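{- There exists $n_0$ such that for every $n\geq n_0$, the maximum of $s_Q(G)$ over all connected graphs $G$ on $n$ vertices is attained by $K_{n-1}^+$, and $K_{n-1}^+$ is, up to isomorphism, the unique connected graph on $n$ vertices attaining this maximum.
   Context: All graphs are finite and simple. The signless Laplacian of a graph $G$ is $Q(G)=D(G)+A(G)$, where $A(G)$ is the adjacency matrix and $D(G)$ the diagonal matrix of vertex degrees; its eigenvalues are $q_1(G)\geq\cdots\geq q_n(G)$. The $Q$-spread of $G$ is $s_Q(G)=q_1(G)-q_n(G)$. $K_{n-1}^+$ is the $n$-vertex graph formed by adding a pendant edge to the complete graph $K_{n-1}$, i.e. by adding one new vertex adjacent to exactly one vertex of $K_{n-1}$. -}

module Defs where

open import Algebra.Bundles using (CommutativeMonoid)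
import Algebra.Properties.CommutativeSemigroup
open import Data.Bool.Base using (Bool; true; false; if_then_else_; not)
open import Data.Fin.Base as Fin using (Fin; zero; suc)
open import Data.Fin.Permutation using (Permutation′; _⟨$⟩ʳ_)
open import Data.Fin.Properties using (_≟_)
open import Data.Fin.Subset using (∣_∣)
open import Data.Integer.Base using (+_)
open import Data.Nat.Base as ℕ using (ℕ; suc; _⊔_)
import Data.Nat.Properties as ℕ
open import Data.Product.Base using (∃; ∃-syntax; Σ-syntax; _×_; _,_)
open import Data.Rational.Base as ℚ using (ℚ; 0ℚ; 1ℚ; ½)
import Data.Rational.Properties as ℚ
open import Data.Vec.Base using (tabulate)
open import Data.Vec.Functional using (Vector; foldr)
open import Relation.Binary.Construct.Closure.ReflexiveTransitive using (Star)
open import Relation.Binary.PropositionalEquality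
  using (_≡_; refl; sym; trans; cong; cong₂; subst; module ≡-Reasoning)
open import Relation.Nullary.Decidable using (does; yes; no)
open import Relation.Nullary.Negation using (contradiction)

-- Real numbers: Cauchy sequences of rationals, with the setoid equality
-- "the difference tends to 0".

∣_∣ℚ : ℚ → ℚ
∣_∣ℚ = ℚ.∣_∣

Cauchy : (ℕ → ℚ) → Set
Cauchy x = ∀ ε → 0ℚ ℚ.< ε →
  ∃[ N ] ∀ m n → N ℕ.≤ m → N ℕ.≤ n → ∣ x m ℚ.- x n ∣ℚ ℚ.≤ ε

record ℝ : Set where
  constructor mkℝ
  field
    seq    : ℕ → ℚ
    cauchy : Cauchy seq

open ℝ public

infix 4 _≈_ _≤_

record _≈_ (x y : ℝ) : Set where
  constructor mk≈
  field
    close : ∀ ε → 0ℚ ℚ.< ε →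
      ∃[ N ] ∀ n → N ℕ.≤ n → ∣ seq x n ℚ.- seq y n ∣ℚ ℚ.≤ ε

-- The slack ε makes this the order on limits: x ≤ y iff not y < x.
record _≤_ (x y : ℝ) : Set where
  constructor mk≤
  field
    below : ∀ ε → 0ℚ ℚ.< ε →
      ∃[ N ] ∀ n → N ℕ.≤ n → seq x n ℚ.≤ seq y n ℚ.+ ε

private abstract
  *-distribˡ-- : ∀ a b c → a ℚ.* (b ℚ.- c) ≡ a ℚ.* b ℚ.- a ℚ.* c
  *-distribˡ-- a b c = trans (ℚ.*-distribˡ-+ a b (ℚ.- c))
    (cong (a ℚ.* b ℚ.+_) (sym (ℚ.neg-distribʳ-* a c)))

  telescope : ∀ a b c → (a ℚ.- b) ℚ.+ (b ℚ.- c) ≡ a ℚ.- c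
  telescope a b c = begin
    (a ℚ.- b) ℚ.+ (b ℚ.- c)        ≡⟨ ℚ.+-assoc a (ℚ.- b) (b ℚ.- c) ⟩
    a ℚ.+ (ℚ.- b ℚ.+ (b ℚ.- c))    ≡⟨ cong (a ℚ.+_) (ℚ.+-assoc (ℚ.- b) b (ℚ.- c)) ⟨
    a ℚ.+ ((ℚ.- b ℚ.+ b) ℚ.- c)    ≡⟨ cong (λ h → a ℚ.+ (h ℚ.- c)) (ℚ.+-inverseˡ b) ⟩
    a ℚ.+ (0ℚ ℚ.- c)               ≡⟨ cong (a ℚ.+_) (ℚ.+-identityˡ (ℚ.- c)) ⟩
    a ℚ.- c                        ∎
    where open ≡-Reasoning

  half-pos : ∀ {ε} → 0ℚ ℚ.< ε → 0ℚ ℚ.< ½ ℚ.* ε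
  half-pos {ε} p = ℚ.positive⁻¹ _ {{ℚ.pos*pos⇒pos ½ ε {{ℚ.positive p}}}}

  halves : ∀ ε → ½ ℚ.* ε ℚ.+ ½ ℚ.* ε ≡ ε
  halves ε = trans (sym (ℚ.*-distribʳ-+ ε ½ ½)) (ℚ.*-identityˡ ε)

  +-cauchy : ∀ x y → Cauchy x → Cauchy y → Cauchy (λ n → x n ℚ.+ y n)
  +-cauchy x y cx cy ε 0<ε
    with cx (½ ℚ.* ε) (half-pos 0<ε) | cy (½ ℚ.* ε) (half-pos 0<ε)
  ... | M , hx | N , hy = M ⊔ N , λ m n m≥ n≥ → begin
    ∣ (x m ℚ.+ y m) ℚ.- (x n ℚ.+ y n) ∣ℚ
      ≡⟨ cong ∣_∣ℚ (lem (x m) (y m) (x n) (y n)) ⟩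
    ∣ (x m ℚ.- x n) ℚ.+ (y m ℚ.- y n) ∣ℚ
      ≤⟨ ℚ.∣p+q∣≤∣p∣+∣q∣ (x m ℚ.- x n) (y m ℚ.- y n) ⟩
    ∣ x m ℚ.- x n ∣ℚ ℚ.+ ∣ y m ℚ.- y n ∣ℚ
      ≤⟨ ℚ.+-mono-≤
           (hx m n (ℕ.m⊔n≤o⇒m≤o M N m≥) (ℕ.m⊔n≤o⇒m≤o M N n≥))
           (hy m n (ℕ.m⊔n≤o⇒n≤o M N m≥) (ℕ.m⊔n≤o⇒n≤o M N n≥)) ⟩
    ½ ℚ.* ε ℚ.+ ½ ℚ.* ε
      ≡⟨ halves ε ⟩
    ε ∎
    where
    open ℚ.≤-Reasoning
    open Algebra.Properties.CommutativeSemigroup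
      (CommutativeMonoid.commutativeSemigroup ℚ.+-0-commutativeMonoid)
      using (interchange)
    lem : ∀ a b c d → (a ℚ.+ b) ℚ.- (c ℚ.+ d) ≡ (a ℚ.- c) ℚ.+ (b ℚ.- d)
    lem a b c d = trans (cong (a ℚ.+ b ℚ.+_) (ℚ.neg-distrib-+ c d))
                        (interchange a b (ℚ.- c) (ℚ.- d))

  neg-cauchy : ∀ x → Cauchy x → Cauchy (λ n → ℚ.- x n)
  neg-cauchy x cx ε 0<ε with cx ε 0<ε
  ... | N , hx = N , λ m n m≥ n≥ →
    subst (ℚ._≤ ε)
      (trans (sym (ℚ.∣-p∣≡∣p∣ (x m ℚ.- x n)))
             (cong ∣_∣ℚ (ℚ.neg-distrib-+ (x m) (ℚ.- x n))))
      (hx m n m≥ n≥)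

  eventually-bounded : ∀ x → Cauchy x →
    ∃[ B ] ∃[ N ] ℚ.Positive B × (∀ n → N ℕ.≤ n → ∣ x n ∣ℚ ℚ.≤ B)
  eventually-bounded x cx with cx 1ℚ (ℚ.positive⁻¹ 1ℚ)
  ... | N , h =
    1ℚ ℚ.+ ∣ x N ∣ℚ , N ,
    ℚ.pos+nonNeg⇒pos 1ℚ ∣ x N ∣ℚ {{ℚ.∣-∣-nonNeg (x N)}} ,
    λ n n≥ → begin
      ∣ x n ∣ℚ                        ≡⟨ cong ∣_∣ℚ (lem (x n) (x N)) ⟩
      ∣ (x n ℚ.- x N) ℚ.+ x N ∣ℚ      ≤⟨ ℚ.∣p+q∣≤∣p∣+∣q∣ (x n ℚ.- x N) (x N) ⟩
      ∣ x n ℚ.- x N ∣ℚ ℚ.+ ∣ x N ∣ℚ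
        ≤⟨ ℚ.+-monoˡ-≤ ∣ x N ∣ℚ (h n N n≥ ℕ.≤-refl) ⟩
      1ℚ ℚ.+ ∣ x N ∣ℚ                 ∎
    where
    open ℚ.≤-Reasoning
    lem : ∀ a b → a ≡ (a ℚ.- b) ℚ.+ b
    lem a b = sym (trans (ℚ.+-assoc a (ℚ.- b) b)
                    (trans (cong (a ℚ.+_) (ℚ.+-inverseˡ b)) (ℚ.+-identityʳ a)))

  quotient : ∀ B → ℚ.Positive B → ∀ δ → 0ℚ ℚ.< δ →
    ∃[ η ] 0ℚ ℚ.< η × B ℚ.* η ≡ δ
  quotient B B>0 δ 0<δ =
    1/B ℚ.* δ ,
    ℚ.positive⁻¹ _ {{ℚ.pos*pos⇒pos 1/B {{ℚ.1/pos⇒pos B}} δ {{ℚ.positive 0<δ}}}} ,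
    trans (sym (ℚ.*-assoc B 1/B δ))
      (trans (cong (ℚ._* δ) (ℚ.*-inverseʳ B)) (ℚ.*-identityˡ δ))
    where
    instance
      pos : ℚ.Positive B
      pos = B>0
      nonZero : ℚ.NonZero B
      nonZero = ℚ.pos⇒nonZero B
    1/B : ℚ
    1/B = ℚ.1/ B

  *-bound : ∀ a b {A η} → ℚ.Positive A → ∣ a ∣ℚ ℚ.≤ A → ∣ b ∣ℚ ℚ.≤ η →
    ∣ a ℚ.* b ∣ℚ ℚ.≤ A ℚ.* η
  *-bound a b {A} {η} A>0 a≤ b≤ = begin
    ∣ a ℚ.* b ∣ℚ        ≡⟨ ℚ.∣p*q∣≡∣p∣*∣q∣ a b ⟩
    ∣ a ∣ℚ ℚ.* ∣ b ∣ℚ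
      ≤⟨ ℚ.*-monoʳ-≤-nonNeg ∣ b ∣ℚ {{ℚ.∣-∣-nonNeg b}} a≤ ⟩
    A ℚ.* ∣ b ∣ℚ
      ≤⟨ ℚ.*-monoˡ-≤-nonNeg A {{ℚ.pos⇒nonNeg A {{A>0}}}} b≤ ⟩
    A ℚ.* η             ∎
    where open ℚ.≤-Reasoning

  *-cauchy : ∀ x y → Cauchy x → Cauchy y → Cauchy (λ n → x n ℚ.* y n)
  *-cauchy x y cx cy ε 0<ε
    with eventually-bounded x cx | eventually-bounded y cy
  ... | A , K , A>0 , x≤A | B , L , B>0 , y≤B
    with quotient A A>0 (½ ℚ.* ε) (half-pos 0<ε)
       | quotient B B>0 (½ ℚ.* ε) (half-pos 0<ε)
  ... | α , 0<α , Aα | β , 0<β , Bβ with cx β 0<β | cy α 0<α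
  ... | M , hx | N , hy =
    (K ⊔ L) ⊔ (M ⊔ N) , λ m n m≥ n≥ → begin
      ∣ x m ℚ.* y m ℚ.- x n ℚ.* y n ∣ℚ
        ≡⟨ cong ∣_∣ℚ (lem (x m) (y m) (x n) (y n)) ⟩
      ∣ x m ℚ.* (y m ℚ.- y n) ℚ.+ y n ℚ.* (x m ℚ.- x n) ∣ℚ
        ≤⟨ ℚ.∣p+q∣≤∣p∣+∣q∣ (x m ℚ.* (y m ℚ.- y n)) (y n ℚ.* (x m ℚ.- x n)) ⟩
      ∣ x m ℚ.* (y m ℚ.- y n) ∣ℚ ℚ.+ ∣ y n ℚ.* (x m ℚ.- x n) ∣ℚ
        ≤⟨ ℚ.+-mono-≤
             (*-bound (x m) (y m ℚ.- y n) A>0 (x≤A m (≥K m≥)) (hy m n (≥N m≥) (≥N n≥)))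
             (*-bound (y n) (x m ℚ.- x n) B>0 (y≤B n (≥L n≥)) (hx m n (≥M m≥) (≥M n≥))) ⟩
      A ℚ.* α ℚ.+ B ℚ.* β
        ≡⟨ cong₂ ℚ._+_ Aα Bβ ⟩
      ½ ℚ.* ε ℚ.+ ½ ℚ.* ε
        ≡⟨ halves ε ⟩
      ε ∎
    where
    open ℚ.≤-Reasoning
    lem : ∀ a b c d →
      a ℚ.* b ℚ.- c ℚ.* d ≡ a ℚ.* (b ℚ.- d) ℚ.+ d ℚ.* (a ℚ.- c)
    lem a b c d = sym (begin-equality
      a ℚ.* (b ℚ.- d) ℚ.+ d ℚ.* (a ℚ.- c)
        ≡⟨ cong₂ ℚ._+_ (*-distribˡ-- a b d) (*-distribˡ-- d a c) ⟩
      (a ℚ.* b ℚ.- a ℚ.* d) ℚ.+ (d ℚ.* a ℚ.- d ℚ.* c)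
        ≡⟨ cong₂ (λ p q → (a ℚ.* b ℚ.- a ℚ.* d) ℚ.+ (p ℚ.- q))
             (ℚ.*-comm d a) (ℚ.*-comm d c) ⟩
      (a ℚ.* b ℚ.- a ℚ.* d) ℚ.+ (a ℚ.* d ℚ.- c ℚ.* d)
        ≡⟨ telescope (a ℚ.* b) (a ℚ.* d) (c ℚ.* d) ⟩
      a ℚ.* b ℚ.- c ℚ.* d ∎)
    ≥K : ∀ {m} → (K ⊔ L) ⊔ (M ⊔ N) ℕ.≤ m → K ℕ.≤ m
    ≥K h = ℕ.m⊔n≤o⇒m≤o K L (ℕ.m⊔n≤o⇒m≤o (K ⊔ L) (M ⊔ N) h)
    ≥L : ∀ {m} → (K ⊔ L) ⊔ (M ⊔ N) ℕ.≤ m → L ℕ.≤ m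
    ≥L h = ℕ.m⊔n≤o⇒n≤o K L (ℕ.m⊔n≤o⇒m≤o (K ⊔ L) (M ⊔ N) h)
    ≥M : ∀ {m} → (K ⊔ L) ⊔ (M ⊔ N) ℕ.≤ m → M ℕ.≤ m
    ≥M h = ℕ.m⊔n≤o⇒m≤o M N (ℕ.m⊔n≤o⇒n≤o (K ⊔ L) (M ⊔ N) h)
    ≥N : ∀ {m} → (K ⊔ L) ⊔ (M ⊔ N) ℕ.≤ m → N ℕ.≤ m
    ≥N h = ℕ.m⊔n≤o⇒n≤o M N (ℕ.m⊔n≤o⇒n≤o (K ⊔ L) (M ⊔ N) h)

infixl 6 _+_ _-_
infixl 7 _*_

fromℚ : ℚ → ℝ
fromℚ q = mkℝ (λ _ → q) λ ε 0<ε →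
  0 , λ _ _ _ _ →
    subst (ℚ._≤ ε) (sym (cong ∣_∣ℚ (ℚ.+-inverseʳ q))) (ℚ.<⇒≤ 0<ε)

fromℕ : ℕ → ℝ
fromℕ k = fromℚ (+ k ℚ./ 1)

0ℝ 1ℝ : ℝ
0ℝ = fromℚ 0ℚ
1ℝ = fromℚ 1ℚ

_+_ _-_ _*_ : ℝ → ℝ → ℝ
x + y = mkℝ (λ n → seq x n ℚ.+ seq y n)
  (+-cauchy (seq x) (seq y) (cauchy x) (cauchy y))
x - y = mkℝ (λ n → seq x n ℚ.- seq y n)
  (+-cauchy (seq x) (λ n → ℚ.- seq y n) (cauchy x) (neg-cauchy (seq y) (cauchy y)))
x * y = mkℝ (λ n → seq x n ℚ.* seq y n)
  (*-cauchy (seq x) (seq y) (cauchy x) (cauchy y))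

∑ : ∀ {n} → Vector ℝ n → ℝ
∑ = foldr _+_ 0ℝ

Matrix : ℕ → Set
Matrix n = Fin n → Fin n → ℝ

_·_ : ∀ {n} → Matrix n → Vector ℝ n → Vector ℝ n
(M · v) i = ∑ λ j → M i j * v j

LinearlyIndependent : ∀ {k n} → (Fin k → Vector ℝ n) → Set
LinearlyIndependent {k} v =
  ∀ (c : Vector ℝ k) → (∀ j → ∑ (λ i → c i * v i j) ≈ 0ℝ) → ∀ i → c i ≈ 0ℝ

-- q lists the eigenvalues of the diagonalisable matrix M in nonincreasing
-- order, each repeated according to its multiplicity.
record Eigenvalues {n} (M : Matrix n) (q : Fin n → ℝ) : Set where
  field
    nonincreasing : ∀ {i j} → i Fin.≤ j → q j ≤ q i
    vectors       : Fin n → Vector ℝ n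
    independent   : LinearlyIndependent vectors
    eigen         : ∀ i k → (M · vectors i) k ≈ q i * vectors i k

record Graph (n : ℕ) : Set where
  field
    adj    : Fin n → Fin n → Bool
    symm   : ∀ i j → adj i j ≡ adj j i
    irrefl : ∀ i → adj i i ≡ false

  degree : Fin n → ℕ
  degree i = ∣ tabulate (adj i) ∣

  Connected : Set
  Connected = ∀ i j → Star (λ u v → adj u v ≡ true) i j

open Graph public using (adj; degree; Connected)

infix 4 _≅_

_≅_ : ∀ {n} → Graph n → Graph n → Set
_≅_ {n} G H =
  Σ[ π ∈ Permutation′ n ] ∀ i j → adj G i j ≡ adj H (π ⟨$⟩ʳ i) (π ⟨$⟩ʳ j)

complete : ∀ n → Graph n
complete n = record { adj = a ; symm = a-sym ; irrefl = a-irrefl }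
  where
  a : Fin n → Fin n → Bool
  a i j = not (does (i ≟ j))

  a-sym : ∀ i j → a i j ≡ a j i
  a-sym i j with i ≟ j | j ≟ i
  ... | yes _   | yes _   = refl
  ... | no _    | no _    = refl
  ... | yes i≡j | no j≢i  = contradiction (sym i≡j) j≢i
  ... | no i≢j  | yes j≡i = contradiction (sym j≡i) i≢j

  a-irrefl : ∀ i → a i i ≡ false
  a-irrefl i with i ≟ i
  ... | yes _  = refl
  ... | no i≢i = contradiction refl i≢i

-- The new vertex is zero; the vertices of G are shifted by suc.
addPendant : ∀ {n} → Graph n → Fin n → Graph (suc n)
addPendant {n} G v = record { adj = a ; symm = a-sym ; irrefl = a-irrefl }
  where
  a : Fin (suc n) → Fin (suc n) → Bool
  a zero    zero    = false
  a zero    (suc j) = does (j ≟ v)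
  a (suc i) zero    = does (i ≟ v)
  a (suc i) (suc j) = adj G i j

  a-sym : ∀ i j → a i j ≡ a j i
  a-sym zero    zero    = refl
  a-sym zero    (suc j) = refl
  a-sym (suc i) zero    = refl
  a-sym (suc i) (suc j) = Graph.symm G i j

  a-irrefl : ∀ i → a i i ≡ false
  a-irrefl zero    = refl
  a-irrefl (suc i) = Graph.irrefl G i

-- K⁺ m is K_{n-1}^+ for n = m + 2; the clique K_{n-1} needs a vertex to
-- carry the pendant edge, so n ≥ 2.
K⁺ : ∀ m → Graph (2 ℕ.+ m)
K⁺ m = addPendant (complete (1 ℕ.+ m)) zero

A D Q : ∀ {n} → Graph n → Matrix n
A G i j = if adj G i j then 1ℝ else 0ℝ
D G i j = if does (i ≟ j) then fromℕ (degree G i) else 0ℝ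
Q G i j = D G i j + A G i j

-- s is the Q-spread q₁ - qₙ of G.  A relation, since the eigenvalues are
-- specified rather than computed; by the spectral theorem for the symmetric
-- integer matrix Q G there is exactly one such s up to ≈.
QSpread : ∀ {n} → Graph (suc n) → ℝ → Set
QSpread {n} G s =
  ∃[ q ] Eigenvalues (Q G) q × s ≈ q zero - q (Fin.fromℕ n)

AttainsMaximum : ∀ {n} → Graph (suc n) → ℝ → Set
AttainsMaximum {n} G s =
  Connected G × QSpread G s ×
  (∀ (H : Graph (suc n)) → Connected H → ∀ t → QSpread H t → t ≤ s)

{-# OPTIONS --safe #-}

-- Write E(x) = xᵀ Q(G) x, h for degrees in the complement H, and S = Σ h.
-- Weighting AM-GM by the degrees gives E(x) ≤ max (d + (Σ of d over the
-- neighbours)/d) |x|², which is at most (2(n - 1) - S/(n - 1)) |x|². Hence a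
-- spread above 2n - 5 forces S < 3(n - 1). If all degrees of G exceed 7, the
-- same estimate for H gives Q(H) ≤ n - 6, so the least eigenvalue of G is at
-- least 4 and the spread is too small. Otherwise some z has degree k ≤ 7; with
-- F the degree sum of the complement of G - z, the estimate for that complement
-- gives Q(G - z) ≥ n - 4 - F/2, and completing squares at z bounds the least
-- eigenvalue of G below by k - k/(n - 3 - F/2 - k). Unless k = 1 and F = 0,
-- which means G ≅ K⁺, the spread is at most 2n - 5 + 3/(2(n - 2)), whereas K⁺
-- has spread √((2n - 5)² + 8), with eigenvalues n - 2, n - 3 (n - 3 times) and
-- (2n - 3 ± √((2n - 5)² + 8))/2.
--
-- All bounds on E are proved for rational vectors; they pass to the eigenvalues
-- because a real eigenvector is a limit of rational vectors.

module Submission where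

open import Algebra.Bundles using (Semiring; CommutativeRing)
import Algebra.Properties.Semiring.Sum
open import Data.Bool.Base using (Bool; true; false; if_then_else_; not; _∨_)
open import Data.Fin.Base as Fin using (Fin; zero; suc; punchIn; punchOut)
open import Data.Fin.Permutation as Perm using (Permutation′; _⟨$⟩ʳ_; insert; insert-punchIn; inverseˡ)
open import Data.Fin.Properties using (_≟_; any?; punchInᵢ≢i; punchIn-punchOut; ≤-antisym; ≤fromℕ)
open import Data.Fin.Subset using (∣_∣)
import Data.Integer.Base as ℤ
import Data.Integer.Properties as ℤ
import Data.Nat.Base
open import Data.Nat.Base as ℕ using (ℕ; zero; suc)
import Data.Nat.Coprimality as Coprimality
import Data.Nat.Properties as ℕ
open import Data.Nat.Tactic.RingSolver as ℕ-Solver using ()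
open import Data.Product.Base using (∃-syntax; _×_; _,_; proj₁; proj₂)
import Data.Rational.Base
open import Data.Rational.Base as ℚ using (ℚ)
import Data.Rational.Properties as ℚ
open import Data.Sum.Base using (_⊎_; inj₁; inj₂; [_,_]′)
open import Data.Vec.Base using (tabulate)
open import Data.Vec.Functional using (Vector)
open import Defs using (Graph; adj; degree; Connected; Cauchy; ∣_∣ℚ; ℝ; mkℝ; seq; cauchy; K⁺)
open import Function.Base using (_∘_; id; _⟨_⟩_)
open import Level using (0ℓ)
open import Relation.Binary.Construct.Closure.ReflexiveTransitive using (Star; _◅_; _◅◅_) renaming (ε to done)
open import Relation.Binary.PropositionalEquality
  using (_≡_; _≢_; refl; sym; trans; cong; cong₂; subst; subst₂; module ≡-Reasoning)
open import Relation.Nullary.Decidable using (Dec; does; yes; no)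
open import Relation.Nullary.Decidable.Core using (dec⇒maybe)
open import Relation.Nullary.Negation using (contradiction; ¬_)
open import Tactic.RingSolver using (solve-∀)
open import Tactic.RingSolver.Core.AlmostCommutativeRing using (AlmostCommutativeRing; fromCommutativeRing)

-- Reals are known only through their approximants and their order is not decidable, so every
-- comparison is arranged to take place between rationals. `classify` decides by comparing natural
-- numbers, and its second outcome carries rational bounds. The value `threshold m` stays below
-- every approximant of the spread of `K⁺` by the fixed margin `1/(4m)`; uniqueness rests on this
-- margin. There is room for it because, to first order, the spread of `K⁺` is `2m - 1 + 8/(4m)`,
-- while the threshold is `2m - 1 + 6/(4m)`. An arbitrary graph brings its eigenvectors with it, as
-- part of `QSpread`. For `K⁺` they have to be exhibited: `AttainsMaximum` asks for an eigenbasis,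
-- and its independence must be shown for coefficients that are Cauchy sequences, with null
-- sequences in place of zeros.

module _ {c ℓ} (R : Semiring c ℓ) where
  open Semiring R using (Carrier; _≈_; _*_; 0#; +-cong; zeroˡ; +-identityˡ; +-identityʳ)
    renaming (refl to ≈-refl; trans to ≈-trans)
  open Algebra.Properties.Semiring.Sum R

  -- Stated over any semiring because it serves counting over `ℕ`, sums over `ℚ`, and combinations
  -- over `ℝ` with its setoid equality.
  sum-select : ∀ {n} (i : Fin n) a (f : Vector Carrier n) →
    sum (λ j → (if does (i ≟ j) then a else 0#) * f j) ≈ a * f i
  sum-select {suc n} zero a f = ≈-trans
    (+-cong ≈-refl (≈-trans (sum-cong-≋ (λ j → zeroˡ (f (suc j)))) (sum-replicate-zero n)))
    (+-identityʳ (a * f zero))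
  sum-select {suc n} (suc i) a f = ≈-trans
    (+-cong (zeroˡ (f zero)) (sum-select i a (λ j → f (suc j))))
    (+-identityˡ (a * f (suc i)))

-- Complements and vertex deletion.

complement : ∀ {n} → Graph n → Graph n
complement {n} G = record { adj = a ; symm = a-sym ; irrefl = a-irrefl }
  where
  a : Fin n → Fin n → Bool
  a i j = not (adj G i j ∨ does (i ≟ j))

  a-sym : ∀ i j → a i j ≡ a j i
  a-sym i j rewrite Graph.symm G i j with i ≟ j | j ≟ i
  ... | yes _   | yes _   = refl
  ... | no _    | no _    = refl
  ... | yes i≡j | no j≢i  = contradiction (sym i≡j) j≢i
  ... | no i≢j  | yes j≡i = contradiction (sym j≡i) i≢j

  a-irrefl : ∀ i → a i i ≡ false
  a-irrefl i rewrite Graph.irrefl G i with i ≟ i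
  ... | yes _  = refl
  ... | no i≢i = contradiction refl i≢i

infixl 6 _∖_

_∖_ : ∀ {n} → Graph (suc n) → Fin (suc n) → Graph n
G ∖ z = record
  { adj    = λ i j → adj G (punchIn z i) (punchIn z j)
  ; symm   = λ i j → Graph.symm G (punchIn z i) (punchIn z j)
  ; irrefl = λ i → Graph.irrefl G (punchIn z i)
  }

-- Degree sums of a graph and of its complement.

module Counting where
  open Data.Nat.Base using (_+_; _*_; _≤_; z≤n)
  open Algebra.Properties.Semiring.Sum ℕ.+-*-semiring public

  𝟙 : Bool → ℕ
  𝟙 b = if b then 1 else 0

  𝟙≤1 : ∀ b → 𝟙 b ≤ 1
  𝟙≤1 true  = ℕ.≤-refl
  𝟙≤1 false = z≤n

  sum-mono : ∀ {n} {f g : Vector ℕ n} → (∀ i → f i ≤ g i) → sum f ≤ sum g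
  sum-mono {zero}  f≤g = z≤n
  sum-mono {suc n} f≤g = ℕ.+-mono-≤ (f≤g zero) (sum-mono (λ i → f≤g (suc i)))

  sum-const : ∀ n c → sum {n} (λ _ → c) ≡ n * c
  sum-const zero    c = refl
  sum-const (suc n) c = cong (c +_) (sum-const n c)

  term≤sum : ∀ {n} (f : Vector ℕ n) i → f i ≤ sum f
  term≤sum {suc n} f zero    = ℕ.m≤m+n (f zero) _
  term≤sum {suc n} f (suc i) =
    ℕ.≤-trans (term≤sum (λ j → f (suc j)) i) (ℕ.m≤n+m _ (f zero))

  sum-pick : ∀ {n} (i : Fin n) (f : Vector ℕ n) → sum (λ j → 𝟙 (does (i ≟ j)) * f j) ≡ f i
  sum-pick i f = trans (sum-select ℕ.+-*-semiring i 1 f) (ℕ.+-identityʳ (f i))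

  sum-pick-1 : ∀ {n} (i : Fin n) → sum (λ j → 𝟙 (does (i ≟ j))) ≡ 1
  sum-pick-1 i =
    trans (sum-cong-≗ (λ j → sym (ℕ.*-identityʳ (𝟙 (does (i ≟ j)))))) (sum-pick i (λ _ → 1))

  edge : ∀ {n} → Graph n → Fin n → Fin n → ℕ
  edge G i j = 𝟙 (adj G i j)

  deg : ∀ {n} → Graph n → Fin n → ℕ
  deg G i = sum (edge G i)

  nbrSum : ∀ {n} → Graph n → Vector ℕ n → Vector ℕ n
  nbrSum G f i = sum λ j → edge G i j * f j

  total : ∀ {n} → Graph n → ℕ
  total G = sum (deg G)

  degree≡deg : ∀ {n} (G : Graph n) i → degree G i ≡ deg G i
  degree≡deg G i = lemma (adj G i)
    where
    lemma : ∀ {n} (f : Fin n → Bool) → ∣ tabulate f ∣ ≡ sum (λ j → 𝟙 (f j))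
    lemma {zero}  f = refl
    lemma {suc n} f with f zero
    ... | true  = cong suc (lemma (λ j → f (suc j)))
    ... | false = lemma (λ j → f (suc j))

  edge-symm : ∀ {n} (G : Graph n) i j → edge G i j ≡ edge G j i
  edge-symm G i j = cong 𝟙 (Graph.symm G i j)

  edge-irrefl : ∀ {n} (G : Graph n) i → edge G i i ≡ 0
  edge-irrefl G i = cong 𝟙 (Graph.irrefl G i)

  edge-complement : ∀ {n} (G : Graph n) i j →
    edge (complement G) i j + edge G i j + 𝟙 (does (i ≟ j)) ≡ 1
  edge-complement G i j with i ≟ j
  ... | yes refl rewrite Graph.irrefl G i = refl
  ... | no _ with adj G i j
  ...   | true  = refl
  ...   | false = refl

  deg-complement : ∀ {n} (G : Graph n) i → deg (complement G) i + deg G i + 1 ≡ n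
  deg-complement {n} G i = begin
    deg (complement G) i + deg G i + 1
      ≡⟨ cong₂ _+_ (∑-distrib-+ (edge (complement G) i) (edge G i)) (sum-pick-1 i) ⟨
    sum (λ j → edge (complement G) i j + edge G i j) + sum (λ j → 𝟙 (does (i ≟ j)))
      ≡⟨ ∑-distrib-+ (λ j → edge (complement G) i j + edge G i j) (λ j → 𝟙 (does (i ≟ j))) ⟨
    sum (λ j → edge (complement G) i j + edge G i j + 𝟙 (does (i ≟ j)))
      ≡⟨ sum-cong-≗ (edge-complement G i) ⟩
    sum {n} (λ _ → 1)
      ≡⟨ trans (sum-const n 1) (ℕ.*-identityʳ n) ⟩
    n ∎
    where open ≡-Reasoning

  deg-complement′ : ∀ {N} (G : Graph (suc N)) i → deg (complement G) i + deg G i ≡ N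
  deg-complement′ G i = ℕ.+-cancelʳ-≡ 1 _ _ (trans (deg-complement G i) (ℕ.+-comm 1 _))

  deg-positive : ∀ {m} (G : Graph (2 + m)) → Connected G → ∀ i → 1 ≤ deg G i
  deg-positive G conn i = first-step (conn i (punchIn i zero)) (λ eq → punchInᵢ≢i i zero (sym eq))
    where
    first-step : ∀ {j} → Star (λ u v → adj G u v ≡ true) i j → i ≢ j → 1 ≤ deg G i
    first-step done         i≢i = contradiction refl i≢i
    first-step (_◅_ {j = u} e _) _ = subst (_≤ deg G i) (cong 𝟙 e) (term≤sum (edge G i) u)

  total-complement : ∀ {N} (G : Graph (suc N)) →
    total (complement G) + total G ≡ suc N * N
  total-complement {N} G = begin
    total (complement G) + total G
      ≡⟨ ∑-distrib-+ (deg (complement G)) (deg G) ⟨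
    sum (λ i → deg (complement G) i + deg G i)
      ≡⟨ sum-cong-≗ (deg-complement′ G) ⟩
    sum {suc N} (λ _ → N)
      ≡⟨ sum-const (suc N) N ⟩
    suc N * N ∎
    where open ≡-Reasoning

  deg-remove : ∀ {n} (G : Graph (suc n)) z i →
    deg G i ≡ edge G i z + sum (λ j → edge G i (punchIn z j))
  deg-remove G z i = sum-remove {i = z} (edge G i)

  total-remove : ∀ {n} (G : Graph (suc n)) z → total G ≡ 2 * deg G z + total (G ∖ z)
  total-remove G z = begin
    total G
      ≡⟨ sum-remove {i = z} (deg G) ⟩
    deg G z + sum (λ i → deg G (punchIn z i))
      ≡⟨ cong (deg G z +_) (sum-cong-≗ λ i → deg-remove G z (punchIn z i)) ⟩
    deg G z + sum (λ i → edge G (punchIn z i) z + deg (G ∖ z) i)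
      ≡⟨ cong (deg G z +_) (∑-distrib-+ (λ i → edge G (punchIn z i) z) (deg (G ∖ z))) ⟩
    deg G z + (sum (λ i → edge G (punchIn z i) z) + total (G ∖ z))
      ≡⟨ cong (λ h → deg G z + (h + total (G ∖ z))) column ⟩
    deg G z + (deg G z + total (G ∖ z))
      ≡⟨ rearrange (deg G z) (total (G ∖ z)) ⟩
    2 * deg G z + total (G ∖ z) ∎
    where
    open ≡-Reasoning
    rearrange : ∀ a b → a + (a + b) ≡ 2 * a + b
    rearrange = ℕ-Solver.solve-∀
    column : sum (λ i → edge G (punchIn z i) z) ≡ deg G z
    column = begin
      sum (λ i → edge G (punchIn z i) z)   ≡⟨ sum-cong-≗ (λ i → edge-symm G (punchIn z i) z) ⟩
      sum (λ i → edge G z (punchIn z i))   ≡⟨ cong (_+ sum (λ i → edge G z (punchIn z i))) (edge-irrefl G z) ⟨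
      edge G z z + sum (λ i → edge G z (punchIn z i)) ≡⟨ deg-remove G z z ⟨
      deg G z ∎

  -- Deleting z loses the N - deg z non-edges at z, each counted twice.
  total-complement-remove : ∀ {M} (G : Graph (2 + M)) z →
    total (complement G) + 2 * deg G z ≡ total (complement (G ∖ z)) + 2 * suc M
  total-complement-remove {M} G z = ℕ.+-cancelʳ-≡ T _ _ (begin
    total (complement G) + 2 * d + T
      ≡⟨ ℕ.+-assoc (total (complement G)) (2 * d) T ⟩
    total (complement G) + (2 * d + T)
      ≡⟨ cong (total (complement G) +_) (total-remove G z) ⟨
    total (complement G) + total G
      ≡⟨ total-complement G ⟩
    (2 + M) * (1 + M)
      ≡⟨ rearrange₁ M ⟩
    suc M * M + 2 * suc M
      ≡⟨ cong (_+ 2 * suc M) (total-complement (G ∖ z)) ⟨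
    total (complement (G ∖ z)) + T + 2 * suc M
      ≡⟨ rearrange₂ (total (complement (G ∖ z))) T (2 * suc M) ⟩
    total (complement (G ∖ z)) + 2 * suc M + T ∎)
    where
    open ≡-Reasoning
    d = deg G z
    T = total (G ∖ z)
    rearrange₁ : ∀ M → (2 + M) * (1 + M) ≡ (1 + M) * M + 2 * (1 + M)
    rearrange₁ = ℕ-Solver.solve-∀
    rearrange₂ : ∀ a b c → a + b + c ≡ a + c + b
    rearrange₂ = ℕ-Solver.solve-∀

  nbrSum-≤ : ∀ {n} (G : Graph n) (f : Vector ℕ n) c i →
    (∀ j → adj G i j ≡ true → f j ≤ c) → nbrSum G f i ≤ deg G i * c
  nbrSum-≤ G f c i f≤c = ℕ.≤-trans (sum-mono pointwise)
    (ℕ.≤-reflexive (sym (*-distribʳ-sum c (edge G i))))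
    where
    pointwise : ∀ j → edge G i j * f j ≤ edge G i j * c
    pointwise j with adj G i j in eq
    ... | true  = ℕ.+-monoˡ-≤ 0 (f≤c j eq)
    ... | false = z≤n

  nbrSum-total : ∀ {n} (G : Graph n) (f : Vector ℕ n) i → nbrSum G f i + f i ≤ sum f
  nbrSum-total G f i = begin
    nbrSum G f i + f i
      ≡⟨ cong (nbrSum G f i +_) (sum-pick i f) ⟨
    nbrSum G f i + sum (λ j → 𝟙 (does (i ≟ j)) * f j)
      ≡⟨ ∑-distrib-+ (λ j → edge G i j * f j) (λ j → 𝟙 (does (i ≟ j)) * f j) ⟨
    sum (λ j → edge G i j * f j + 𝟙 (does (i ≟ j)) * f j)
      ≤⟨ sum-mono pointwise ⟩
    sum f ∎
    where
    open ℕ.≤-Reasoning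
    pointwise : ∀ j → edge G i j * f j + 𝟙 (does (i ≟ j)) * f j ≤ f j
    pointwise j with i ≟ j
    ... | yes refl rewrite Graph.irrefl G i = ℕ.≤-reflexive (ℕ.+-identityʳ (f i))
    ... | no _ with adj G i j
    ...   | true  = ℕ.≤-reflexive (trans (ℕ.+-identityʳ _) (ℕ.+-identityʳ (f j)))
    ...   | false = z≤n

  -- Feng and Yu: d + m ≤ 2|E|/(n - 1) + n - 2 for a vertex of degree d whose
  -- neighbours have average degree m, written with the non-edges.
  degree-condition-complement : ∀ {N} (G : Graph (suc N)) → (∀ i → 1 ≤ deg G i) → ∀ i →
    N * (deg G i * deg G i + nbrSum G (deg G) i) + total (complement G) * deg G i
      ≤ 2 * N * N * deg G i
  degree-condition-complement {N} G d≥1 i = begin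
    N * (d * d + P) + S * d
      ≤⟨ ℕ.+-monoʳ-≤ (N * (d * d + P)) (ℕ.*-monoˡ-≤ d S≤) ⟩
    N * (d * d + P) + (T + h i * N) * d
      ≡⟨ rearrange₁ N d P T (h i) ⟩
    T * d + (N * (d * d + P) + h i * N * d)
      ≤⟨ ℕ.+-monoˡ-≤ _ (ℕ.*-monoʳ-≤ T d≤N) ⟩
    T * N + (N * (d * d + P) + h i * N * d)
      ≡⟨ rearrange₂ N d P T (h i) ⟩
    N * (h i + d) * d + N * (P + T)
      ≡⟨ cong₂ (λ p q → N * p * d + N * q) (deg-complement′ G i) P+T ⟩
    N * N * d + N * (d * N)
      ≡⟨ rearrange₃ N d ⟩
    2 * N * N * d ∎
    where
    open ℕ.≤-Reasoning
    H = complement G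
    h = deg H
    S = total H
    d = deg G i
    P = nbrSum G (deg G) i
    T = nbrSum G h i
    B = nbrSum H h i
    rearrange₁ : ∀ N d P T h →
      N * (d * d + P) + (T + h * N) * d ≡ T * d + (N * (d * d + P) + h * N * d)
    rearrange₁ = ℕ-Solver.solve-∀
    rearrange₂ : ∀ N d P T h →
      T * N + (N * (d * d + P) + h * N * d) ≡ N * (h + d) * d + N * (P + T)
    rearrange₂ = ℕ-Solver.solve-∀
    rearrange₃ : ∀ N d → N * N * d + N * (d * N) ≡ 2 * N * N * d
    rearrange₃ = ℕ-Solver.solve-∀
    d≤N : d ≤ N
    d≤N = subst (d ≤_) (deg-complement′ G i) (ℕ.m≤n+m d (h i))
    P+T : P + T ≡ d * N
    P+T = begin-equality
      P + T
        ≡⟨ ∑-distrib-+ (λ j → edge G i j * deg G j) (λ j → edge G i j * h j) ⟨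
      sum (λ j → edge G i j * deg G j + edge G i j * h j)
        ≡⟨ sum-cong-≗ (λ j → trans (sym (ℕ.*-distribˡ-+ (edge G i j) (deg G j) (h j)))
             (cong (edge G i j *_) (trans (ℕ.+-comm (deg G j) (h j)) (deg-complement′ G j)))) ⟩
      sum (λ j → edge G i j * N)
        ≡⟨ *-distribʳ-sum N (edge G i) ⟨
      d * N ∎
    -- Each vertex is a non-neighbour of `i`, a neighbour of `i`, or `i` itself.
    B+T+h : B + T + h i ≡ S
    B+T+h = begin-equality
      B + T + h i
        ≡⟨ cong₂ _+_ (∑-distrib-+ (λ j → edge H i j * h j) (λ j → edge G i j * h j)) (sum-pick i h) ⟨
      sum (λ j → edge H i j * h j + edge G i j * h j) + sum (λ j → 𝟙 (does (i ≟ j)) * h j)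
        ≡⟨ ∑-distrib-+ (λ j → edge H i j * h j + edge G i j * h j) (λ j → 𝟙 (does (i ≟ j)) * h j) ⟨
      sum (λ j → edge H i j * h j + edge G i j * h j + 𝟙 (does (i ≟ j)) * h j)
        ≡⟨ sum-cong-≗ (λ j → trans (factor (edge H i j) (edge G i j) _ (h j))
             (trans (cong (_* h j) (edge-complement G i j)) (ℕ.+-identityʳ (h j)))) ⟩
      S ∎
      where
      factor : ∀ a b c x → a * x + b * x + c * x ≡ (a + b + c) * x
      factor = ℕ-Solver.solve-∀
    -- Each of the `h i` non-neighbours `j` has `h j + 1 ≤ N` because it has a neighbour in `G`; the
    -- summand `h i` on the left supplies these ones.
    B+h : B + h i ≤ h i * N
    B+h = begin
      B + h i
        ≡⟨ ∑-distrib-+ (λ j → edge H i j * h j) (edge H i) ⟨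
      sum (λ j → edge H i j * h j + edge H i j)
        ≡⟨ sum-cong-≗ (λ j → factor (edge H i j) (h j)) ⟩
      nbrSum H (λ j → h j + 1) i
        ≤⟨ nbrSum-≤ H (λ j → h j + 1) N i (λ j _ →
             subst (h j + 1 ≤_) (deg-complement′ G j) (ℕ.+-monoʳ-≤ (h j) (d≥1 j))) ⟩
      h i * N ∎
      where
      factor : ∀ a x → a * x + a ≡ a * (x + 1)
      factor = ℕ-Solver.solve-∀
    S≤ : S ≤ T + h i * N
    S≤ = begin
      S                ≡⟨ B+T+h ⟨
      B + T + h i      ≡⟨ swap B T (h i) ⟩
      T + (B + h i)    ≤⟨ ℕ.+-monoʳ-≤ T B+h ⟩
      T + h i * N      ∎
      where
      swap : ∀ a b c → a + b + c ≡ b + (a + c)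
      swap = ℕ-Solver.solve-∀

  -- A degree is at most 3 or at least 4; the second bound is
  -- (h - 4)(M - h) ≥ 0.
  degree-condition-sparse : ∀ {n} (H : Graph n) M → (∀ j → deg H j ≤ M) →
    total H ≤ 4 * M → ∀ i →
    deg H i * deg H i + nbrSum H (deg H) i ≤ (M + 3) * deg H i
  degree-condition-sparse H M h≤M S≤4M i with deg H i ℕ.≤? 3
  ... | yes h≤3 = begin
    h * h + nbrSum H (deg H) i ≤⟨ ℕ.+-mono-≤ (ℕ.*-monoˡ-≤ h h≤3) (nbrSum-≤ H (deg H) M i (λ j _ → h≤M j)) ⟩
    3 * h + h * M              ≡⟨ rearrange h M ⟩
    (M + 3) * h                ∎
    where
    open ℕ.≤-Reasoning
    h = deg H i
    rearrange : ∀ h M → 3 * h + h * M ≡ (M + 3) * h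
    rearrange = ℕ-Solver.solve-∀
  ... | no h≰3 = ℕ.+-cancelʳ-≤ h _ _ (begin
    h * h + B + h                ≡⟨ ℕ.+-assoc (h * h) B h ⟩
    h * h + (B + h)              ≤⟨ ℕ.+-monoʳ-≤ (h * h) (nbrSum-total H (deg H) i) ⟩
    h * h + total H              ≤⟨ ℕ.+-monoʳ-≤ (h * h) S≤4M ⟩
    h * h + 4 * M                ≤⟨ convex ⟩
    (M + 3) * h + h              ∎)
    where
    open ℕ.≤-Reasoning
    h = deg H i
    B = nbrSum H (deg H) i
    4≤h : 4 ≤ h
    4≤h = ℕ.≰⇒> h≰3
    convex : h * h + 4 * M ≤ (M + 3) * h + h
    convex with ℕ.m≤n⇒∃[o]m+o≡n 4≤h | ℕ.m≤n⇒∃[o]m+o≡n (h≤M i)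
    ... | x , eq | y , eq′ rewrite sym eq′ | sym eq =
      ℕ.≤-trans (ℕ.m≤m+n _ (x * y)) (ℕ.≤-reflexive (expand x y))
      where
      expand : ∀ x y → (4 + x) * (4 + x) + 4 * (4 + x + y) + x * y
                       ≡ (4 + x + y + 3) * (4 + x) + (4 + x)
      expand = ℕ-Solver.solve-∀

  two-edges≤deg : ∀ {n} (H : Graph n) v {i j} → i ≢ j → edge H v i + edge H v j ≤ deg H v
  two-edges≤deg H v {i} {j} i≢j = begin
    edge H v i + edge H v j
      ≡⟨ cong₂ _+_ (sum-pick i (edge H v)) (sum-pick j (edge H v)) ⟨
    sum (λ u → 𝟙 (does (i ≟ u)) * edge H v u) + sum (λ u → 𝟙 (does (j ≟ u)) * edge H v u)
      ≡⟨ ∑-distrib-+ (λ u → 𝟙 (does (i ≟ u)) * edge H v u) (λ u → 𝟙 (does (j ≟ u)) * edge H v u) ⟨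
    sum (λ u → 𝟙 (does (i ≟ u)) * edge H v u + 𝟙 (does (j ≟ u)) * edge H v u)
      ≤⟨ sum-mono pointwise ⟩
    deg H v ∎
    where
    open ℕ.≤-Reasoning
    pointwise : ∀ u → 𝟙 (does (i ≟ u)) * edge H v u + 𝟙 (does (j ≟ u)) * edge H v u ≤ edge H v u
    pointwise u with i ≟ u | j ≟ u
    ... | yes refl | yes refl = contradiction refl i≢j
    ... | yes _    | no _     = ℕ.≤-reflexive (trans (ℕ.+-identityʳ _) (ℕ.+-identityʳ _))
    ... | no _     | yes _    = ℕ.≤-reflexive (ℕ.+-identityʳ _)
    ... | no _     | no _     = z≤n

  -- The rows and columns of `i` and `j` in the adjacency matrix hold `2 (deg i + deg j)` ones. Only
  -- the entries at `(i, j)` and `(j, i)` lie both in such a row and in such a column, whence the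
  -- `2` on the right. The proof performs this count row by row.
  edge-degree-sum : ∀ {n} (H : Graph n) i j → adj H i j ≡ true →
    2 * (deg H i + deg H j) ≤ total H + 2
  edge-degree-sum H i j i~j = begin
    2 * (deg H i + deg H j)
      ≡⟨ rearrange (deg H i) (deg H j) ⟩
    deg H i + deg H j + (deg H i + deg H j)
      ≡⟨ cong₂ _+_ (cong₂ _+_ (sum-cong-≗ (λ v → edge-symm H i v)) (sum-cong-≗ (λ v → edge-symm H j v)))
                   (sym (cong₂ _+_ (sum-pick i (deg H)) (sum-pick j (deg H)))) ⟩
    sum (λ v → edge H v i) + sum (λ v → edge H v j)
      + (sum (λ v → δ i v * deg H v) + sum (λ v → δ j v * deg H v))
      ≡⟨ cong₂ _+_ (∑-distrib-+ (λ v → edge H v i) (λ v → edge H v j))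
                   (∑-distrib-+ (λ v → δ i v * deg H v) (λ v → δ j v * deg H v)) ⟨
    sum (λ v → edge H v i + edge H v j) + sum (λ v → δ i v * deg H v + δ j v * deg H v)
      ≡⟨ ∑-distrib-+ (λ v → edge H v i + edge H v j) (λ v → δ i v * deg H v + δ j v * deg H v) ⟨
    sum (λ v → edge H v i + edge H v j + (δ i v * deg H v + δ j v * deg H v))
      ≤⟨ sum-mono pointwise ⟩
    sum (λ v → deg H v + (δ i v + δ j v))
      ≡⟨ ∑-distrib-+ (deg H) (λ v → δ i v + δ j v) ⟩
    total H + sum (λ v → δ i v + δ j v)
      ≡⟨ cong (total H +_) (trans (∑-distrib-+ (δ i) (δ j)) (cong₂ _+_ (sum-pick-1 i) (sum-pick-1 j))) ⟩
    total H + 2 ∎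
    where
    open ℕ.≤-Reasoning
    δ : ∀ {n} → Fin n → Fin n → ℕ
    δ i v = 𝟙 (does (i ≟ v))
    rearrange : ∀ a b → 2 * (a + b) ≡ a + b + (a + b)
    rearrange = ℕ-Solver.solve-∀
    i≢j : i ≢ j
    i≢j refl = contradiction (trans (sym i~j) (Graph.irrefl H i)) λ ()
    pointwise : ∀ v → edge H v i + edge H v j + (δ i v * deg H v + δ j v * deg H v)
                      ≤ deg H v + (δ i v + δ j v)
    pointwise v with i ≟ v | j ≟ v
    ... | yes refl | yes refl = contradiction refl i≢j
    ... | yes refl | no _     rewrite Graph.irrefl H i = begin
      edge H i j + (deg H i + 0 + 0) ≤⟨ ℕ.+-monoˡ-≤ _ (𝟙≤1 (adj H i j)) ⟩
      1 + (deg H i + 0 + 0)          ≡⟨ solved (deg H i) ⟩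
      deg H i + 1                    ∎
      where
      solved : ∀ a → 1 + (a + 0 + 0) ≡ a + 1
      solved = ℕ-Solver.solve-∀
    ... | no _     | yes refl rewrite Graph.irrefl H j = begin
      edge H j i + 0 + (deg H j + 0) ≤⟨ ℕ.+-monoˡ-≤ _ (ℕ.+-monoˡ-≤ 0 (𝟙≤1 (adj H j i))) ⟩
      1 + (deg H j + 0)              ≡⟨ solved (deg H j) ⟩
      deg H j + 1                    ∎
      where
      solved : ∀ a → 1 + (a + 0) ≡ a + 1
      solved = ℕ-Solver.solve-∀
    ... | no _     | no _     = ℕ.+-monoˡ-≤ 0 (two-edges≤deg H v i≢j)

  -- The left side is a sum of `2 (deg i + deg j)` over the edges at `i`, to which `edge-degree-sum`
  -- applies. Through `form-bound` this says that the largest eigenvalue is at most the number of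
  -- edges plus one.
  degree-condition-total : ∀ {n} (H : Graph n) i →
    2 * (deg H i * deg H i + nbrSum H (deg H) i) ≤ (total H + 2) * deg H i
  degree-condition-total H i = begin
    2 * (h * h + nbrSum H (deg H) i)
      ≡⟨ cong (λ a → 2 * (a + nbrSum H (deg H) i)) (*-distribʳ-sum h (edge H i)) ⟩
    2 * (sum (λ j → edge H i j * h) + nbrSum H (deg H) i)
      ≡⟨ cong (2 *_) (∑-distrib-+ (λ j → edge H i j * h) (λ j → edge H i j * deg H j)) ⟨
    2 * sum (λ j → edge H i j * h + edge H i j * deg H j)
      ≡⟨ *-distribˡ-sum 2 (λ j → edge H i j * h + edge H i j * deg H j) ⟩
    sum (λ j → 2 * (edge H i j * h + edge H i j * deg H j))
      ≡⟨ sum-cong-≗ (λ j → rearrange (edge H i j) h (deg H j)) ⟩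
    nbrSum H (λ j → 2 * (h + deg H j)) i
      ≤⟨ nbrSum-≤ H (λ j → 2 * (h + deg H j)) (total H + 2) i (edge-degree-sum H i) ⟩
    h * (total H + 2)
      ≡⟨ ℕ.*-comm h (total H + 2) ⟩
    (total H + 2) * h ∎
    where
    open ℕ.≤-Reasoning
    h = deg H i
    rearrange : ∀ e a b → 2 * (e * a + e * b) ≡ e * (2 * (a + b))
    rearrange = ℕ-Solver.solve-∀

-- Inequalities and finite sums over the rationals.

module RationalSums where
  open Data.Rational.Base using (_+_; _*_; -_; _-_; _≤_; _<_; 0ℚ; 1ℚ; ½; 1/_)
  open Algebra.Properties.Semiring.Sum (CommutativeRing.semiring ℚ.+-*-commutativeRing) public

  ring : AlmostCommutativeRing 0ℓ 0ℓ
  ring = fromCommutativeRing ℚ.+-*-commutativeRing (λ x → dec⇒maybe (0ℚ ℚ.≟ x))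

  2ℚ 4ℚ : ℚ
  2ℚ = 1ℚ + 1ℚ
  4ℚ = 2ℚ + 2ℚ

  ≤-by : ∀ {p q} d → 0ℚ ≤ d → p + d ≡ q → p ≤ q
  ≤-by {p} d 0≤d p+d≡q = begin
    p       ≡⟨ ℚ.+-identityʳ p ⟨
    p + 0ℚ  ≤⟨ ℚ.+-monoʳ-≤ p 0≤d ⟩
    p + d   ≡⟨ p+d≡q ⟩
    _       ∎
    where open ℚ.≤-Reasoning

  0≤-difference : ∀ {p q} → p ≤ q → 0ℚ ≤ q - p
  0≤-difference {p} {q} p≤q = subst (_≤ q - p) (ℚ.+-inverseʳ p) (ℚ.+-monoˡ-≤ (- p) p≤q)

  0≤+ : ∀ {p q} → 0ℚ ≤ p → 0ℚ ≤ q → 0ℚ ≤ p + q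
  0≤+ 0≤p 0≤q = ℚ.+-mono-≤ 0≤p 0≤q

  *-monoˡ : ∀ {r p q} → 0ℚ ≤ r → p ≤ q → r * p ≤ r * q
  *-monoˡ {r} 0≤r = ℚ.*-monoˡ-≤-nonNeg r {{ℚ.nonNegative 0≤r}}

  *-monoʳ : ∀ {r p q} → 0ℚ ≤ r → p ≤ q → p * r ≤ q * r
  *-monoʳ {r} 0≤r = ℚ.*-monoʳ-≤-nonNeg r {{ℚ.nonNegative 0≤r}}

  0≤* : ∀ {p q} → 0ℚ ≤ p → 0ℚ ≤ q → 0ℚ ≤ p * q
  0≤* {p} {q} 0≤p 0≤q = subst (_≤ p * q) (ℚ.*-zeroʳ p) (*-monoˡ 0≤p 0≤q)

  0<* : ∀ {p q} → 0ℚ < p → 0ℚ < q → 0ℚ < p * q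
  0<* {p} {q} 0<p 0<q =
    ℚ.positive⁻¹ _ {{ℚ.pos*pos⇒pos p {{ℚ.positive 0<p}} q {{ℚ.positive 0<q}}}}

  *-cancelˡ : ∀ {r p q} → 0ℚ < r → r * p ≤ r * q → p ≤ q
  *-cancelˡ {r} 0<r = ℚ.*-cancelˡ-≤-pos r {{ℚ.positive 0<r}}

  0≤square : ∀ p → 0ℚ ≤ p * p
  0≤square p with ℚ.≤-total 0ℚ p
  ... | inj₁ 0≤p = 0≤* 0≤p 0≤p
  ... | inj₂ p≤0 = subst (0ℚ ≤_) (neg² p) (0≤* (ℚ.neg-antimono-≤ p≤0) (ℚ.neg-antimono-≤ p≤0))
    where
    neg² : ∀ p → (- p) * (- p) ≡ p * p
    neg² = solve-∀ ring

  0≤½ : 0ℚ ≤ ½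
  0≤½ = ℚ.nonNegative⁻¹ ½

  0≤binary-form : ∀ P c R x y → 0ℚ < P → c * c ≤ P * R →
    0ℚ ≤ P * (x * x) + 2ℚ * c * (x * y) + R * (y * y)
  0≤binary-form P c R x y 0<P c²≤PR = *-cancelˡ 0<P
    (subst (_≤ P * (P * (x * x) + 2ℚ * c * (x * y) + R * (y * y))) (sym (ℚ.*-zeroʳ P))
      (≤-by _ (0≤+ (0≤square (P * x + c * y)) (0≤* (0≤-difference c²≤PR) (0≤square y)))
        (complete-square P c R x y)))
    where
    complete-square : ∀ P c R x y →
      0ℚ + ((P * x + c * y) * (P * x + c * y) + (P * R - c * c) * (y * y))
        ≡ P * (P * (x * x) + 2ℚ * c * (x * y) + R * (y * y))
    complete-square = solve-∀ ring

  ι : ℕ → ℚ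
  ι k = ℤ.+ k ℚ./ 1

  private
    ι≡mkℚ : ∀ k → ι k ≡ ℚ.mkℚ (ℤ.+ k) 0 (Coprimality.sym (Coprimality.1-coprimeTo k))
    ι≡mkℚ k = ℚ.normalize-coprime (Coprimality.sym (Coprimality.1-coprimeTo k))

  ι-+ : ∀ a b → ι (a ℕ.+ b) ≡ ι a + ι b
  ι-+ a b = sym (trans (cong₂ _+_ (ι≡mkℚ a) (ι≡mkℚ b))
    (cong (ℚ._/ 1) (cong₂ ℤ._+_ (ℤ.*-identityʳ (ℤ.+ a)) (ℤ.*-identityʳ (ℤ.+ b)))))

  ι-* : ∀ a b → ι (a ℕ.* b) ≡ ι a * ι b
  ι-* a b = sym (trans (cong₂ _*_ (ι≡mkℚ a) (ι≡mkℚ b))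
    (cong (ℚ._/ 1) (sym (ℤ.pos-* a b))))

  0≤ι : ∀ a → 0ℚ ≤ ι a
  0≤ι a = ℚ.nonNegative⁻¹ (ι a) {{ℚ.normalize-nonNeg a 1}}

  0<ι : ∀ a → 0ℚ < ι (suc a)
  0<ι a = ℚ.positive⁻¹ (ι (suc a)) {{ℚ.normalize-pos (suc a) 1}}

  ι-mono : ∀ {a b} → a ℕ.≤ b → ι a ≤ ι b
  ι-mono {a} a≤b with ℕ.m≤n⇒∃[o]m+o≡n a≤b
  ... | o , refl = ≤-by (ι o) (0≤ι o) (sym (ι-+ a o))

  ι-sum : ∀ {n} (f : Vector ℕ n) → ι (Counting.sum f) ≡ sum (ι ∘ f)
  ι-sum {zero}  f = refl
  ι-sum {suc n} f = trans (ι-+ (f zero) _) (cong (ι (f zero) +_) (ι-sum (f ∘ suc)))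

  -- recip 0 is the junk value 0.
  recip : ℕ → ℚ
  recip zero    = 0ℚ
  recip (suc k) = (1/ ι (suc k)) {{ℚ.pos⇒nonZero (ι (suc k)) {{ℚ.normalize-pos (suc k) 1}}}}

  0<recip : ∀ {k} → 1 ℕ.≤ k → 0ℚ < recip k
  0<recip {suc k} _ = ℚ.positive⁻¹ _ {{ℚ.1/pos⇒pos (ι (suc k)) {{ℚ.normalize-pos (suc k) 1}}}}

  0≤recip : ∀ k → 0ℚ ≤ recip k
  0≤recip zero    = ℚ.≤-refl
  0≤recip (suc k) = ℚ.<⇒≤ (0<recip {suc k} (ℕ.s≤s ℕ.z≤n))

  ι*recip : ∀ {k} → 1 ℕ.≤ k → ι k * recip k ≡ 1ℚ
  ι*recip {suc k} _ = ℚ.*-inverseʳ (ι (suc k)) {{ℚ.pos⇒nonZero (ι (suc k)) {{ℚ.normalize-pos (suc k) 1}}}}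

  sum-mono : ∀ {n} {f g : Vector ℚ n} → (∀ i → f i ≤ g i) → sum f ≤ sum g
  sum-mono {zero}  f≤g = ℚ.≤-refl
  sum-mono {suc n} f≤g = ℚ.+-mono-≤ (f≤g zero) (sum-mono (λ i → f≤g (suc i)))

  0≤sum : ∀ {n} {f : Vector ℚ n} → (∀ i → 0ℚ ≤ f i) → 0ℚ ≤ sum f
  0≤sum {zero}  0≤f = ℚ.≤-refl
  0≤sum {suc n} 0≤f = 0≤+ (0≤f zero) (0≤sum (λ i → 0≤f (suc i)))

  term≤sum : ∀ {n} (f : Vector ℚ n) → (∀ i → 0ℚ ≤ f i) → ∀ i → f i ≤ sum f
  term≤sum {suc n} f 0≤f zero    = ≤-by _ (0≤sum (0≤f ∘ suc)) refl
  term≤sum {suc n} f 0≤f (suc i) = ℚ.≤-trans (term≤sum (f ∘ suc) (0≤f ∘ suc) i)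
    (≤-by (f zero) (0≤f zero) (ℚ.+-comm (sum (f ∘ suc)) (f zero)))

  sum-const : ∀ n c → sum {n} (λ _ → c) ≡ ι n * c
  sum-const zero    c = sym (ℚ.*-zeroˡ c)
  sum-const (suc n) c = begin
    c + sum {n} (λ _ → c)  ≡⟨ cong (c +_) (sum-const n c) ⟩
    c + ι n * c            ≡⟨ factor c (ι n) ⟩
    (1ℚ + ι n) * c         ≡⟨ cong (_* c) (ι-+ 1 n) ⟨
    ι (suc n) * c          ∎
    where
    open ≡-Reasoning
    factor : ∀ c n → c + n * c ≡ (1ℚ + n) * c
    factor = solve-∀ ring

  -- AM-GM charges half of a mixed term to `i` and half to `j`. Exchanging the summation indices
  -- collects both halves in row `i`, so that estimates can be made row by row.
  sum-swap-symmetrize : ∀ {n} (a c : Fin n → Fin n → ℚ) →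
    sum (λ i → sum λ j → a i j + (½ * c i j + ½ * c j i)) ≡ sum (λ i → sum λ j → a i j + c i j)
  sum-swap-symmetrize {n} a c = begin
    sum (λ i → sum λ j → a i j + (½ * c i j + ½ * c j i))
      ≡⟨ split a (λ i j → ½ * c i j + ½ * c j i) ⟩
    sum (λ i → sum (a i)) + sum (λ i → sum λ j → ½ * c i j + ½ * c j i)
      ≡⟨ cong (sum (λ i → sum (a i)) +_) (begin
        sum (λ i → sum λ j → ½ * c i j + ½ * c j i)
          ≡⟨ split (λ i j → ½ * c i j) (λ i j → ½ * c j i) ⟩
        sum (λ i → sum λ j → ½ * c i j) + sum (λ i → sum λ j → ½ * c j i)
          ≡⟨ cong (sum (λ i → sum λ j → ½ * c i j) +_) (∑-comm (λ i j → ½ * c j i)) ⟩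
        sum (λ i → sum λ j → ½ * c i j) + sum (λ i → sum λ j → ½ * c i j)
          ≡⟨ split (λ i j → ½ * c i j) (λ i j → ½ * c i j) ⟨
        sum (λ i → sum λ j → ½ * c i j + ½ * c i j)
          ≡⟨ sum-cong-≗ (λ i → sum-cong-≗ λ j → halves (c i j)) ⟩
        sum (λ i → sum (c i)) ∎) ⟩
    sum (λ i → sum (a i)) + sum (λ i → sum (c i))
      ≡⟨ split a c ⟨
    sum (λ i → sum λ j → a i j + c i j) ∎
    where
    open ≡-Reasoning
    halves : ∀ p → ½ * p + ½ * p ≡ p
    halves = solve-∀ ring
    split : ∀ (f g : Fin n → Fin n → ℚ) →
      sum (λ i → sum λ j → f i j + g i j) ≡ sum (λ i → sum (f i)) + sum (λ i → sum (g i))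
    split f g = trans (sum-cong-≗ λ i → ∑-distrib-+ (f i) (g i))
                      (∑-distrib-+ (λ i → sum (f i)) (λ i → sum (g i)))

  ‖_‖² : ∀ {n} → Vector ℚ n → ℚ
  ‖ x ‖² = sum λ i → x i * x i

  0≤‖‖² : ∀ {n} (x : Vector ℚ n) → 0ℚ ≤ ‖ x ‖²
  0≤‖‖² x = 0≤sum λ i → 0≤square (x i)

  cauchy-schwarz : ∀ {n} (x : Vector ℚ n) → sum x * sum x ≤ ι n * ‖ x ‖²
  cauchy-schwarz {n} x = begin
    sum x * sum x
      ≡⟨ *-distribʳ-sum (sum x) x ⟩
    sum (λ i → x i * sum x)
      ≡⟨ sum-cong-≗ (λ i → *-distribˡ-sum (x i) x) ⟩
    sum (λ i → sum λ j → x i * x j)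
      ≤⟨ sum-mono (λ i → sum-mono λ j →
           ≤-by _ (0≤* 0≤½ (0≤square (x i - x j))) (am-gm (x i) (x j))) ⟩
    sum (λ i → sum λ j → 0ℚ + (½ * (x i * x i) + ½ * (x j * x j)))
      ≡⟨ sum-swap-symmetrize (λ _ _ → 0ℚ) (λ i j → x i * x i) ⟩
    sum (λ i → sum {n} λ j → 0ℚ + x i * x i)
      ≡⟨ sum-cong-≗ (λ i → trans (sum-const n (0ℚ + x i * x i)) (cong (ι n *_) (ℚ.+-identityˡ (x i * x i)))) ⟩
    sum (λ i → ι n * (x i * x i))
      ≡⟨ *-distribˡ-sum (ι n) (λ i → x i * x i) ⟨
    ι n * ‖ x ‖² ∎
    where
    open ℚ.≤-Reasoning
    am-gm : ∀ a b → a * b + ½ * ((a - b) * (a - b)) ≡ 0ℚ + (½ * (a * a) + ½ * (b * b))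
    am-gm = solve-∀ ring

-- The quadratic form of the signless Laplacian.

module Forms where
  open Data.Rational.Base using (_+_; _*_; -_; _-_; _≤_; 0ℚ; 1ℚ; ½)
  open RationalSums
  open Counting using (𝟙; edge; deg; nbrSum)

  weight : ∀ {n} → Graph n → Fin n → Fin n → ℚ
  weight G i j = ι (edge G i j)

  -- The quadratic form of Q G, with the diagonal entry deg i written as the
  -- sum over j of the weights.
  form : ∀ {n} → Graph n → Vector ℚ n → ℚ
  form G x = sum λ i → sum λ j → weight G i j * (x i * x i + x i * x j)

  0≤weight : ∀ {n} (G : Graph n) i j → 0ℚ ≤ weight G i j
  0≤weight G i j = 0≤ι (edge G i j)

  sum-weight : ∀ {n} (G : Graph n) i → sum (weight G i) ≡ ι (deg G i)
  sum-weight G i = sym (ι-sum (edge G i))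

  -- The condition says `Q d ≤ U d` entrywise for the degree vector `d`, as in the Collatz-Wielandt
  -- bound for the largest eigenvalue. It is kept multiplied by the degree because complements can
  -- have isolated vertices; in their rows the bound reduces to `0 ≤ U`.
  form-bound : ∀ {n} (G : Graph n) U → 0ℚ ≤ U →
    (∀ i → ι (deg G i ℕ.* deg G i ℕ.+ nbrSum G (deg G) i) ≤ U * ι (deg G i)) →
    ∀ x → form G x ≤ U * ‖ x ‖²
  form-bound {n} G U 0≤U cond x = begin
    form G x
      ≤⟨ sum-mono (λ i → sum-mono λ j → pointwise i j) ⟩
    sum (λ i → sum λ j → a i j + (½ * c i j + ½ * c j i))
      ≡⟨ sum-swap-symmetrize a c ⟩
    sum (λ i → sum λ j → a i j + c i j)
      ≤⟨ sum-mono row ⟩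
    sum (λ i → U * (x i * x i))
      ≡⟨ *-distribˡ-sum U (λ i → x i * x i) ⟨
    U * ‖ x ‖² ∎
    where
    open ℚ.≤-Reasoning
    d = λ i → ι (deg G i)
    r = λ i → recip (deg G i)
    a c : Fin n → Fin n → ℚ
    a i j = weight G i j * (x i * x i)
    c i j = weight G i j * (d j * r i * (x i * x i))

    -- The weights d i turn AM-GM for x i / d i and x j / d j into row sums of
    -- the vector d.
    am-gm : ∀ a b x y r s → 0ℚ ≤ a → 0ℚ ≤ b → a * r ≡ 1ℚ → b * s ≡ 1ℚ →
      x * x + x * y ≤ x * x + (½ * (b * r * (x * x)) + ½ * (a * s * (y * y)))
    am-gm a b x y r s 0≤a 0≤b ar bs = ≤-by _
      (0≤* 0≤½ (0≤* (0≤* 0≤a 0≤b) (0≤square (r * x - s * y))))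
      (trans (expand a b x y r s) (trans
        (cong₂ (λ p q → x * x + x * y + (½ * (p * (b * r * (x * x))) - p * q * (x * y) + ½ * (q * (a * s * (y * y)))))
          ar bs)
        (collect (b * r * (x * x)) (x * y) (a * s * (y * y)) (x * x))))
      where
      expand : ∀ a b x y r s →
        x * x + x * y + ½ * (a * b * ((r * x - s * y) * (r * x - s * y)))
          ≡ x * x + x * y + (½ * (a * r * (b * r * (x * x))) - a * r * (b * s) * (x * y)
                             + ½ * (b * s * (a * s * (y * y))))
      expand = solve-∀ ring
      collect : ∀ p q r t →
        t + q + (½ * (1ℚ * p) - 1ℚ * 1ℚ * q + ½ * (1ℚ * r)) ≡ t + (½ * p + ½ * r)
      collect = solve-∀ ring

    positive : ∀ i j → adj G i j ≡ true → d i * r i ≡ 1ℚ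
    positive i j i~j = ι*recip
      (subst (ℕ._≤ deg G i) (cong 𝟙 i~j) (Counting.term≤sum (edge G i) j))

    pointwise : ∀ i j → weight G i j * (x i * x i + x i * x j) ≤ a i j + (½ * c i j + ½ * c j i)
    pointwise i j = helper (adj G i j) refl
      where
      A = x i * x i + x i * x j
      B = x i * x i
      C = d j * r i * (x i * x i)
      D = d i * r j * (x j * x j)
      one : ∀ b c d → b + (½ * c + ½ * d) ≡ 1ℚ * b + (½ * (1ℚ * c) + ½ * (1ℚ * d))
      one = solve-∀ ring
      none : ∀ a b c d → 0ℚ * a ≡ 0ℚ * b + (½ * (0ℚ * c) + ½ * (0ℚ * d))
      none = solve-∀ ring
      known : ∀ b → adj G i j ≡ b → ι (𝟙 b) * A ≤ ι (𝟙 b) * B + (½ * (ι (𝟙 b) * C) + ½ * (ι (𝟙 b) * D))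
      known true  i~j = begin
        1ℚ * A
          ≡⟨ ℚ.*-identityˡ A ⟩
        A
          ≤⟨ am-gm (d i) (d j) (x i) (x j) (r i) (r j) (0≤ι (deg G i)) (0≤ι (deg G j))
               (positive i j i~j) (positive j i (trans (Graph.symm G j i) i~j)) ⟩
        B + (½ * C + ½ * D)
          ≡⟨ one B C D ⟩
        1ℚ * B + (½ * (1ℚ * C) + ½ * (1ℚ * D)) ∎
      known false _ = ℚ.≤-reflexive (none A B C D)
      helper : ∀ b → adj G i j ≡ b → weight G i j * A ≤ a i j + (½ * c i j + ½ * c j i)
      helper b eq = subst
        (λ e → weight G i j * A ≤ weight G i j * B + (½ * (weight G i j * C) + ½ * (e * D)))
        (cong ι (Counting.edge-symm G i j))
        (subst (λ b → ι (𝟙 b) * A ≤ ι (𝟙 b) * B + (½ * (ι (𝟙 b) * C) + ½ * (ι (𝟙 b) * D)))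
          (sym eq) (known b eq))

    row : ∀ i → sum (λ j → a i j + c i j) ≤ U * (x i * x i)
    row i = begin
      sum (λ j → a i j + c i j)
        ≡⟨ sum-cong-≗ (λ j → factor (weight G i j) (d j) (r i) (x i * x i)) ⟩
      sum (λ j → (weight G i j + weight G i j * d j * r i) * (x i * x i))
        ≡⟨ *-distribʳ-sum (x i * x i) (λ j → weight G i j + weight G i j * d j * r i) ⟨
      sum (λ j → weight G i j + weight G i j * d j * r i) * (x i * x i)
        ≡⟨ cong (_* (x i * x i)) rowsum ⟩
      (d i + P * r i) * (x i * x i)
        ≤⟨ *-monoʳ (0≤square (x i)) (bound (deg G i) refl) ⟩
      U * (x i * x i) ∎
      where
      P = ι (nbrSum G (deg G) i)
      factor : ∀ w d r y → w * y + w * (d * r * y) ≡ (w + w * d * r) * y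
      factor = solve-∀ ring
      rowsum : sum (λ j → weight G i j + weight G i j * d j * r i) ≡ d i + P * r i
      rowsum = trans (∑-distrib-+ (weight G i) (λ j → weight G i j * d j * r i))
        (cong₂ _+_ (sum-weight G i)
          (trans (sym (*-distribʳ-sum (r i) (λ j → weight G i j * d j)))
            (cong (_* r i) (trans
              (sum-cong-≗ λ j → sym (ι-* (edge G i j) (deg G j)))
              (sym (ι-sum (λ j → edge G i j ℕ.* deg G j)))))))
      bound : ∀ k → deg G i ≡ k → d i + P * r i ≤ U
      bound zero    eq = begin
        d i + P * r i          ≡⟨ cong (λ k → ι k + P * recip k) eq ⟩
        0ℚ + P * 0ℚ            ≡⟨ trans (ℚ.+-identityˡ _) (ℚ.*-zeroʳ P) ⟩
        0ℚ                     ≤⟨ 0≤U ⟩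
        U                      ∎
      bound (suc k) eq = begin
        d i + P * r i
          ≡⟨ cong (_+ P * r i) (trans (sym (ℚ.*-identityʳ (d i))) (cong (d i *_) (sym dr))) ⟩
        d i * (d i * r i) + P * r i
          ≡⟨ factor′ (d i) P (r i) ⟩
        (d i * d i + P) * r i
          ≡⟨ cong (_* r i) (trans (ι-+ (deg G i ℕ.* deg G i) _) (cong (_+ P) (ι-* (deg G i) (deg G i)))) ⟨
        ι (deg G i ℕ.* deg G i ℕ.+ nbrSum G (deg G) i) * r i
          ≤⟨ *-monoʳ (0≤recip (deg G i)) (cond i) ⟩
        U * d i * r i
          ≡⟨ trans (ℚ.*-assoc U (d i) (r i)) (trans (cong (U *_) dr) (ℚ.*-identityʳ U)) ⟩
        U ∎
        where
        dr : d i * r i ≡ 1ℚ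
        dr = ι*recip (subst (1 ℕ.≤_) (sym eq) (ℕ.s≤s ℕ.z≤n))
        factor′ : ∀ d p r → d * (d * r) + p * r ≡ (d * d + p) * r
        factor′ = solve-∀ ring

  -- The two Laplacians add up to that of the complete graph, `(n - 2) I + J`. On the right all
  -- pairs are summed, including `i = j`, and these diagonal pairs make up the `2 ‖ x ‖²` on the
  -- left.
  form-complement : ∀ {n} (G : Graph n) x →
    form G x + form (complement G) x + 2ℚ * ‖ x ‖² ≡ ι n * ‖ x ‖² + sum x * sum x
  form-complement {n} G x = begin
    form G x + form (complement G) x + 2ℚ * ‖ x ‖²
      ≡⟨ cong (form G x + form (complement G) x +_)
           (trans (*-distribˡ-sum 2ℚ (λ i → x i * x i)) (sum-cong-≗ λ i → diagonal i)) ⟩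
    form G x + form (complement G) x + sum (λ i → sum λ j → δ i j * q i j)
      ≡⟨ cong (_+ sum (λ i → sum λ j → δ i j * q i j))
           (join (λ i j → weight G i j * q i j) (λ i j → weight (complement G) i j * q i j)) ⟩
    sum (λ i → sum λ j → weight G i j * q i j + weight (complement G) i j * q i j)
      + sum (λ i → sum λ j → δ i j * q i j)
      ≡⟨ join (λ i j → weight G i j * q i j + weight (complement G) i j * q i j) (λ i j → δ i j * q i j) ⟩
    sum (λ i → sum λ j → weight G i j * q i j + weight (complement G) i j * q i j + δ i j * q i j)
      ≡⟨ sum-cong-≗ (λ i → sum-cong-≗ λ j → partition i j) ⟩
    sum (λ i → sum λ j → q i j)
      ≡⟨ sum-cong-≗ (λ i → trans (∑-distrib-+ (λ _ → x i * x i) (λ j → x i * x j))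
           (cong₂ _+_ (sum-const n (x i * x i)) (sym (*-distribˡ-sum (x i) x)))) ⟩
    sum (λ i → ι n * (x i * x i) + x i * sum x)
      ≡⟨ ∑-distrib-+ (λ i → ι n * (x i * x i)) (λ i → x i * sum x) ⟩
    sum (λ i → ι n * (x i * x i)) + sum (λ i → x i * sum x)
      ≡⟨ cong₂ _+_ (*-distribˡ-sum (ι n) (λ i → x i * x i)) (*-distribʳ-sum (sum x) x) ⟨
    ι n * ‖ x ‖² + sum x * sum x ∎
    where
    open ≡-Reasoning
    q δ : Fin n → Fin n → ℚ
    q i j = x i * x i + x i * x j
    δ i j = if does (i ≟ j) then 1ℚ else 0ℚ
    join : ∀ (f g : Fin n → Fin n → ℚ) →
      sum (λ i → sum (f i)) + sum (λ i → sum (g i)) ≡ sum (λ i → sum λ j → f i j + g i j)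
    join f g = sym (trans (sum-cong-≗ λ i → ∑-distrib-+ (f i) (g i))
                          (∑-distrib-+ (λ i → sum (f i)) (λ i → sum (g i))))
    diagonal : ∀ i → 2ℚ * (x i * x i) ≡ sum (λ j → δ i j * q i j)
    diagonal i = trans (double (x i))
      (sym (sum-select (CommutativeRing.semiring ℚ.+-*-commutativeRing) i 1ℚ (q i)))
      where
      double : ∀ y → 2ℚ * (y * y) ≡ 1ℚ * (y * y + y * y)
      double = solve-∀ ring
    δ≡ι : ∀ i j → δ i j ≡ ι (𝟙 (does (i ≟ j)))
    δ≡ι i j with does (i ≟ j)
    ... | true  = refl
    ... | false = refl
    partition : ∀ i j →
      weight G i j * q i j + weight (complement G) i j * q i j + δ i j * q i j ≡ q i j
    partition i j = begin
      weight G i j * q i j + weight (complement G) i j * q i j + δ i j * q i j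
        ≡⟨ factor (weight G i j) (weight (complement G) i j) (δ i j) (q i j) ⟩
      (weight (complement G) i j + weight G i j + δ i j) * q i j
        ≡⟨ cong (λ h → (weight (complement G) i j + weight G i j + h) * q i j) (δ≡ι i j) ⟩
      (weight (complement G) i j + weight G i j + ι (𝟙 (does (i ≟ j)))) * q i j
        ≡⟨ cong (_* q i j) (trans (ι-+ (edge (complement G) i j ℕ.+ edge G i j) (𝟙 (does (i ≟ j))))
             (cong (_+ ι (𝟙 (does (i ≟ j)))) (ι-+ (edge (complement G) i j) (edge G i j)))) ⟨
      ι (edge (complement G) i j ℕ.+ edge G i j ℕ.+ 𝟙 (does (i ≟ j))) * q i j
        ≡⟨ cong (λ k → ι k * q i j) (Counting.edge-complement G i j) ⟩
      1ℚ * q i j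
        ≡⟨ ℚ.*-identityˡ (q i j) ⟩
      q i j ∎
      where
      factor : ∀ a b c y → a * y + b * y + c * y ≡ (b + a + c) * y
      factor = solve-∀ ring

  -- The two ordered terms of an edge `zj` combine to the square of `x z + x j`. Iterated over the
  -- vertices, this is why the form is nonnegative.
  form-remove : ∀ {n} (G : Graph (suc n)) z x →
    form G x ≡ sum (λ j → weight G z (punchIn z j) * ((x z + x (punchIn z j)) * (x z + x (punchIn z j))))
               + form (G ∖ z) (x ∘ punchIn z)
  form-remove {n} G z x = begin
    form G x
      ≡⟨ sum-remove {i = z} (λ i → sum (f i)) ⟩
    sum (f z) + sum (λ i → sum (f (p i)))
      ≡⟨ cong₂ _+_ (trans (sum-remove {i = z} (f z)) (trans (cong (_+ sum (f z ∘ p)) loop) (ℚ.+-identityˡ (sum (f z ∘ p)))))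
                   (trans (sum-cong-≗ λ i → sum-remove {i = z} (f (p i)))
                          (∑-distrib-+ (λ i → f (p i) z) (λ i → sum (f (p i) ∘ p)))) ⟩
    sum (λ j → f z (p j)) + (sum (λ i → f (p i) z) + form (G ∖ z) (x ∘ p))
      ≡⟨ ℚ.+-assoc (sum (λ j → f z (p j))) (sum (λ i → f (p i) z)) (form (G ∖ z) (x ∘ p)) ⟨
    sum (λ j → f z (p j)) + sum (λ i → f (p i) z) + form (G ∖ z) (x ∘ p)
      ≡⟨ cong (_+ form (G ∖ z) (x ∘ p)) (trans
           (sym (∑-distrib-+ (λ j → f z (p j)) (λ j → f (p j) z)))
           (sum-cong-≗ star)) ⟩
    sum (λ j → weight G z (p j) * ((x z + x (p j)) * (x z + x (p j)))) + form (G ∖ z) (x ∘ p) ∎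
    where
    open ≡-Reasoning
    p = punchIn z
    f : Fin (suc n) → Fin (suc n) → ℚ
    f i j = weight G i j * (x i * x i + x i * x j)
    loop : f z z ≡ 0ℚ
    loop = trans (cong (λ k → ι k * (x z * x z + x z * x z)) (Counting.edge-irrefl G z)) (ℚ.*-zeroˡ (x z * x z + x z * x z))
    star : ∀ j → f z (p j) + f (p j) z ≡ weight G z (p j) * ((x z + x (p j)) * (x z + x (p j)))
    star j = trans (cong (λ k → f z (p j) + ι k * (x (p j) * x (p j) + x (p j) * x z))
                         (Counting.edge-symm G (p j) z))
                   (square (weight G z (p j)) (x z) (x (p j)))
      where
      square : ∀ w a b → w * (a * a + a * b) + w * (b * b + b * a) ≡ w * ((a + b) * (a + b))
      square = solve-∀ ring

  norm-remove : ∀ {n} z (x : Vector ℚ (suc n)) → ‖ x ‖² ≡ x z * x z + ‖ x ∘ punchIn z ‖²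
  norm-remove z x = sum-remove {i = z} (λ i → x i * x i)

  0≤form : ∀ {n} (G : Graph n) x → 0ℚ ≤ form G x
  0≤form {zero}  G x = ℚ.≤-refl
  0≤form {suc n} G x = subst (0ℚ ≤_) (sym (form-remove G zero x))
    (0≤+ (0≤sum λ j → 0≤* (0≤weight G zero (suc j)) (0≤square (x zero + x (suc j))))
         (0≤form (G ∖ zero) (x ∘ suc)))

  -- In `Q(G) = (n - 2) I + J - Q(complement)` the contribution of `J` is the square of `sum x`,
  -- which is dropped.
  form-lower : ∀ {n} (G : Graph n) U x → form (complement G) x ≤ U * ‖ x ‖² →
    (ι n - 2ℚ - U) * ‖ x ‖² ≤ form G x
  form-lower {n} G U x bound = ≤-by _
    (0≤+ (0≤-difference bound) (0≤square (sum x)))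
    (trans (rearrange (ι n) U ‖ x ‖² (form (complement G) x) (sum x * sum x))
      (trans (cong (λ h → h - form (complement G) x - 2ℚ * ‖ x ‖²) (sym (form-complement G x)))
        (cancel (form G x) (form (complement G) x) ‖ x ‖²)))
    where
    rearrange : ∀ n U X C S →
      (n - 2ℚ - U) * X + (U * X - C + S) ≡ n * X + S - C - 2ℚ * X
    rearrange = solve-∀ ring
    cancel : ∀ F C X → F + C + 2ℚ * X - C - 2ℚ * X ≡ F
    cancel = solve-∀ ring

  form-complete : ∀ {n} (G : Graph n) → (∀ i j → weight (complement G) i j ≡ 0ℚ) → ∀ x →
    form G x ≡ (ι n - 2ℚ) * ‖ x ‖² + sum x * sum x
  form-complete {n} G empty x = begin
    form G x
      ≡⟨ cancel (form G x) (form (complement G) x) ‖ x ‖² ⟩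
    form G x + form (complement G) x + 2ℚ * ‖ x ‖² - form (complement G) x - 2ℚ * ‖ x ‖²
      ≡⟨ cong₂ (λ p q → p - q - 2ℚ * ‖ x ‖²) (form-complement G x) no-form ⟩
    ι n * ‖ x ‖² + sum x * sum x - 0ℚ - 2ℚ * ‖ x ‖²
      ≡⟨ rearrange (ι n) ‖ x ‖² (sum x * sum x) ⟩
    (ι n - 2ℚ) * ‖ x ‖² + sum x * sum x ∎
    where
    open ≡-Reasoning
    cancel : ∀ F C X → F ≡ F + C + 2ℚ * X - C - 2ℚ * X
    cancel = solve-∀ ring
    rearrange : ∀ n X S → n * X + S - 0ℚ - 2ℚ * X ≡ (n - 2ℚ) * X + S
    rearrange = solve-∀ ring
    no-form : form (complement G) x ≡ 0ℚ
    no-form = trans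
      (sum-cong-≗ {n} {_} {λ _ → 0ℚ} λ i → trans
        (sum-cong-≗ {n} {_} {λ _ → 0ℚ} λ j → trans (cong (_* (x i * x i + x i * x j)) (empty i j)) (ℚ.*-zeroˡ (x i * x i + x i * x j)))
        (sum-replicate-zero n))
      (sum-replicate-zero n)

  -- For an edge zj the certificate is
  -- (a + b)² + (g - 1)b² - (1 - t)a² = g(b + ta)², where gt = 1.
  form-low-degree : ∀ {n} (G : Graph (suc n)) z g t x → 1ℚ ≤ g → 0ℚ ≤ t → t * g ≡ 1ℚ →
    (g - 1ℚ + ι (deg G z)) * ‖ x ∘ punchIn z ‖² ≤ form (G ∖ z) (x ∘ punchIn z) →
    ι (deg G z) * (1ℚ - t) * ‖ x ‖² ≤ form G x
  form-low-degree {n} G z g t x 1≤g 0≤t tg bound = begin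
    k * (1ℚ - t) * ‖ x ‖²
      ≡⟨ cong (k * (1ℚ - t) *_) (norm-remove z x) ⟩
    k * (1ℚ - t) * (a * a + Y)
      ≤⟨ ≤-by _ (0≤* (0≤* (0≤ι (deg G z)) 0≤t) (0≤‖‖² y)) (rearrange₁ k t (a * a) Y) ⟩
    k * (1ℚ - t) * (a * a) + k * Y
      -- Of the coefficient `g - 1 + k` in the hypothesis, `k` pays for the norm outside `z`, and
      -- `g - 1` for the squares `(g - 1) b²` that the edge certificate consumes.
      ≡⟨ rearrange₂ k g t (a * a) Y ⟩
    k * ((1ℚ - t) * (a * a)) - (g - 1ℚ) * Y + (g - 1ℚ + k) * Y
      ≤⟨ ℚ.+-monoʳ-≤ (k * ((1ℚ - t) * (a * a)) - (g - 1ℚ) * Y) bound ⟩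
    k * ((1ℚ - t) * (a * a)) - (g - 1ℚ) * Y + form (G ∖ z) y
      ≤⟨ ℚ.+-monoˡ-≤ (form (G ∖ z) y) star-bound ⟩
    star + form (G ∖ z) y
      ≡⟨ form-remove G z x ⟨
    form G x ∎
    where
    open ℚ.≤-Reasoning
    k = ι (deg G z)
    a = x z
    y = x ∘ punchIn z
    Y = ‖ y ‖²
    w = λ j → weight G z (punchIn z j)
    star = sum λ j → w j * ((a + y j) * (a + y j))
    rearrange₁ : ∀ k t A Y → k * (1ℚ - t) * (A + Y) + k * t * Y ≡ k * (1ℚ - t) * A + k * Y
    rearrange₁ = solve-∀ ring
    rearrange₂ : ∀ k g t A Y →
      k * (1ℚ - t) * A + k * Y ≡ k * ((1ℚ - t) * A) - (g - 1ℚ) * Y + (g - 1ℚ + k) * Y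
    rearrange₂ = solve-∀ ring
    pointwise : ∀ e b → e ℕ.≤ 1 →
      ι e * ((1ℚ - t) * (a * a)) ≤ (g - 1ℚ) * (b * b) + ι e * ((a + b) * (a + b))
    pointwise zero b _ = begin
      0ℚ * ((1ℚ - t) * (a * a))                      ≡⟨ ℚ.*-zeroˡ ((1ℚ - t) * (a * a)) ⟩
      0ℚ                                             ≤⟨ 0≤* (0≤-difference 1≤g) (0≤square b) ⟩
      (g - 1ℚ) * (b * b)                             ≡⟨ ℚ.+-identityʳ _ ⟨
      (g - 1ℚ) * (b * b) + 0ℚ                        ≡⟨ cong ((g - 1ℚ) * (b * b) +_) (ℚ.*-zeroˡ ((a + b) * (a + b))) ⟨
      (g - 1ℚ) * (b * b) + 0ℚ * ((a + b) * (a + b))  ∎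
    pointwise (suc zero) b _ = ≤-by (g * ((b + t * a) * (b + t * a)))
      (0≤* (ℚ.≤-trans (ℚ.nonNegative⁻¹ 1ℚ) 1≤g) (0≤square (b + t * a)))
      (trans (expand a b g t) (trans
        (cong (λ h → (1ℚ - t) * (a * a) + g * (b * b) + 2ℚ * h * (a * b) + h * t * (a * a)) tg)
        (collect a b g t)))
      where
      expand : ∀ a b g t → 1ℚ * ((1ℚ - t) * (a * a)) + g * ((b + t * a) * (b + t * a))
        ≡ (1ℚ - t) * (a * a) + g * (b * b) + 2ℚ * (t * g) * (a * b) + t * g * t * (a * a)
      expand = solve-∀ ring
      collect : ∀ a b g t →
        (1ℚ - t) * (a * a) + g * (b * b) + 2ℚ * 1ℚ * (a * b) + 1ℚ * t * (a * a)
        ≡ (g - 1ℚ) * (b * b) + 1ℚ * ((a + b) * (a + b))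
      collect = solve-∀ ring
    pointwise (suc (suc _)) b (ℕ.s≤s ())
    sum-w : sum w ≡ k
    sum-w = begin-equality
      sum w                            ≡⟨ ι-sum (λ j → edge G z (punchIn z j)) ⟨
      ι (Counting.sum (λ j → edge G z (punchIn z j)))
        ≡⟨ cong (λ e → ι (e ℕ.+ Counting.sum (λ j → edge G z (punchIn z j)))) (Counting.edge-irrefl G z) ⟨
      ι (edge G z z ℕ.+ Counting.sum (λ j → edge G z (punchIn z j)))
        ≡⟨ cong ι (Counting.deg-remove G z z) ⟨
      k ∎
    star-bound : k * ((1ℚ - t) * (a * a)) - (g - 1ℚ) * Y ≤ star
    star-bound = begin
      k * ((1ℚ - t) * (a * a)) - (g - 1ℚ) * Y
        ≡⟨ cong (λ h → h * ((1ℚ - t) * (a * a)) - (g - 1ℚ) * Y) sum-w ⟨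
      sum w * ((1ℚ - t) * (a * a)) - (g - 1ℚ) * Y
        ≡⟨ cong (_- (g - 1ℚ) * Y) (*-distribʳ-sum ((1ℚ - t) * (a * a)) w) ⟩
      sum (λ j → w j * ((1ℚ - t) * (a * a))) - (g - 1ℚ) * Y
        ≤⟨ ℚ.+-monoˡ-≤ (- ((g - 1ℚ) * Y))
             (sum-mono λ j → pointwise (edge G z (punchIn z j)) (y j) (Counting.𝟙≤1 _)) ⟩
      sum (λ j → (g - 1ℚ) * (y j * y j) + w j * ((a + y j) * (a + y j))) - (g - 1ℚ) * Y
        ≡⟨ cong (_- (g - 1ℚ) * Y) (trans
             (∑-distrib-+ (λ j → (g - 1ℚ) * (y j * y j)) (λ j → w j * ((a + y j) * (a + y j))))
             (cong (_+ star) (sym (*-distribˡ-sum (g - 1ℚ) (λ j → y j * y j))))) ⟩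
      (g - 1ℚ) * Y + star - (g - 1ℚ) * Y
        ≡⟨ cancel ((g - 1ℚ) * Y) star ⟩
      star ∎
      where
      cancel : ∀ p q → p + q - p ≡ q
      cancel = solve-∀ ring

-- A relabelled `K⁺`: `z` is the pendant vertex and `w` its neighbour, named by its label after the
-- deletion of `z`. Working with this shape lets the spread bound apply to every copy of `K⁺`
-- directly.
record PendantClique {n} (G : Graph (suc n)) (z : Fin (suc n)) (w : Fin n) : Set where
  field
    pendant : ∀ j → adj G z (punchIn z j) ≡ does (j ≟ w)
    clique  : ∀ i j → adj G (punchIn z i) (punchIn z j) ≡ not (does (i ≟ j))

does-≟-sym : ∀ {n} (i j : Fin n) → does (i ≟ j) ≡ does (j ≟ i)
does-≟-sym i j with i ≟ j | j ≟ i
... | yes _   | yes _   = refl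
... | no _    | no _    = refl
... | yes i≡j | no j≢i  = contradiction (sym i≡j) j≢i
... | no i≢j  | yes j≡i = contradiction (sym j≡i) i≢j

-- Sharp bounds on the form of a pendant clique.

module PendantCliqueForm where
  open Data.Rational.Base using (_+_; _*_; -_; _-_; _≤_; _<_; 0ℚ; 1ℚ; ½)
  open RationalSums
  open Forms

  3ℚ 8ℚ : ℚ
  3ℚ = 2ℚ + 1ℚ
  8ℚ = 4ℚ + 4ℚ

  -- Without `z` the graph is complete, so the form sees the vertices other than `z` and its
  -- neighbour only through `‖ y ‖²` and `sum y`, which Cauchy-Schwarz links.
  form-pendantClique : ∀ {M} (G : Graph (2 ℕ.+ M)) {z w} → PendantClique G z w → ∀ x →
    let b = x (punchIn z w) ; y = λ j → x (punchIn z (punchIn w j)) in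
    form G x ≡ (x z + b) * (x z + b)
               + ((1ℚ + ι M - 2ℚ) * (b * b + ‖ y ‖²) + (b + sum y) * (b + sum y))
  form-pendantClique {M} G {z} {w} pc x = begin
    form G x
      ≡⟨ form-remove G z x ⟩
    sum (λ j → weight G z (p j) * sq j) + form (G ∖ z) (x ∘ p)
      ≡⟨ cong₂ _+_ star (form-complete (G ∖ z) no-edge (x ∘ p)) ⟩
    sq w + ((ι (suc M) - 2ℚ) * ‖ x ∘ p ‖² + sum (x ∘ p) * sum (x ∘ p))
      ≡⟨ cong₂ (λ s t → sq w + ((ι (suc M) - 2ℚ) * s + t * t))
           (norm-remove w (x ∘ p)) (sum-remove {i = w} (x ∘ p)) ⟩
    sq w + ((ι (suc M) - 2ℚ) * (b * b + ‖ y ‖²) + (b + sum y) * (b + sum y))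
      ≡⟨ cong (λ s → sq w + ((s - 2ℚ) * (b * b + ‖ y ‖²) + (b + sum y) * (b + sum y))) (ι-+ 1 M) ⟩
    sq w + ((1ℚ + ι M - 2ℚ) * (b * b + ‖ y ‖²) + (b + sum y) * (b + sum y)) ∎
    where
    open ≡-Reasoning
    open PendantClique pc
    p = punchIn z
    b = x (p w)
    y = λ j → x (p (punchIn w j))
    sq = λ j → (x z + x (p j)) * (x z + x (p j))
    star : sum (λ j → weight G z (p j) * sq j) ≡ sq w
    star = trans
      (sum-cong-≗ λ j → cong (_* sq j) (indicator j))
      (trans (sum-select (CommutativeRing.semiring ℚ.+-*-commutativeRing) w 1ℚ sq) (ℚ.*-identityˡ (sq w)))
      where
      indicator : ∀ j → weight G z (p j) ≡ (if does (w ≟ j) then 1ℚ else 0ℚ)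
      indicator j rewrite pendant j | does-≟-sym j w with does (w ≟ j)
      ... | true  = refl
      ... | false = refl
    no-edge : ∀ i j → weight (complement (G ∖ z)) i j ≡ 0ℚ
    no-edge i j rewrite clique i j with does (i ≟ j)
    ... | true  = refl
    ... | false = refl

  -- The discriminant conditions of all binary forms below amount to ab ≥ 8.
  module _ (m s : ℚ) (0<m : 0ℚ < m) (3≤s : 3ℚ ≤ s)
           (0<b : 0ℚ < s - 2ℚ * m + 1ℚ)
           (8≤ab : 8ℚ ≤ (s + 2ℚ * m - 1ℚ) * (s - 2ℚ * m + 1ℚ)) where

    private
      a b : ℚ
      a = s + 2ℚ * m - 1ℚ
      b = s - 2ℚ * m + 1ℚ

      0<2 : 0ℚ < 2ℚ
      0<2 = ℚ.positive⁻¹ 2ℚ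

      0<a : 0ℚ < a
      0<a = ℚ.<-≤-trans 0<2
        (≤-by _ (0≤+ (0≤-difference 3≤s) (0≤* (ℚ.<⇒≤ 0<2) (ℚ.<⇒≤ 0<m))) (rearrange s m))
        where
        rearrange : ∀ s m → 2ℚ + (s - (2ℚ + 1ℚ) + 2ℚ * m) ≡ s + 2ℚ * m - 1ℚ
        rearrange = solve-∀ ring

      0≤ab-8 : 0ℚ ≤ ½ * (a * b - 8ℚ)
      0≤ab-8 = 0≤* 0≤½ (0≤-difference 8≤ab)

      star-discriminant : ∀ u v → u * v ≡ a * b → 4ℚ ≤ u * (½ * v)
      star-discriminant u v uv = ≤-by _ 0≤ab-8 (trans (cong (λ h → 4ℚ + ½ * (h - 8ℚ)) (sym uv)) (rearrange u v))
        where
        rearrange : ∀ u v → 4ℚ + ½ * (u * v - (4ℚ + 4ℚ)) ≡ u * (½ * v)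
        rearrange = solve-∀ ring

      0≤m[ab-8] : 0ℚ ≤ m * (½ * (a * b - 8ℚ))
      0≤m[ab-8] = 0≤* (ℚ.<⇒≤ 0<m) 0≤ab-8

      0<b+2 : 0ℚ < b + 2ℚ
      0<b+2 = ℚ.+-mono-< 0<b 0<2

    -- `X` and `T` stand for the squared norm and the sum of the remaining coordinates. Multiplied
    -- by `m`, the difference of the two sides is a form in `x` and `y`, a form in `T` and `y`, and
    -- a nonnegative multiple of `m X - T²`. The coefficient `m (s - 1)` of `y²` is divided into
    -- `½ m b` and `½ m (a - 2)`, so that both discriminant conditions reduce to `a b` being at
    -- least `8`.
    pendantClique-upper : ∀ x y X T → T * T ≤ m * X →
      2ℚ * ((x + y) * (x + y) + ((1ℚ + m - 2ℚ) * (y * y + X) + (y + T) * (y + T)))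
        ≤ (2ℚ * m + 1ℚ + s) * (x * x + (y * y + X))
    pendantClique-upper x y X T T²≤mX = *-cancelˡ 0<m (≤-by _
      (0≤+ (0≤+
        (0≤* (ℚ.<⇒≤ 0<m) (0≤binary-form a (- 2ℚ) (½ * b) x y 0<a (star-discriminant a b refl)))
        (0≤binary-form (b + 2ℚ) (- (2ℚ * m)) (½ * m * (a - 2ℚ)) T y 0<b+2
          (≤-by _ 0≤m[ab-8] (discriminant m s))))
        (0≤* (0≤+ (ℚ.≤-trans (ℚ.nonNegative⁻¹ 3ℚ) 3≤s) (ℚ.nonNegative⁻¹ 3ℚ)) (0≤-difference T²≤mX)))
      (certificate m s x y X T))
      where
      discriminant : ∀ m s → let a = s + 2ℚ * m - 1ℚ ; b = s - 2ℚ * m + 1ℚ in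
        (- (2ℚ * m)) * (- (2ℚ * m)) + m * (½ * (a * b - 8ℚ)) ≡ (b + 2ℚ) * (½ * m * (a - 2ℚ))
      discriminant = solve-∀ ring
      certificate : ∀ m s x y X T → let a = s + 2ℚ * m - 1ℚ ; b = s - 2ℚ * m + 1ℚ in
        m * (2ℚ * ((x + y) * (x + y) + ((1ℚ + m - 2ℚ) * (y * y + X) + (y + T) * (y + T))))
        + (m * (a * (x * x) + 2ℚ * (- 2ℚ) * (x * y) + ½ * b * (y * y))
           + ((b + 2ℚ) * (T * T) + 2ℚ * (- (2ℚ * m)) * (T * y) + ½ * m * (a - 2ℚ) * (y * y))
           + (s + 3ℚ) * (m * X - T * T))
        ≡ m * ((2ℚ * m + 1ℚ + s) * (x * x + (y * y + X)))
      certificate = solve-∀ ring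

    -- The certificate of `pendantClique-upper` with `s` replaced by `- s` and all signs reversed,
    -- which exchanges `a` and `- b`. The multiplier `s + 3` becomes `s - 3`, twice the distance
    -- from the small root `(2m + 1 - s)/2` to `m - 1`.
    pendantClique-lower : ∀ x y X T → T * T ≤ m * X →
      (2ℚ * m + 1ℚ - s) * (x * x + (y * y + X))
        ≤ 2ℚ * ((x + y) * (x + y) + ((1ℚ + m - 2ℚ) * (y * y + X) + (y + T) * (y + T)))
    pendantClique-lower x y X T T²≤mX = *-cancelˡ 0<m (≤-by _
      (0≤+ (0≤+
        (0≤* (ℚ.<⇒≤ 0<m) (0≤binary-form b 2ℚ (½ * a) x y 0<b (star-discriminant b a (ℚ.*-comm b a))))
        (0≤binary-form (½ * m * (b + 2ℚ)) (2ℚ * m) (a - 2ℚ) y T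
          (0<* (0<* (ℚ.positive⁻¹ ½) 0<m) 0<b+2)
          (≤-by _ 0≤m[ab-8] (discriminant m s))))
        (0≤* (0≤-difference 3≤s) (0≤-difference T²≤mX)))
      (certificate m s x y X T))
      where
      discriminant : ∀ m s → let a = s + 2ℚ * m - 1ℚ ; b = s - 2ℚ * m + 1ℚ in
        2ℚ * m * (2ℚ * m) + m * (½ * (a * b - 8ℚ)) ≡ ½ * m * (b + 2ℚ) * (a - 2ℚ)
      discriminant = solve-∀ ring
      certificate : ∀ m s x y X T → let a = s + 2ℚ * m - 1ℚ ; b = s - 2ℚ * m + 1ℚ in
        m * ((2ℚ * m + 1ℚ - s) * (x * x + (y * y + X)))
        + (m * (b * (x * x) + 2ℚ * 2ℚ * (x * y) + ½ * a * (y * y))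
           + (½ * m * (b + 2ℚ) * (y * y) + 2ℚ * (2ℚ * m) * (y * T) + (a - 2ℚ) * (T * T))
           + (s - 3ℚ) * (m * X - T * T))
        ≡ m * (2ℚ * ((x + y) * (x + y) + ((1ℚ + m - 2ℚ) * (y * y + X) + (y + T) * (y + T))))
      certificate = solve-∀ ring

  pendantClique-bounds : ∀ {M} (G : Graph (3 ℕ.+ M)) {z w} → PendantClique G z w → ∀ s →
    let m = ι (suc M) in
    3ℚ ≤ s → 0ℚ < s - 2ℚ * m + 1ℚ → 8ℚ ≤ (s + 2ℚ * m - 1ℚ) * (s - 2ℚ * m + 1ℚ) → ∀ x →
    2ℚ * form G x ≤ (2ℚ * m + 1ℚ + s) * ‖ x ‖² × (2ℚ * m + 1ℚ - s) * ‖ x ‖² ≤ 2ℚ * form G x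
  pendantClique-bounds {M} G {z} {w} pc s 3≤s 0<b 8≤ab x =
    subst₂ (λ f n → 2ℚ * f ≤ (2ℚ * m + 1ℚ + s) * n) (sym formula) (sym norm)
      (pendantClique-upper m s (0<ι M) 3≤s 0<b 8≤ab (x z) b ‖ y ‖² (sum y) (cauchy-schwarz y)) ,
    subst₂ (λ f n → (2ℚ * m + 1ℚ - s) * n ≤ 2ℚ * f) (sym formula) (sym norm)
      (pendantClique-lower m s (0<ι M) 3≤s 0<b 8≤ab (x z) b ‖ y ‖² (sum y) (cauchy-schwarz y))
    where
    m = ι (suc M)
    b = x (punchIn z w)
    y = λ j → x (punchIn z (punchIn w j))
    formula = form-pendantClique G pc x
    norm : ‖ x ‖² ≡ x z * x z + (b * b + ‖ y ‖²)
    norm = trans (norm-remove z x) (cong (x z * x z +_) (norm-remove w (x ∘ punchIn z)))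

-- The dichotomy: pendant clique or small gap.

module Classification where
  open Data.Rational.Base using (_+_; _*_; -_; _-_; _≤_; 0ℚ; 1ℚ; ½)
  open RationalSums
  open Forms
  open PendantCliqueForm using (3ℚ; 8ℚ)
  open Counting using (𝟙; edge; deg; total; nbrSum)

  0≤2 : 0ℚ ≤ 2ℚ
  0≤2 = ℚ.nonNegative⁻¹ 2ℚ

  unique-true : ∀ {n} (f : Fin n → Bool) → Counting.sum (λ j → 𝟙 (f j)) ≡ 1 →
    ∃[ w ] ∀ j → f j ≡ does (j ≟ w)
  unique-true {suc n} f eq with f zero in f0
  ... | true  = zero , λ { zero → f0 ; (suc j) → all-false j }
    where
    all-false : ∀ j → f (suc j) ≡ false
    all-false j with f (suc j) in fj
    ... | false = refl
    ... | true  = contradiction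
      (subst₂ ℕ._≤_ (cong 𝟙 fj) (ℕ.suc-injective eq) (Counting.term≤sum (λ j → 𝟙 (f (suc j))) j)) λ ()
  ... | false with unique-true (f ∘ suc) eq
  ...   | w , hw = suc w , λ { zero → f0 ; (suc j) → hw j }

  -- Both ends of an edge have degree at least `1`, so `edge-degree-sum` would give
  -- `4 ≤ total H + 2`.
  few-edges⇒none : ∀ {n} (H : Graph n) → total H ℕ.≤ 1 → ∀ i j → adj H i j ≡ false
  few-edges⇒none H F≤1 i j with adj H i j in i~j
  ... | false = refl
  ... | true  = contradiction (begin
    4                                ≤⟨ ℕ.*-monoʳ-≤ 2 (ℕ.+-mono-≤ (endpoint i j i~j)
                                          (endpoint j i (trans (Graph.symm H j i) i~j))) ⟩
    2 ℕ.* (deg H i ℕ.+ deg H j)      ≤⟨ Counting.edge-degree-sum H i j i~j ⟩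
    total H ℕ.+ 2                    ≤⟨ ℕ.+-monoˡ-≤ 2 F≤1 ⟩
    3                                ∎) λ { (ℕ.s≤s (ℕ.s≤s (ℕ.s≤s ()))) }
    where
    open ℕ.≤-Reasoning
    endpoint : ∀ i j → adj H i j ≡ true → 1 ℕ.≤ deg H i
    endpoint i j e = subst (ℕ._≤ deg H i) (cong 𝟙 e) (Counting.term≤sum (edge H i) j)

  pendantClique-by-degree : ∀ {n} (G : Graph (suc n)) z → deg G z ≡ 1 →
    total (complement (G ∖ z)) ℕ.≤ 1 → ∃[ w ] PendantClique G z w
  pendantClique-by-degree G z d≡1 F≤1
    with unique-true (λ j → adj G z (punchIn z j))
           (trans (cong (ℕ._+ Counting.sum (λ j → edge G z (punchIn z j))) (sym (Counting.edge-irrefl G z)))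
             (trans (sym (Counting.deg-remove G z z)) d≡1))
  ... | w , hw = w , record { pendant = hw ; clique = clique }
    where
    clique : ∀ i j → adj G (punchIn z i) (punchIn z j) ≡ not (does (i ≟ j))
    clique i j with i ≟ j | few-edges⇒none (complement (G ∖ z)) F≤1 i j
    ... | yes refl | _       = Graph.irrefl (G ∖ z) i
    ... | no _     | no-edge with adj G (punchIn z i) (punchIn z j)
    ...   | true  = refl
    ...   | false = sym no-edge

  record Bounds {n} (G : Graph n) (τ : ℚ) : Set where
    field
      U L   : ℚ
      upper : ∀ x → form G x ≤ U * ‖ x ‖²
      lower : ∀ x → L * ‖ x ‖² ≤ form G x
      gap   : U - L ≤ τ

  form-upper : ∀ {N} (G : Graph (suc N)) → 1 ℕ.≤ N → (∀ i → 1 ℕ.≤ deg G i) → ∀ x →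
    form G x ≤ (2ℚ * ι N - ι (total (complement G)) * recip N) * ‖ x ‖²
  form-upper {N} G 1≤N d≥1 = form-bound G U 0≤U cond
    where
    open ℚ.≤-Reasoning
    S = total (complement G)
    ρ = recip N
    U = 2ℚ * ι N - ι S * ρ
    cond : ∀ i → ι (deg G i ℕ.* deg G i ℕ.+ nbrSum G (deg G) i) ≤ U * ι (deg G i)
    cond i = begin
      ι X
        ≡⟨ rearrange₁ (ι N) ρ (ι X) (ι S) (ι d) (ι*recip 1≤N) ⟩
      (ι N * ι X + ι S * ι d) * ρ - ι S * ρ * ι d
        ≡⟨ cong (λ h → h * ρ - ι S * ρ * ι d) (trans (ι-+ (N ℕ.* X) (S ℕ.* d)) (cong₂ _+_ (ι-* N X) (ι-* S d))) ⟨
      ι (N ℕ.* X ℕ.+ S ℕ.* d) * ρ - ι S * ρ * ι d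
        ≤⟨ ℚ.+-monoˡ-≤ (- (ι S * ρ * ι d)) (*-monoʳ (0≤recip N)
             (ι-mono (Counting.degree-condition-complement G d≥1 i))) ⟩
      ι (2 ℕ.* N ℕ.* N ℕ.* d) * ρ - ι S * ρ * ι d
        ≡⟨ cong (λ h → h * ρ - ι S * ρ * ι d) (trans (ι-* (2 ℕ.* N ℕ.* N) d)
             (cong (_* ι d) (trans (ι-* (2 ℕ.* N) N) (cong (_* ι N) (ι-* 2 N))))) ⟩
      2ℚ * ι N * ι N * ι d * ρ - ι S * ρ * ι d
        ≡⟨ rearrange₂ (ι N) ρ (ι S) (ι d) (ι*recip 1≤N) ⟩
      U * ι d ∎
      where
      d = deg G i
      X = d ℕ.* d ℕ.+ nbrSum G (deg G) i
      rearrange₁ : ∀ N ρ X S d → N * ρ ≡ 1ℚ → X ≡ (N * X + S * d) * ρ - S * ρ * d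
      rearrange₁ N ρ X S d eq = trans (trans (sym (ℚ.*-identityˡ X)) (cong (_* X) (sym eq))) (expand N ρ X S d)
        where
        expand : ∀ N ρ X S d → N * ρ * X ≡ (N * X + S * d) * ρ - S * ρ * d
        expand = solve-∀ ring
      rearrange₂ : ∀ N ρ S d → N * ρ ≡ 1ℚ → 2ℚ * N * N * d * ρ - S * ρ * d ≡ (2ℚ * N - S * ρ) * d
      rearrange₂ N ρ S d eq = trans (expand N ρ S d) (trans
        (cong (λ h → (2ℚ * N * h - S * ρ) * d) eq) (cong (λ h → (h - S * ρ) * d) (ℚ.*-identityʳ (2ℚ * N))))
        where
        expand : ∀ N ρ S d → 2ℚ * N * N * d * ρ - S * ρ * d ≡ (2ℚ * N * (N * ρ) - S * ρ) * d
        expand = solve-∀ ring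
    -- The sign of `U` is read off from `cond` at a single vertex: its left side is nonnegative and
    -- its degree is positive.
    0≤U : 0ℚ ≤ U
    0≤U = *-cancelˡ (ℚ.<-≤-trans (0<ι 0) (ι-mono (d≥1 zero))) (begin
      ι (deg G zero) * 0ℚ   ≡⟨ ℚ.*-zeroʳ (ι (deg G zero)) ⟩
      0ℚ                    ≤⟨ 0≤ι (deg G zero ℕ.* deg G zero ℕ.+ nbrSum G (deg G) zero) ⟩
      ι (deg G zero ℕ.* deg G zero ℕ.+ nbrSum G (deg G) zero) ≤⟨ cond zero ⟩
      U * ι (deg G zero)    ≡⟨ ℚ.*-comm U (ι (deg G zero)) ⟩
      ι (deg G zero) * U    ∎)

  -- K⁺ has spread √((2m - 1)² + 8) on m + 2 vertices, which exceeds this.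
  threshold : ℕ → ℚ
  threshold m = 2ℚ * ι m - 1ℚ + (4ℚ + 2ℚ) * recip (4 ℕ.* m)

  4μr≡1 : ∀ m → 40 ℕ.≤ m → 4ℚ * ι m * recip (4 ℕ.* m) ≡ 1ℚ
  4μr≡1 m 40≤m = trans (cong (_* recip (4 ℕ.* m)) (sym (ι-* 4 m)))
    (ι*recip (ℕ.≤-trans (ℕ.≤-trans (ℕ.s≤s ℕ.z≤n) 40≤m) (ℕ.m≤n*m m 4)))

  0≤6r : ∀ m → 0ℚ ≤ (4ℚ + 2ℚ) * recip (4 ℕ.* m)
  0≤6r m = 0≤* (ℚ.nonNegative⁻¹ (4ℚ + 2ℚ)) (0≤recip (4 ℕ.* m))

  -- 2 ρ ≥ 4 r and the concavity of (2μ - 4 - φ)(2φ + 2) in φ on [2 , μ + 3].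
  pendant-slack : ∀ μ φ γ ρ r t → (1ℚ + μ) * ρ ≡ 1ℚ → 4ℚ * μ * r ≡ 1ℚ → γ * t ≡ 1ℚ →
    0ℚ ≤ ρ → 0ℚ ≤ r → 0ℚ ≤ t → ι 10 ≤ μ → 2ℚ ≤ φ → φ ≤ μ + 3ℚ → γ ≡ 2ℚ * μ - 4ℚ - φ →
    0ℚ ≤ (4ℚ + 2ℚ) * r + (φ - 2ℚ) * ρ - 2ℚ * t
  pendant-slack μ φ γ ρ r t Nρ mr γt 0≤ρ 0≤r 0≤t 10≤μ 2≤φ φ≤μ+3 γ≡ =
    subst (0ℚ ≤_) (split φ ρ r t) (0≤+ (0≤* (0≤-difference 2≤φ) 2r≤ρ) t≤)
    where
    split : ∀ φ ρ r t →
      (φ - 2ℚ) * (ρ - 2ℚ * r) + ((2ℚ * φ + 2ℚ) * r - 2ℚ * t) ≡ (4ℚ + 2ℚ) * r + (φ - 2ℚ) * ρ - 2ℚ * t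
    split = solve-∀ ring
    0≤μ-1 : 0ℚ ≤ μ - 1ℚ
    0≤μ-1 = 0≤-difference (ℚ.≤-trans (ι-mono {1} {10} (ℕ.s≤s ℕ.z≤n)) 10≤μ)
    2r≤ρ : 0ℚ ≤ ρ - 2ℚ * r
    2r≤ρ = subst (0ℚ ≤_)
      (trans (expand μ ρ r) (trans (cong₂ (λ p q → p * ρ - 2ℚ * r * q) mr Nρ) (collect ρ r)))
      (0≤* (0≤* 0≤2 (0≤* 0≤ρ 0≤r)) 0≤μ-1)
      where
      expand : ∀ μ ρ r → 2ℚ * (ρ * r) * (μ - 1ℚ) ≡ 4ℚ * μ * r * ρ - 2ℚ * r * ((1ℚ + μ) * ρ)
      expand = solve-∀ ring
      collect : ∀ ρ r → 1ℚ * ρ - 2ℚ * r * 1ℚ ≡ ρ - 2ℚ * r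
      collect = solve-∀ ring
    -- At `φ = 2` the difference is `4 (μ - 9)`. The rest is `φ - 2` times a cofactor that is
    -- nonnegative for `10 ≤ μ` and `φ ≤ μ + 3`. Multiplied by `t r`, the inequality becomes
    -- `2 t ≤ (2 φ + 2) r`.
    product : 0ℚ ≤ γ * (2ℚ * φ + 2ℚ) - 8ℚ * μ
    product = subst (0ℚ ≤_) (trans (concave μ φ) (cong (λ h → h * (2ℚ * φ + 2ℚ) - 8ℚ * μ) (sym γ≡)))
      (0≤+ (0≤* (ℚ.nonNegative⁻¹ 4ℚ) (0≤-difference (ℚ.≤-trans (ι-mono {9} {10} (ℕ.n≤1+n 9)) 10≤μ)))
           (0≤* (0≤-difference 2≤φ)
             (0≤+ (0≤* 0≤2 (0≤-difference 10≤μ)) (0≤* 0≤2 (0≤-difference φ≤μ+3)))))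
      where
      concave : ∀ μ φ →
        4ℚ * (μ - ι 9) + (φ - 2ℚ) * (2ℚ * (μ - ι 10) + 2ℚ * (μ + 3ℚ - φ))
          ≡ (2ℚ * μ - 4ℚ - φ) * (2ℚ * φ + 2ℚ) - 8ℚ * μ
      concave = solve-∀ ring
    t≤ : 0ℚ ≤ (2ℚ * φ + 2ℚ) * r - 2ℚ * t
    t≤ = subst (0ℚ ≤_)
      (trans (expand γ μ φ r t) (trans (cong₂ (λ p q → p * ((2ℚ * φ + 2ℚ) * r) - 2ℚ * t * q) γt mr) (collect φ r t)))
      (0≤* (0≤* 0≤t 0≤r) product)
      where
      expand : ∀ γ μ φ r t →
        t * r * (γ * (2ℚ * φ + 2ℚ) - 8ℚ * μ) ≡ γ * t * ((2ℚ * φ + 2ℚ) * r) - 2ℚ * t * (4ℚ * μ * r)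
      expand = solve-∀ ring
      collect : ∀ φ r t → 1ℚ * ((2ℚ * φ + 2ℚ) * r) - 2ℚ * t * 1ℚ ≡ (2ℚ * φ + 2ℚ) * r - 2ℚ * t
      collect = solve-∀ ring

  -- With `ρ` and `t` at most `1/8`, the losses `2 κ ρ` and `2 κ t` are at most `κ/4` each. Of
  -- `κ - 1` there remains `κ/2 - 1`, which is nonnegative for `κ` at least `2`.
  low-degree-slack : ∀ κ φ ρ r t → 2ℚ ≤ κ → 0ℚ ≤ φ → 0ℚ ≤ ρ → 0ℚ ≤ r → 8ℚ * ρ ≤ 1ℚ → 8ℚ * t ≤ 1ℚ →
    0ℚ ≤ κ - 1ℚ + (4ℚ + 2ℚ) * r + (φ - 2ℚ * κ) * ρ - κ * (2ℚ * t)
  low-degree-slack κ φ ρ r t 2≤κ 0≤φ 0≤ρ 0≤r 8ρ≤1 8t≤1 = subst (0ℚ ≤_) (split κ φ ρ r t)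
    (0≤+ (0≤+ (0≤+
      (0≤* (0≤* (ℚ.nonNegative⁻¹ (½ * ½)) (ℚ.≤-trans 0≤2 2≤κ))
           (0≤+ (0≤-difference 8ρ≤1) (0≤-difference 8t≤1)))
      (0≤* 0≤½ (0≤-difference 2≤κ)))
      (0≤* (ℚ.nonNegative⁻¹ (4ℚ + 2ℚ)) 0≤r))
      (0≤* 0≤φ 0≤ρ))
    where
    split : ∀ κ φ ρ r t →
      ½ * ½ * κ * ((1ℚ - 8ℚ * ρ) + (1ℚ - 8ℚ * t)) + ½ * (κ - 2ℚ) + (4ℚ + 2ℚ) * r + φ * ρ
        ≡ κ - 1ℚ + (4ℚ + 2ℚ) * r + (φ - 2ℚ * κ) * ρ - κ * (2ℚ * t)
    split = solve-∀ ring

  eightfold-recip : ∀ k → 8 ℕ.≤ k → 8ℚ * recip k ≤ 1ℚ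
  eightfold-recip k 8≤k = begin
    8ℚ * recip k    ≤⟨ *-monoʳ (0≤recip k) (ι-mono 8≤k) ⟩
    ι k * recip k   ≡⟨ ι*recip (ℕ.≤-trans (ℕ.s≤s ℕ.z≤n) 8≤k) ⟩
    1ℚ              ∎
    where open ℚ.≤-Reasoning

  module _ {m} (40≤m : 40 ℕ.≤ m) (G : Graph (2 ℕ.+ m)) (d≥1 : ∀ i → 1 ℕ.≤ deg G i) where
    private
      N = suc m
      S = total (complement G)
      μ = ι m
      ρ = recip N
      r = recip (4 ℕ.* m)
      σ = ι S

      Nρ : (1ℚ + μ) * ρ ≡ 1ℚ
      Nρ = trans (cong (_* ρ) (sym (ι-+ 1 m))) (ι*recip {N} (ℕ.s≤s ℕ.z≤n))

      upperBound : ∀ x → form G x ≤ (2ℚ * (1ℚ + μ) - σ * ρ) * ‖ x ‖²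
      upperBound x = subst (λ h → form G x ≤ (2ℚ * h - σ * ρ) * ‖ x ‖²) (ι-+ 1 m)
        (form-upper G (ℕ.s≤s ℕ.z≤n) d≥1 x)

    -- Nonnegativity of the form suffices below, because already `U ≤ 2 N - 3 = 2 m - 1`.
    bounds-many-nonedges : 3 ℕ.* N ℕ.≤ S → Bounds G (threshold m)
    bounds-many-nonedges 3N≤S = record
      { U = 2ℚ * (1ℚ + μ) - σ * ρ ; L = 0ℚ
      ; upper = upperBound
      ; lower = λ x → subst (_≤ form G x) (sym (ℚ.*-zeroˡ ‖ x ‖²)) (0≤form G x)
      ; gap = ≤-by _ (0≤+ (0≤-difference 3≤σρ) (0≤6r m)) (rearrange μ (σ * ρ) r)
      }
      where
      open ℚ.≤-Reasoning
      3≤σρ : 3ℚ ≤ σ * ρ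
      3≤σρ = begin
        3ℚ                   ≡⟨ ℚ.*-identityʳ 3ℚ ⟨
        3ℚ * 1ℚ              ≡⟨ cong (3ℚ *_) (ι*recip {N} (ℕ.s≤s ℕ.z≤n)) ⟨
        3ℚ * (ι N * ρ)       ≡⟨ ℚ.*-assoc 3ℚ (ι N) ρ ⟨
        3ℚ * ι N * ρ         ≡⟨ cong (_* ρ) (ι-* 3 N) ⟨
        ι (3 ℕ.* N) * ρ      ≤⟨ *-monoʳ (0≤recip N) (ι-mono 3N≤S) ⟩
        σ * ρ                ∎
      rearrange : ∀ μ s r → 2ℚ * (1ℚ + μ) - s - 0ℚ + ((s - 3ℚ) + (4ℚ + 2ℚ) * r) ≡ 2ℚ * μ - 1ℚ + (4ℚ + 2ℚ) * r
      rearrange = solve-∀ ring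

    bounds-high-degrees : S ℕ.≤ 3 ℕ.* N → (∀ j → 8 ℕ.≤ deg G j) → Bounds G (threshold m)
    bounds-high-degrees S≤3N d≥8 = record
      { U = 2ℚ * (1ℚ + μ) - σ * ρ ; L = ι (2 ℕ.+ m) - 2ℚ - ι (M ℕ.+ 3)
      ; upper = upperBound
      ; lower = λ x → form-lower G (ι (M ℕ.+ 3)) x (form-bound H (ι (M ℕ.+ 3)) (0≤ι (M ℕ.+ 3)) cond x)
      ; gap = subst (λ l → 2ℚ * (1ℚ + μ) - σ * ρ - l ≤ threshold m) (sym L≡4)
          (≤-by _ (0≤+ (0≤+ (ℚ.nonNegative⁻¹ 1ℚ) (0≤6r m)) (0≤* (0≤ι S) (0≤recip N))) (rearrange μ (σ * ρ) r))
      }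
      where
      H = complement G
      -- Degrees of at least `8` leave at most `N - 8 = m - 7` non-neighbours, so the lower bound is
      -- `m - (M + 3) = 4`. The hypothesis `S ≤ 4 M` of the sparse condition follows from
      -- `S ≤ 3 (M + 8)` once `M` is at least `24`.
      M = m ℕ.∸ 7
      M+7 : M ℕ.+ 7 ≡ m
      M+7 = ℕ.m∸n+n≡m (ℕ.≤-trans (ℕ.m≤n+m 7 33) 40≤m)
      rearrange : ∀ μ s r →
        2ℚ * (1ℚ + μ) - s - 4ℚ + (1ℚ + (4ℚ + 2ℚ) * r + s) ≡ 2ℚ * μ - 1ℚ + (4ℚ + 2ℚ) * r
      rearrange = solve-∀ ring
      L≡4 : ι (2 ℕ.+ m) - 2ℚ - ι (M ℕ.+ 3) ≡ 4ℚ
      L≡4 = trans (cong₂ (λ p q → p - 2ℚ - q)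
                    (trans (ι-+ 2 m) (cong (2ℚ +_) (trans (cong ι (sym M+7)) (ι-+ M 7)))) (ι-+ M 3))
                  (cancel (ι M))
        where
        cancel : ∀ q → 2ℚ + (q + ι 7) - 2ℚ - (q + ι 3) ≡ 4ℚ
        cancel = solve-∀ ring
      h≤ : ∀ j → deg H j ℕ.≤ M
      h≤ j = ℕ.+-cancelʳ-≤ 8 (deg H j) M (begin
        deg H j ℕ.+ 8            ≤⟨ ℕ.+-monoʳ-≤ (deg H j) (d≥8 j) ⟩
        deg H j ℕ.+ deg G j      ≡⟨ Counting.deg-complement′ G j ⟩
        suc m                    ≡⟨ cong suc M+7 ⟨
        suc (M ℕ.+ 7)            ≡⟨ ℕ.+-suc M 7 ⟨
        M ℕ.+ 8                  ∎)
        where open ℕ.≤-Reasoning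
      24≤M : 24 ℕ.≤ M
      24≤M = ℕ.∸-monoˡ-≤ 7 (ℕ.≤-trans (ℕ.m≤n+m 31 9) 40≤m)
      S≤ : S ℕ.≤ 4 ℕ.* M
      S≤ = begin
        S                          ≤⟨ S≤3N ⟩
        3 ℕ.* suc m                ≡⟨ cong (λ k → 3 ℕ.* suc k) M+7 ⟨
        3 ℕ.* suc (M ℕ.+ 7)        ≡⟨ expand M ⟩
        24 ℕ.+ 3 ℕ.* M             ≤⟨ ℕ.+-monoˡ-≤ (3 ℕ.* M) 24≤M ⟩
        4 ℕ.* M                    ∎
        where
        open ℕ.≤-Reasoning
        expand : ∀ M → 3 ℕ.* (1 ℕ.+ (M ℕ.+ 7)) ≡ 24 ℕ.+ 3 ℕ.* M
        expand = ℕ-Solver.solve-∀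
      cond : ∀ i → ι (deg H i ℕ.* deg H i ℕ.+ nbrSum H (deg H) i) ≤ ι (M ℕ.+ 3) * ι (deg H i)
      cond i = ℚ.≤-trans (ι-mono (Counting.degree-condition-sparse H M h≤ S≤ i))
        (ℚ.≤-reflexive (ι-* (M ℕ.+ 3) (deg H i)))

    bounds-low-degree : S ℕ.≤ 3 ℕ.* N → ∀ z → deg G z ℕ.≤ 7 →
      2 ℕ.≤ deg G z ⊎ 2 ℕ.≤ total (complement (G ∖ z)) → Bounds G (threshold m)
    bounds-low-degree S≤3N z k≤7 big = record
      { U = 2ℚ * (1ℚ + μ) - σ * ρ ; L = κ * (1ℚ - 2ℚ * t)
      ; upper = upperBound
      ; lower = λ x → form-low-degree G z g (2ℚ * t) x 1≤g (0≤* 0≤2 (0≤recip G₂)) tg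
          (subst (λ h → h * ‖ x ∘ punchIn z ‖² ≤ form (G ∖ z) (x ∘ punchIn z)) coefficient
            (form-lower (G ∖ z) (½ * ι (F ℕ.+ 2)) (x ∘ punchIn z)
              (form-bound H (½ * ι (F ℕ.+ 2)) (0≤* 0≤½ (0≤ι (F ℕ.+ 2))) cond (x ∘ punchIn z))))
      ; gap = ≤-by _ slack (trans
          (cong (λ h → 2ℚ * (1ℚ + μ) - h * ρ - κ * (1ℚ - 2ℚ * t)
                       + (κ - 1ℚ + (4ℚ + 2ℚ) * r + (φ - 2ℚ * κ) * ρ - κ * (2ℚ * t))) σ≡)
          (trans (expand μ φ κ ρ r t) (trans
            (cong (λ h → 2ℚ * (1ℚ + μ) - 2ℚ * h - 1ℚ + (4ℚ + 2ℚ) * r) Nρ)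
            (collect μ r))))
      }
      where
      k = deg G z
      H = complement (G ∖ z)
      F = total H
      κ = ι k
      φ = ι F

      equation : S ℕ.+ 2 ℕ.* k ≡ F ℕ.+ 2 ℕ.* N
      equation = Counting.total-complement-remove G z

      F≤ : F ℕ.≤ suc m ℕ.+ 2 ℕ.* k
      F≤ = ℕ.+-cancelʳ-≤ (2 ℕ.* N) F (suc m ℕ.+ 2 ℕ.* k) (begin
        F ℕ.+ 2 ℕ.* N                  ≡⟨ equation ⟨
        S ℕ.+ 2 ℕ.* k                  ≤⟨ ℕ.+-monoˡ-≤ (2 ℕ.* k) S≤3N ⟩
        3 ℕ.* N ℕ.+ 2 ℕ.* k            ≡⟨ rearrange N k ⟩
        N ℕ.+ 2 ℕ.* k ℕ.+ 2 ℕ.* N      ∎)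
        where
        open ℕ.≤-Reasoning
        rearrange : ∀ N k → 3 ℕ.* N ℕ.+ 2 ℕ.* k ≡ N ℕ.+ 2 ℕ.* k ℕ.+ 2 ℕ.* N
        rearrange = ℕ-Solver.solve-∀

      -- Here `31 = 3 + 4 * 7`, from the bound on `F` and `k ≤ 7`. That `2 m` exceeds this by `8` is
      -- mathematically the tightest use of `40 ≤ m`.
      2+F+2k≤ : 2 ℕ.+ F ℕ.+ 2 ℕ.* k ℕ.≤ 31 ℕ.+ m
      2+F+2k≤ = begin
        2 ℕ.+ F ℕ.+ 2 ℕ.* k                            ≤⟨ ℕ.+-monoˡ-≤ (2 ℕ.* k) (ℕ.+-monoʳ-≤ 2 F≤) ⟩
        2 ℕ.+ (suc m ℕ.+ 2 ℕ.* k) ℕ.+ 2 ℕ.* k          ≡⟨ rearrange m k ⟩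
        3 ℕ.+ m ℕ.+ 4 ℕ.* k                            ≤⟨ ℕ.+-monoʳ-≤ (3 ℕ.+ m) (ℕ.*-monoʳ-≤ 4 k≤7) ⟩
        3 ℕ.+ m ℕ.+ 28                                 ≡⟨ rearrange′ m ⟩
        31 ℕ.+ m                                       ∎
        where
        open ℕ.≤-Reasoning
        rearrange : ∀ m k → 2 ℕ.+ (1 ℕ.+ m ℕ.+ 2 ℕ.* k) ℕ.+ 2 ℕ.* k ≡ 3 ℕ.+ m ℕ.+ 4 ℕ.* k
        rearrange = ℕ-Solver.solve-∀
        rearrange′ : ∀ m → 3 ℕ.+ m ℕ.+ 28 ≡ 31 ℕ.+ m
        rearrange′ = ℕ-Solver.solve-∀

      -- Twice the `g` of `form-low-degree`, to stay within the naturals. Equating the lower bound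
      -- `m - 1 - (F + 2)/2` for `G ∖ z` with `g - 1 + k` gives `g = m - 1 - F/2 - k`; its
      -- reciprocal is then `2 t`.
      G₂ : ℕ
      G₂ = 2 ℕ.* m ℕ.∸ (2 ℕ.+ F ℕ.+ 2 ℕ.* k)

      31+m≤2m : 31 ℕ.+ m ℕ.≤ 2 ℕ.* m
      31+m≤2m = ℕ.≤-trans (ℕ.+-monoˡ-≤ m (ℕ.≤-trans (ℕ.m≤n+m 31 9) 40≤m))
        (ℕ.≤-reflexive (cong (m ℕ.+_) (sym (ℕ.+-identityʳ m))))

      G₂-equation : 2 ℕ.+ F ℕ.+ 2 ℕ.* k ℕ.+ G₂ ≡ 2 ℕ.* m
      G₂-equation = ℕ.m+[n∸m]≡n (ℕ.≤-trans 2+F+2k≤ 31+m≤2m)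

      8≤G₂ : 8 ℕ.≤ G₂
      8≤G₂ = ℕ.+-cancelˡ-≤ (31 ℕ.+ m) 8 G₂ (begin
        31 ℕ.+ m ℕ.+ 8                       ≡⟨ rearrange m ⟩
        39 ℕ.+ m                             ≤⟨ ℕ.+-monoˡ-≤ m (ℕ.≤-trans (ℕ.n≤1+n 39) 40≤m) ⟩
        m ℕ.+ m                              ≡⟨ cong (m ℕ.+_) (ℕ.+-identityʳ m) ⟨
        2 ℕ.* m                              ≡⟨ G₂-equation ⟨
        2 ℕ.+ F ℕ.+ 2 ℕ.* k ℕ.+ G₂           ≤⟨ ℕ.+-monoˡ-≤ G₂ 2+F+2k≤ ⟩
        31 ℕ.+ m ℕ.+ G₂                      ∎)
        where
        open ℕ.≤-Reasoning
        rearrange : ∀ m → 31 ℕ.+ m ℕ.+ 8 ≡ 39 ℕ.+ m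
        rearrange = ℕ-Solver.solve-∀

      γ t g : ℚ
      γ = ι G₂
      t = recip G₂
      g = ½ * γ

      γt : γ * t ≡ 1ℚ
      γt = ι*recip (ℕ.≤-trans (ℕ.s≤s ℕ.z≤n) 8≤G₂)

      tg : 2ℚ * t * g ≡ 1ℚ
      tg = trans (rearrange t γ) γt
        where
        rearrange : ∀ t γ → 2ℚ * t * (½ * γ) ≡ γ * t
        rearrange = solve-∀ ring

      1≤g : 1ℚ ≤ g
      1≤g = *-monoˡ 0≤½ (ι-mono (ℕ.≤-trans (ℕ.s≤s (ℕ.s≤s ℕ.z≤n)) 8≤G₂))

      γ≡ : γ ≡ 2ℚ * μ - 2ℚ - φ - 2ℚ * κ
      γ≡ = trans (isolate φ κ γ) (cong (λ h → h - 2ℚ - φ - 2ℚ * κ) (begin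
        2ℚ + φ + 2ℚ * κ + γ                    ≡⟨ cong₂ (λ p q → p + q + γ) (ι-+ 2 F) (ι-* 2 k) ⟨
        ι (2 ℕ.+ F) + ι (2 ℕ.* k) + γ          ≡⟨ cong (_+ γ) (ι-+ (2 ℕ.+ F) (2 ℕ.* k)) ⟨
        ι (2 ℕ.+ F ℕ.+ 2 ℕ.* k) + γ            ≡⟨ ι-+ (2 ℕ.+ F ℕ.+ 2 ℕ.* k) G₂ ⟨
        ι (2 ℕ.+ F ℕ.+ 2 ℕ.* k ℕ.+ G₂)         ≡⟨ cong ι G₂-equation ⟩
        ι (2 ℕ.* m)                            ≡⟨ ι-* 2 m ⟩
        2ℚ * μ                                 ∎))
        where
        open ≡-Reasoning
        isolate : ∀ φ κ γ → γ ≡ 2ℚ + φ + 2ℚ * κ + γ - 2ℚ - φ - 2ℚ * κ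
        isolate = solve-∀ ring

      σ≡ : σ ≡ φ + 2ℚ * (1ℚ + μ) - 2ℚ * κ
      σ≡ = trans (isolate σ κ) (cong (_- 2ℚ * κ) (begin
        σ + 2ℚ * κ               ≡⟨ cong (σ +_) (ι-* 2 k) ⟨
        σ + ι (2 ℕ.* k)          ≡⟨ ι-+ S (2 ℕ.* k) ⟨
        ι (S ℕ.+ 2 ℕ.* k)        ≡⟨ cong ι equation ⟩
        ι (F ℕ.+ 2 ℕ.* N)        ≡⟨ ι-+ F (2 ℕ.* N) ⟩
        φ + ι (2 ℕ.* N)          ≡⟨ cong (φ +_) (trans (ι-* 2 N) (cong (2ℚ *_) (ι-+ 1 m))) ⟩
        φ + 2ℚ * (1ℚ + μ)        ∎))
        where
        open ≡-Reasoning
        isolate : ∀ σ κ → σ ≡ σ + 2ℚ * κ - 2ℚ * κ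
        isolate = solve-∀ ring

      coefficient : ι (suc m) - 2ℚ - ½ * ι (F ℕ.+ 2) ≡ g - 1ℚ + κ
      coefficient = trans (cong₂ (λ p q → p - 2ℚ - ½ * q) (ι-+ 1 m) (ι-+ F 2))
        (trans (rearrange μ φ κ) (cong (λ h → ½ * h - 1ℚ + κ) (sym γ≡)))
        where
        rearrange : ∀ μ φ κ →
          1ℚ + μ - 2ℚ - ½ * (φ + 2ℚ) ≡ ½ * (2ℚ * μ - 2ℚ - φ - 2ℚ * κ) - 1ℚ + κ
        rearrange = solve-∀ ring

      cond : ∀ i → ι (deg H i ℕ.* deg H i ℕ.+ nbrSum H (deg H) i) ≤ ½ * ι (F ℕ.+ 2) * ι (deg H i)
      cond i = begin
        ι X                                    ≡⟨ halve (ι X) ⟩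
        ½ * (2ℚ * ι X)                         ≡⟨ cong (½ *_) (ι-* 2 X) ⟨
        ½ * ι (2 ℕ.* X)                        ≤⟨ *-monoˡ 0≤½ (ι-mono (Counting.degree-condition-total H i)) ⟩
        ½ * ι ((F ℕ.+ 2) ℕ.* deg H i)          ≡⟨ cong (½ *_) (ι-* (F ℕ.+ 2) (deg H i)) ⟩
        ½ * (ι (F ℕ.+ 2) * ι (deg H i))        ≡⟨ ℚ.*-assoc ½ (ι (F ℕ.+ 2)) (ι (deg H i)) ⟨
        ½ * ι (F ℕ.+ 2) * ι (deg H i)          ∎
        where
        open ℚ.≤-Reasoning
        X = deg H i ℕ.* deg H i ℕ.+ nbrSum H (deg H) i
        halve : ∀ x → x ≡ ½ * (2ℚ * x)
        halve = solve-∀ ring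

      expand : ∀ μ φ κ ρ r t →
        2ℚ * (1ℚ + μ) - (φ + 2ℚ * (1ℚ + μ) - 2ℚ * κ) * ρ - κ * (1ℚ - 2ℚ * t)
          + (κ - 1ℚ + (4ℚ + 2ℚ) * r + (φ - 2ℚ * κ) * ρ - κ * (2ℚ * t))
        ≡ 2ℚ * (1ℚ + μ) - 2ℚ * ((1ℚ + μ) * ρ) - 1ℚ + (4ℚ + 2ℚ) * r
      expand = solve-∀ ring
      collect : ∀ μ r →
        2ℚ * (1ℚ + μ) - 2ℚ * 1ℚ - 1ℚ + (4ℚ + 2ℚ) * r ≡ 2ℚ * μ - 1ℚ + (4ℚ + 2ℚ) * r
      collect = solve-∀ ring

      pendant-case : ¬ 2 ℕ.≤ k → 0ℚ ≤ κ - 1ℚ + (4ℚ + 2ℚ) * r + (φ - 2ℚ * κ) * ρ - κ * (2ℚ * t)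
      pendant-case 2≰k = subst (0ℚ ≤_) (trans (rearrange φ ρ r t) (cong
          (λ h → h - 1ℚ + (4ℚ + 2ℚ) * r + (φ - 2ℚ * h) * ρ - h * (2ℚ * t)) (sym κ≡1)))
        (pendant-slack μ φ γ ρ r t Nρ (4μr≡1 m 40≤m) γt (0≤recip N) (0≤recip (4 ℕ.* m)) (0≤recip G₂)
          (ι-mono (ℕ.≤-trans (ℕ.m≤n+m 10 30) 40≤m)) (ι-mono 2≤F) φ≤
          (trans γ≡ (trans (cong (λ h → 2ℚ * μ - 2ℚ - φ - 2ℚ * h) κ≡1) (rearrange′ μ φ))))
        where
        k≡1 : k ≡ 1
        k≡1 = ℕ.≤-antisym (ℕ.s≤s⁻¹ (ℕ.≰⇒> 2≰k)) (d≥1 z)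
        κ≡1 : κ ≡ 1ℚ
        κ≡1 = cong ι k≡1
        2≤F : 2 ℕ.≤ F
        2≤F = [ (λ 2≤k → contradiction 2≤k 2≰k) , id ]′ big
        φ≤ : φ ≤ μ + 3ℚ
        φ≤ = subst (φ ≤_) (ι-+ m 3) (ι-mono (ℕ.≤-trans F≤
          (ℕ.≤-reflexive (trans (cong (λ h → suc m ℕ.+ 2 ℕ.* h) k≡1) (shift m)))))
          where
          shift : ∀ m → 1 ℕ.+ m ℕ.+ 2 ≡ m ℕ.+ 3
          shift = ℕ-Solver.solve-∀
        rearrange : ∀ φ ρ r t → (4ℚ + 2ℚ) * r + (φ - 2ℚ) * ρ - 2ℚ * t
          ≡ 1ℚ - 1ℚ + (4ℚ + 2ℚ) * r + (φ - 2ℚ * 1ℚ) * ρ - 1ℚ * (2ℚ * t)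
        rearrange = solve-∀ ring
        rearrange′ : ∀ μ φ → 2ℚ * μ - 2ℚ - φ - 2ℚ * 1ℚ ≡ 2ℚ * μ - 4ℚ - φ
        rearrange′ = solve-∀ ring

      slack : 0ℚ ≤ κ - 1ℚ + (4ℚ + 2ℚ) * r + (φ - 2ℚ * κ) * ρ - κ * (2ℚ * t)
      slack = cases (2 ℕ.≤? k)
        where
        cases : Dec (2 ℕ.≤ k) → 0ℚ ≤ κ - 1ℚ + (4ℚ + 2ℚ) * r + (φ - 2ℚ * κ) * ρ - κ * (2ℚ * t)
        cases (yes 2≤k) = low-degree-slack κ φ ρ r t (ι-mono 2≤k) (0≤ι F) (0≤recip N) (0≤recip (4 ℕ.* m))
          (eightfold-recip N (ℕ.m≤n⇒m≤1+n (ℕ.≤-trans (ℕ.m≤n+m 8 32) 40≤m))) (eightfold-recip G₂ 8≤G₂)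
        cases (no 2≰k)  = pendant-case 2≰k

    -- Every test compares natural numbers, so the alternative is decided constructively. In the
    -- last branch `G` has a vertex of degree `1` whose deletion leaves no non-edge.
    classify : (∃[ z ] ∃[ w ] PendantClique G z w) ⊎ Bounds G (threshold m)
    classify with S ℕ.≤? 3 ℕ.* N
    ... | no S≰3N = inj₂ (bounds-many-nonedges (ℕ.<⇒≤ (ℕ.≰⇒> S≰3N)))
    ... | yes S≤3N with any? (λ z → deg G z ℕ.≤? 7)
    ...   | no none = inj₂ (bounds-high-degrees S≤3N (λ j → ℕ.≰⇒> (λ d≤7 → none (j , d≤7))))
    ...   | yes (z , d≤7) with 2 ℕ.≤? deg G z | 2 ℕ.≤? total (complement (G ∖ z))
    ...     | yes 2≤d | _       = inj₂ (bounds-low-degree S≤3N z d≤7 (inj₁ 2≤d))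
    ...     | no _    | yes 2≤F = inj₂ (bounds-low-degree S≤3N z d≤7 (inj₂ 2≤F))
    ...     | no 2≰d  | no 2≰F  = inj₁ (z , pendantClique-by-degree G z
      (ℕ.≤-antisym (ℕ.s≤s⁻¹ (ℕ.≰⇒> 2≰d)) (d≥1 z)) (ℕ.s≤s⁻¹ (ℕ.≰⇒> 2≰F)))

-- Null sequences of rationals.

module NullSequences where
  open Data.Rational.Base using (_+_; _*_; -_; _-_; _≤_; _<_; 0ℚ; 1ℚ; ½; 1/_)
  open RationalSums

  Null : (ℕ → ℚ) → Set
  Null f = ∀ ε → 0ℚ < ε → ∃[ N ] ∀ n → N ℕ.≤ n → ∣ f n ∣ℚ ≤ ε

  Bounded : (ℕ → ℚ) → Set
  Bounded f = ∃[ B ] ∃[ N ] 0ℚ < B × (∀ n → N ℕ.≤ n → ∣ f n ∣ℚ ≤ B)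

  0<½* : ∀ {ε} → 0ℚ < ε → 0ℚ < ½ * ε
  0<½* = 0<* (ℚ.positive⁻¹ ½)

  ½+½ : ∀ ε → ½ * ε + ½ * ε ≡ ε
  ½+½ = solve-∀ ring

  null-cong : ∀ {f g} → (∀ n → f n ≡ g n) → Null f → Null g
  null-cong f≗g nf ε 0<ε with nf ε 0<ε
  ... | N , h = N , λ n n≥N → subst (λ p → ∣ p ∣ℚ ≤ ε) (f≗g n) (h n n≥N)

  null-zero : Null (λ _ → 0ℚ)
  null-zero ε 0<ε = 0 , λ _ _ → ℚ.<⇒≤ 0<ε

  null-neg : ∀ {f} → Null f → Null (λ n → - f n)
  null-neg {f} nf ε 0<ε with nf ε 0<ε
  ... | N , h = N , λ n n≥N → subst (_≤ ε) (sym (ℚ.∣-p∣≡∣p∣ (f n))) (h n n≥N)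

  null-+ : ∀ {f g} → Null f → Null g → Null (λ n → f n + g n)
  null-+ {f} {g} nf ng ε 0<ε with nf (½ * ε) (0<½* 0<ε) | ng (½ * ε) (0<½* 0<ε)
  ... | M , hf | N , hg = M ℕ.⊔ N , λ n n≥ → begin
    ∣ f n + g n ∣ℚ          ≤⟨ ℚ.∣p+q∣≤∣p∣+∣q∣ (f n) (g n) ⟩
    ∣ f n ∣ℚ + ∣ g n ∣ℚ     ≤⟨ ℚ.+-mono-≤ (hf n (ℕ.m⊔n≤o⇒m≤o M N n≥)) (hg n (ℕ.m⊔n≤o⇒n≤o M N n≥)) ⟩
    ½ * ε + ½ * ε           ≡⟨ ½+½ ε ⟩
    ε                       ∎
    where open ℚ.≤-Reasoning

  null-* : ∀ {f g} → Bounded f → Null g → Null (λ n → f n * g n)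
  null-* {f} {g} (B , M , 0<B , hf) ng ε 0<ε with ng (1/B * ε) (0<* 0<1/B 0<ε)
    where
    instance
      B-positive : ℚ.Positive B
      B-positive = ℚ.positive 0<B
      B-nonZero : ℚ.NonZero B
      B-nonZero = ℚ.pos⇒nonZero B
    1/B : ℚ
    1/B = 1/ B
    0<1/B : 0ℚ < 1/B
    0<1/B = ℚ.positive⁻¹ 1/B {{ℚ.1/pos⇒pos B}}
  ... | N , hg = M ℕ.⊔ N , λ n n≥ → begin
    ∣ f n * g n ∣ℚ          ≡⟨ ℚ.∣p*q∣≡∣p∣*∣q∣ (f n) (g n) ⟩
    ∣ f n ∣ℚ * ∣ g n ∣ℚ     ≤⟨ *-monoʳ (ℚ.0≤∣p∣ (g n)) (hf n (ℕ.m⊔n≤o⇒m≤o M N n≥)) ⟩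
    B * ∣ g n ∣ℚ            ≤⟨ *-monoˡ (ℚ.<⇒≤ 0<B) (hg n (ℕ.m⊔n≤o⇒n≤o M N n≥)) ⟩
    B * (1/B * ε)           ≡⟨ ℚ.*-assoc B 1/B ε ⟨
    B * 1/B * ε             ≡⟨ cong (_* ε) (ℚ.*-inverseʳ B) ⟩
    1ℚ * ε                  ≡⟨ ℚ.*-identityˡ ε ⟩
    ε                       ∎
    where
    open ℚ.≤-Reasoning
    instance
      B-nonZero : ℚ.NonZero B
      B-nonZero = ℚ.pos⇒nonZero B {{ℚ.positive 0<B}}
    1/B : ℚ
    1/B = 1/ B

  null-sum : ∀ {k} {f : Fin k → ℕ → ℚ} → (∀ i → Null (f i)) → Null (λ n → sum λ i → f i n)
  null-sum {zero}  nf = null-zero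
  null-sum {suc k} nf = null-+ (nf zero) (null-sum (λ i → nf (suc i)))

  cauchy⇒bounded : ∀ f → Cauchy f → Bounded f
  cauchy⇒bounded f cf with cf 1ℚ (ℚ.positive⁻¹ 1ℚ)
  ... | N , h = 1ℚ + ∣ f N ∣ℚ , N , ℚ.+-mono-<-≤ (ℚ.positive⁻¹ 1ℚ) (ℚ.0≤∣p∣ (f N)) , λ n n≥N → begin
    ∣ f n ∣ℚ                       ≡⟨ cong ∣_∣ℚ (split (f n) (f N)) ⟩
    ∣ (f n - f N) + f N ∣ℚ         ≤⟨ ℚ.∣p+q∣≤∣p∣+∣q∣ (f n - f N) (f N) ⟩
    ∣ f n - f N ∣ℚ + ∣ f N ∣ℚ      ≤⟨ ℚ.+-monoˡ-≤ ∣ f N ∣ℚ (h n N n≥N ℕ.≤-refl) ⟩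
    1ℚ + ∣ f N ∣ℚ                  ∎
    where
    open ℚ.≤-Reasoning
    split : ∀ a b → a ≡ (a - b) + b
    split = solve-∀ ring

  p≤∣p∣ : ∀ p → p ≤ ∣ p ∣ℚ
  p≤∣p∣ p with ℚ.≤-total 0ℚ p
  ... | inj₁ 0≤p = ℚ.≤-reflexive (sym (ℚ.0≤p⇒∣p∣≡p 0≤p))
  ... | inj₂ p≤0 = ℚ.≤-trans p≤0 (ℚ.0≤∣p∣ p)

  ∣p-q∣≤ε⇒p≤q+ε : ∀ {ε} p q → ∣ p - q ∣ℚ ≤ ε → p ≤ q + ε
  ∣p-q∣≤ε⇒p≤q+ε {ε} p q h = begin
    p                ≡⟨ split p q ⟩
    q + (p - q)      ≤⟨ ℚ.+-monoʳ-≤ q (ℚ.≤-trans (p≤∣p∣ (p - q)) h) ⟩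
    q + ε            ∎
    where
    open ℚ.≤-Reasoning
    split : ∀ p q → p ≡ q + (p - q)
    split = solve-∀ ring

  ∣p-q∣≡∣q-p∣ : ∀ p q → ∣ p - q ∣ℚ ≡ ∣ q - p ∣ℚ
  ∣p-q∣≡∣q-p∣ p q = trans (sym (ℚ.∣-p∣≡∣p∣ (p - q))) (cong ∣_∣ℚ (flip p q))
    where
    flip : ∀ p q → - (p - q) ≡ q - p
    flip = solve-∀ ring

  ∣p∣*∣p∣≡p*p : ∀ p → ∣ p ∣ℚ * ∣ p ∣ℚ ≡ p * p
  ∣p∣*∣p∣≡p*p p = trans (sym (ℚ.∣p*q∣≡∣p∣*∣q∣ p p)) (ℚ.0≤p⇒∣p∣≡p (0≤square p))

  square-cancel-≤ : ∀ {p q} → 0ℚ ≤ q → p * p ≤ q * q → p ≤ q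
  square-cancel-≤ {p} {q} 0≤q p²≤q² with p ℚ.≤? q
  ... | yes p≤q = p≤q
  ... | no p≰q  = contradiction (ℚ.<-≤-trans q²<p² p²≤q²) (ℚ.<-irrefl refl)
    where
    open ℚ.≤-Reasoning
    q<p = ℚ.≰⇒> p≰q
    q²<p² : q * q < p * p
    q²<p² = begin-strict
      q * q ≤⟨ *-monoˡ 0≤q (ℚ.<⇒≤ q<p) ⟩
      q * p <⟨ ℚ.*-monoˡ-<-pos p {{ℚ.positive (ℚ.≤-<-trans 0≤q q<p)}} q<p ⟩
      p * p ∎

  -- A constructive replacement for comparing a real with `0`. One late term, within `ε/4` of all
  -- later ones, is compared with `ε/2`; the two alternatives overlap, so this rational test decides
  -- between them.
  sign-split : ∀ f → Cauchy f → ∀ ε → 0ℚ < ε →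
    (∃[ N ] ∀ n → N ℕ.≤ n → f n ≤ ε) ⊎ (∃[ η ] ∃[ N ] 0ℚ < η × (∀ n → N ℕ.≤ n → η ≤ f n))
  sign-split f cf ε 0<ε with cf (½ * (½ * ε)) (0<½* (0<½* 0<ε))
  ... | N , h with f N ℚ.≤? ½ * ε
  ...   | yes fN≤ = inj₁ (N , λ n n≥N → begin
    f n                                   ≤⟨ ∣p-q∣≤ε⇒p≤q+ε (f n) (f N) (h n N n≥N ℕ.≤-refl) ⟩
    f N + ½ * (½ * ε)                     ≤⟨ ℚ.+-monoˡ-≤ (½ * (½ * ε)) fN≤ ⟩
    ½ * ε + ½ * (½ * ε)                   ≤⟨ ≤-by (½ * (½ * ε)) (ℚ.<⇒≤ (0<½* (0<½* 0<ε))) (collect ε) ⟩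
    ε                                     ∎)
    where
    open ℚ.≤-Reasoning
    collect : ∀ ε → ½ * ε + ½ * (½ * ε) + ½ * (½ * ε) ≡ ε
    collect = solve-∀ ring
  ...   | no fN≰ = inj₂ (½ * (½ * ε) , N , 0<½* (0<½* 0<ε) , λ n n≥N → begin
    ½ * (½ * ε)                           ≡⟨ isolate ε ⟩
    ½ * ε - ½ * (½ * ε)                   ≤⟨ ℚ.+-monoˡ-≤ (- (½ * (½ * ε))) (ℚ.<⇒≤ (ℚ.≰⇒> fN≰)) ⟩
    f N - ½ * (½ * ε)                     ≤⟨ ℚ.+-monoˡ-≤ (- (½ * (½ * ε)))
                                              (∣p-q∣≤ε⇒p≤q+ε (f N) (f n) (h N n ℕ.≤-refl n≥N)) ⟩
    f n + ½ * (½ * ε) - ½ * (½ * ε)       ≡⟨ cancel (f n) (½ * (½ * ε)) ⟩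
    f n                                   ∎)
    where
    open ℚ.≤-Reasoning
    isolate : ∀ ε → ½ * (½ * ε) ≡ ½ * ε - ½ * (½ * ε)
    isolate = solve-∀ ring
    cancel : ∀ p q → p + q - q ≡ p
    cancel = solve-∀ ring

-- Square roots by Newton iteration.

module SquareRoot where
  open Data.Rational.Base using (_+_; _*_; -_; _-_; _≤_; _<_; 0ℚ; 1ℚ; ½; 1/_)
  open RationalSums
  open NullSequences
  open PendantCliqueForm using (3ℚ)

  -- The Archimedean property: a positive rational is at least the reciprocal of its denominator,
  -- which is `suc d`.
  recip-null : Null (λ n → recip (suc n))
  recip-null ε@(ℚ.mkℚ (ℤ.+ suc p) d _) 0<ε = suc d , λ n n≥ →
    subst (_≤ ε) (sym (ℚ.0≤p⇒∣p∣≡p (0≤recip (suc n)))) (*-cancelˡ (0<ι n) (begin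
    ι (suc n) * recip (suc n)      ≡⟨ ι*recip {suc n} (ℕ.s≤s ℕ.z≤n) ⟩
    1ℚ                             ≡⟨ ℚ.*-inverseʳ δ ⟨
    δ * (1/ δ)                     ≡⟨ cong (_* (1/ δ)) (ℚ.normalize-coprime (Coprimality.sym (Coprimality.1-coprimeTo (suc d)))) ⟨
    ι (suc d) * (1/ δ)             ≤⟨ *-monoˡ (0≤ι (suc d)) 1/δ≤ε ⟩
    ι (suc d) * ε                  ≤⟨ *-monoʳ (ℚ.<⇒≤ 0<ε) (ι-mono (ℕ.m≤n⇒m≤1+n n≥)) ⟩
    ι (suc n) * ε                  ∎))
    where
    open ℚ.≤-Reasoning
    δ = ℚ.mkℚ (ℤ.+ suc d) 0 (Coprimality.sym (Coprimality.1-coprimeTo (suc d)))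
    1/δ≤ε : 1/ δ ≤ ε
    1/δ≤ε = ℚ.*≤* (ℤ.*-monoʳ-≤-nonNeg (ℤ.+ suc d) (ℤ.+≤+ (ℕ.s≤s (ℕ.z≤n {p}))))
  recip-null (ℚ.mkℚ (ℤ.+ zero)   d _) (ℚ.*<* (ℤ.+<+ ()))
  recip-null (ℚ.mkℚ ℤ.-[1+ _ ]   d _) (ℚ.*<* ())

  null-dominated : ∀ {f g} → (∀ n → ∣ f n ∣ℚ ≤ ∣ g n ∣ℚ) → Null g → Null f
  null-dominated f≤g ng ε 0<ε with ng ε 0<ε
  ... | N , h = N , λ n n≥N → ℚ.≤-trans (f≤g n) (h n n≥N)

  bounded-const : ∀ c → Bounded (λ _ → c)
  bounded-const c = 1ℚ + ∣ c ∣ℚ , 0 , ℚ.+-mono-<-≤ (ℚ.positive⁻¹ 1ℚ) (ℚ.0≤∣p∣ c) ,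
    λ _ _ → ≤-by 1ℚ (ℚ.nonNegative⁻¹ 1ℚ) (ℚ.+-comm ∣ c ∣ℚ 1ℚ)

  null-scale : ∀ c {f} → Null f → Null (λ n → c * f n)
  null-scale c = null-* (bounded-const c)

  null-cancel : ∀ {c f : ℕ → ℚ} → (∀ n → 1ℚ ≤ c n) → Null (λ n → c n * f n) → Null f
  null-cancel {c} {f} 1≤c = null-dominated λ n → begin
    ∣ f n ∣ℚ                ≡⟨ ℚ.*-identityˡ ∣ f n ∣ℚ ⟨
    1ℚ * ∣ f n ∣ℚ           ≤⟨ *-monoʳ (ℚ.0≤∣p∣ (f n)) (ℚ.≤-trans (1≤c n) (p≤∣p∣ (c n))) ⟩
    ∣ c n ∣ℚ * ∣ f n ∣ℚ     ≡⟨ ℚ.∣p*q∣≡∣p∣*∣q∣ (c n) (f n) ⟨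
    ∣ c n * f n ∣ℚ          ∎
    where open ℚ.≤-Reasoning

  -- The factor `x i + x j` of the difference of squares is at least `1`, so closeness of the
  -- squares passes to the terms themselves.
  square-cauchy : ∀ x M → (∀ k → 3ℚ ≤ x k) → Null (λ k → x k * x k - M) → Cauchy x
  square-cauchy x M 3≤x x²→M ε 0<ε with x²→M (½ * ε) (0<½* 0<ε)
  ... | N , h = N , λ i j i≥ j≥ → begin
    ∣ x i - x j ∣ℚ
      ≡⟨ ℚ.*-identityˡ ∣ x i - x j ∣ℚ ⟨
    1ℚ * ∣ x i - x j ∣ℚ
      ≤⟨ *-monoʳ (ℚ.0≤∣p∣ (x i - x j)) (ℚ.≤-trans (1≤sum i j) (p≤∣p∣ (x i + x j))) ⟩
    ∣ x i + x j ∣ℚ * ∣ x i - x j ∣ℚ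
      ≡⟨ ℚ.∣p*q∣≡∣p∣*∣q∣ (x i + x j) (x i - x j) ⟨
    ∣ (x i + x j) * (x i - x j) ∣ℚ
      ≡⟨ cong ∣_∣ℚ (factor (x i) (x j) M) ⟩
    ∣ (x i * x i - M) - (x j * x j - M) ∣ℚ
      ≤⟨ ℚ.∣p-q∣≤∣p∣+∣q∣ (x i * x i - M) (x j * x j - M) ⟩
    ∣ x i * x i - M ∣ℚ + ∣ x j * x j - M ∣ℚ
      ≤⟨ ℚ.+-mono-≤ (h i i≥) (h j j≥) ⟩
    ½ * ε + ½ * ε
      ≡⟨ ½+½ ε ⟩
    ε ∎
    where
    open ℚ.≤-Reasoning
    1≤sum : ∀ i j → 1ℚ ≤ x i + x j
    1≤sum i j = ℚ.≤-trans (ℚ.≤ᵇ⇒≤ _) (ℚ.+-mono-≤ (3≤x i) (3≤x j))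
    factor : ∀ a b M → (a + b) * (a - b) ≡ (a * a - M) - (b * b - M)
    factor = solve-∀ ring

  module _ (M : ℚ) (9≤M : 3ℚ * 3ℚ ≤ M) where

    private
      0≤M : 0ℚ ≤ M
      0≤M = ℚ.≤-trans (ℚ.nonNegative⁻¹ (3ℚ * 3ℚ)) 9≤M

    -- Approximation from above is essential: `M ≤ value²` is the discriminant condition of
    -- `pendantClique-bounds`, so every iterate can serve there as a rational `s`.
    record Approximation (e : ℚ) : Set where
      field
        value : ℚ
        pos   : 0ℚ < value
        above : M ≤ value * value
        near  : value * value ≤ M + e

      3≤value : 3ℚ ≤ value
      3≤value = square-cancel-≤ (ℚ.<⇒≤ pos) (ℚ.≤-trans 9≤M above)

    -- The Newton step x ↦ (x + M/x)/2, whose error is ((x² - M)/2x)².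
    newton : ∀ {e} → Approximation e → Approximation (½ * ½ * e)
    newton {e} a = record
      { value = ½ * (x + M * y)
      ; pos   = 0<* (ℚ.positive⁻¹ ½) (ℚ.+-mono-<-≤ pos (0≤* 0≤M (ℚ.<⇒≤ 0<y)))
      ; above = ≤-by _ (0≤square (½ * (x - M * y))) (trans (error x y M) (cong (λ h → square + M * (1ℚ - h)) xy)
                  ⟨ trans ⟩ collect square M)
      ; near  = begin
        square
          ≡⟨ trans (error′ x y M) (cong (λ h → M * h + ½ * ½ * ((x - M * y) * (x - M * y))) xy) ⟩
        M * 1ℚ + ½ * ½ * ((x - M * y) * (x - M * y))
          ≤⟨ ℚ.+-monoʳ-≤ (M * 1ℚ) (*-monoˡ (ℚ.nonNegative⁻¹ (½ * ½)) error≤) ⟩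
        M * 1ℚ + ½ * ½ * e
          ≡⟨ cong (_+ ½ * ½ * e) (ℚ.*-identityʳ M) ⟩
        M + ½ * ½ * e ∎
      }
      where
      open ℚ.≤-Reasoning
      open Approximation a renaming (value to x)
      instance
        x-positive : ℚ.Positive x
        x-positive = ℚ.positive pos
        x-nonZero : ℚ.NonZero x
        x-nonZero = ℚ.pos⇒nonZero x
      y : ℚ
      y = 1/ x
      xy : x * y ≡ 1ℚ
      xy = ℚ.*-inverseʳ x
      0<y : 0ℚ < y
      0<y = ℚ.positive⁻¹ y {{ℚ.1/pos⇒pos x}}
      square = ½ * (x + M * y) * (½ * (x + M * y))
      error : ∀ x y M → M + ½ * (x - M * y) * (½ * (x - M * y))
        ≡ ½ * (x + M * y) * (½ * (x + M * y)) + M * (1ℚ - x * y)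
      error = solve-∀ ring
      collect : ∀ s M → s + M * (1ℚ - 1ℚ) ≡ s
      collect = solve-∀ ring
      error′ : ∀ x y M → ½ * (x + M * y) * (½ * (x + M * y))
        ≡ M * (x * y) + ½ * ½ * ((x - M * y) * (x - M * y))
      error′ = solve-∀ ring
      -- With `y = 1/x` the product is `1 - M y²`. The squared difference of `x` and `M y` contains
      -- `x² - M` twice; one copy together with `y²` is traded for `1`. This gives up quadratic
      -- convergence for the factor `1/4` per step.
      y²[x²-M]≤1 : y * y * (x * x - M) ≤ 1ℚ
      y²[x²-M]≤1 = ≤-by (y * y * M) (0≤* (0≤square y) 0≤M)
        (trans (expand x y M) (cong (λ h → h * h) xy))
        where
        expand : ∀ x y M → y * y * (x * x - M) + y * y * M ≡ x * y * (x * y)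
        expand = solve-∀ ring
      error≤ : (x - M * y) * (x - M * y) ≤ e
      error≤ = begin
        (x - M * y) * (x - M * y)
          ≡⟨ cong (λ h → (h - M * y) * (h - M * y)) (trans (sym (ℚ.*-identityʳ x)) (cong (x *_) (sym xy))) ⟩
        (x * (x * y) - M * y) * (x * (x * y) - M * y)
          ≡⟨ expand x y M ⟩
        y * y * (x * x - M) * (x * x - M)
          ≤⟨ *-monoʳ (0≤-difference above) y²[x²-M]≤1 ⟩
        1ℚ * (x * x - M)
          ≤⟨ ≤-by (M + e - x * x) (0≤-difference near) (collect′ x M e) ⟩
        e ∎
        where
        expand : ∀ x y M → (x * (x * y) - M * y) * (x * (x * y) - M * y) ≡ y * y * (x * x - M) * (x * x - M)
        expand = solve-∀ ring
        collect′ : ∀ x M e → 1ℚ * (x * x - M) + (M + e - x * x) ≡ e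
        collect′ = solve-∀ ring

    module _ {e₀ : ℚ} (start : Approximation e₀) where

      error : ℕ → ℚ
      error zero    = e₀
      error (suc k) = ½ * ½ * error k

      approximation : ∀ k → Approximation (error k)
      approximation zero    = start
      approximation (suc k) = newton (approximation k)

      root-seq : ℕ → ℚ
      root-seq k = Approximation.value (approximation k)

      3≤root : ∀ k → 3ℚ ≤ root-seq k
      3≤root k = Approximation.3≤value (approximation k)

      root-above : ∀ k → M ≤ root-seq k * root-seq k
      root-above k = Approximation.above (approximation k)

      0≤error : ∀ k → 0ℚ ≤ error k
      0≤error k = subst (0ℚ ≤_) (cancel M (error k))
        (0≤-difference (ℚ.≤-trans (root-above k) (Approximation.near (approximation k))))
        where
        cancel : ∀ M e → M + e - M ≡ e
        cancel = solve-∀ ring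

      -- The geometric decay is compared with a harmonic one so that `recip-null` applies; the
      -- induction step amounts to `(k + 2)/4 ≤ k + 1`.
      error-decay : ∀ k → error k ≤ e₀ * recip (suc k)
      error-decay zero    = ℚ.≤-reflexive (sym (ℚ.*-identityʳ e₀))
      error-decay (suc k) = begin
        ½ * ½ * error k
          ≤⟨ *-monoˡ (ℚ.nonNegative⁻¹ (½ * ½)) (error-decay k) ⟩
        ½ * ½ * (e₀ * r)
          ≤⟨ *-cancelˡ (0<ι (suc k)) (≤-by ((½ + ½ * ½) * ι k * (e₀ * r) + ½ * (e₀ * r))
               (0≤+ (0≤* (0≤* (ℚ.nonNegative⁻¹ (½ + ½ * ½)) (0≤ι k)) 0≤e₀r) (0≤* 0≤½ 0≤e₀r)) balance) ⟩
        e₀ * r′ ∎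
        where
        open ℚ.≤-Reasoning
        r  = recip (suc k)
        r′ = recip (2 ℕ.+ k)
        0≤e₀r : 0ℚ ≤ e₀ * r
        0≤e₀r = 0≤* (0≤error 0) (0≤recip (suc k))
        balance : ι (2 ℕ.+ k) * (½ * ½ * (e₀ * r)) + ((½ + ½ * ½) * ι k * (e₀ * r) + ½ * (e₀ * r)) ≡ ι (2 ℕ.+ k) * (e₀ * r′)
        balance = trans (cong (λ h → h * (½ * ½ * (e₀ * r)) + ((½ + ½ * ½) * ι k * (e₀ * r) + ½ * (e₀ * r))) (ι-+ 2 k))
          (trans (collect (ι k) e₀ r)
          (trans (cong (λ h → e₀ * (h * r)) (sym (ι-+ 1 k)))
          (trans (cong (e₀ *_) (trans (ι*recip {suc k} (ℕ.s≤s ℕ.z≤n)) (sym (ι*recip {2 ℕ.+ k} (ℕ.s≤s ℕ.z≤n)))))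
          (swap e₀ (ι (2 ℕ.+ k)) r′))))
          where
          collect : ∀ κ e r → (2ℚ + κ) * (½ * ½ * (e * r)) + ((½ + ½ * ½) * κ * (e * r) + ½ * (e * r))
            ≡ e * ((1ℚ + κ) * r)
          collect = solve-∀ ring
          swap : ∀ e κ r → e * (κ * r) ≡ κ * (e * r)
          swap = solve-∀ ring

      error-null : Null error
      error-null = null-dominated
        (λ k → subst₂ _≤_ (sym (ℚ.0≤p⇒∣p∣≡p (0≤error k)))
          (sym (ℚ.0≤p⇒∣p∣≡p (0≤* (0≤error 0) (0≤recip (suc k))))) (error-decay k))
        (null-scale e₀ recip-null)

      root²-null : Null (λ k → root-seq k * root-seq k - M)
      root²-null = null-dominated
        (λ k → subst₂ _≤_ (sym (ℚ.0≤p⇒∣p∣≡p (0≤-difference (root-above k)))) (sym (ℚ.0≤p⇒∣p∣≡p (0≤error k)))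
          (≤-by _ (0≤-difference (Approximation.near (approximation k)))
            (cancel (root-seq k * root-seq k) M (error k))))
        error-null
        where
        cancel : ∀ s M e → s - M + (M + e - s) ≡ e
        cancel = solve-∀ ring

      root-cauchy : Cauchy root-seq
      root-cauchy = square-cauchy root-seq M 3≤root root²-null

      root : ℝ
      root = mkℝ root-seq root-cauchy

-- Rows of the Laplacian of `K⁺` and its eigenvalue equations.

module CliqueRows (l : ℕ) where
  open Data.Rational.Base using (_+_; _*_; -_; _-_; _≤_; 0ℚ; 1ℚ; ½)
  open RationalSums
  open Forms using (weight; sum-weight)
  open Counting using (deg)

  μ : ℚ
  μ = ι (suc l)

  1≤μ : 1ℚ ≤ μ
  1≤μ = ι-mono {1} {suc l} (ℕ.s≤s ℕ.z≤n)

  δ : Fin (suc l) → Fin (suc l) → ℚ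
  δ i j = if does (i ≟ j) then 1ℚ else 0ℚ

  sum-δ : ∀ i (y : Vector ℚ (suc l)) → sum (λ j → δ i j * y j) ≡ y i
  sum-δ i y = trans (sum-select (CommutativeRing.semiring ℚ.+-*-commutativeRing) i 1ℚ y) (ℚ.*-identityˡ (y i))

  sum-δ-1 : ∀ i → sum (δ i) ≡ 1ℚ
  sum-δ-1 i = trans (sum-cong-≗ (λ j → sym (ℚ.*-identityʳ (δ i j)))) (sum-δ i (λ _ → 1ℚ))

  sum-zero : ∀ {n} {f : Vector ℚ n} → (∀ j → f j ≡ 0ℚ) → sum f ≡ 0ℚ
  sum-zero {n} f≗0 = trans (sum-cong-≗ f≗0) (sum-replicate-zero n)

  rest : Vector ℚ (3 ℕ.+ l) → Vector ℚ (suc l)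
  rest y j = y (suc (suc j))

  row-pendant : ∀ y → sum (λ j → weight (K⁺ (suc l)) zero j * y j) ≡ y (suc zero)
  row-pendant y = trans
    (cong (λ h → 0ℚ * y zero + (1ℚ * y (suc zero) + h)) (sum-zero λ j → ℚ.*-zeroˡ (rest y j)))
    (collect (y zero) (y (suc zero)))
    where
    collect : ∀ a b → 0ℚ * a + (1ℚ * b + 0ℚ) ≡ b
    collect = solve-∀ ring

  row-hub : ∀ y → sum (λ j → weight (K⁺ (suc l)) (suc zero) j * y j) ≡ y zero + sum (rest y)
  row-hub y = trans
    (cong (λ h → 1ℚ * y zero + (0ℚ * y (suc zero) + h)) (sum-cong-≗ λ j → ℚ.*-identityˡ (rest y j)))
    (collect (y zero) (y (suc zero)) (sum (rest y)))
    where
    collect : ∀ a b s → 1ℚ * a + (0ℚ * b + s) ≡ a + s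
    collect = solve-∀ ring

  row-rest : ∀ i y → sum (λ j → weight (K⁺ (suc l)) (suc (suc i)) j * y j)
    ≡ y (suc zero) + (sum (rest y) - rest y i)
  row-rest i y = trans
    (cong (λ h → 0ℚ * y zero + (1ℚ * y (suc zero) + h)) others)
    (collect (y zero) (y (suc zero)) (sum (rest y) - rest y i))
    where
    collect : ∀ a b s → 0ℚ * a + (1ℚ * b + s) ≡ b + s
    collect = solve-∀ ring
    x = rest y
    off-diagonal : ∀ b p → ι (Counting.𝟙 (not b)) * p ≡ p + (- 1ℚ) * ((if b then 1ℚ else 0ℚ) * p)
    off-diagonal true  = solve-∀ ring
    off-diagonal false = solve-∀ ring
    others : sum (λ j → ι (Counting.𝟙 (not (does (i ≟ j)))) * x j) ≡ sum x - x i
    others = trans (sum-cong-≗ λ j → off-diagonal (does (i ≟ j)) (x j))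
      (trans (∑-distrib-+ x (λ j → (- 1ℚ) * (δ i j * x j)))
        (cong (sum x +_) (trans (sym (*-distribˡ-sum (- 1ℚ) (λ j → δ i j * x j)))
          (trans (cong ((- 1ℚ) *_) (sum-δ i x)) (negate (x i))))))
      where
      negate : ∀ p → (- 1ℚ) * p ≡ - p
      negate = solve-∀ ring

  private
    -- The degrees are obtained by applying the row formulas to the constant vector `1`.
    ι-deg : ∀ i → ι (deg (K⁺ (suc l)) i) ≡ sum (λ j → weight (K⁺ (suc l)) i j * 1ℚ)
    ι-deg i = trans (sym (sum-weight (K⁺ (suc l)) i))
      (sum-cong-≗ λ j → sym (ℚ.*-identityʳ (weight (K⁺ (suc l)) i j)))

    sum-1 : sum {suc l} (λ _ → 1ℚ) ≡ μ
    sum-1 = trans (sum-const (suc l) 1ℚ) (ℚ.*-identityʳ μ)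

  deg-pendant : ι (deg (K⁺ (suc l)) zero) ≡ 1ℚ
  deg-pendant = trans (ι-deg zero) (row-pendant (λ _ → 1ℚ))

  deg-hub : ι (deg (K⁺ (suc l)) (suc zero)) ≡ 1ℚ + μ
  deg-hub = trans (ι-deg (suc zero)) (trans (row-hub (λ _ → 1ℚ)) (cong (1ℚ +_) sum-1))

  deg-rest : ∀ i → ι (deg (K⁺ (suc l)) (suc (suc i))) ≡ μ
  deg-rest i = trans (ι-deg (suc (suc i))) (trans (row-rest i (λ _ → 1ℚ))
    (trans (cong (λ h → 1ℚ + (h - 1ℚ)) sum-1) (cancel μ)))
    where
    cancel : ∀ p → 1ℚ + (p - 1ℚ) ≡ p
    cancel = solve-∀ ring

  -- The two eigenvalues ((2m + 1) ± s)/2 are the roots of χ.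
  χ : ℚ → ℚ
  χ r = r * r - (2ℚ * μ + 1ℚ) * r + 2ℚ * (μ - 1ℚ)

  χ-root : ∀ e s → e * e ≡ 1ℚ →
    χ (½ * (2ℚ * μ + 1ℚ + e * s)) ≡ ½ * ½ * (s * s - ((2ℚ * μ - 1ℚ) * (2ℚ * μ - 1ℚ) + (4ℚ + 4ℚ)))
  χ-root e s e²≡1 = trans (expand μ e s) (trans
    (cong (λ h → ½ * ½ * (h * (s * s) - ((2ℚ * μ - 1ℚ) * (2ℚ * μ - 1ℚ) + (4ℚ + 4ℚ)))) e²≡1)
    (collect μ s))
    where
    expand : ∀ μ e s →
      ½ * (2ℚ * μ + 1ℚ + e * s) * (½ * (2ℚ * μ + 1ℚ + e * s))
        - (2ℚ * μ + 1ℚ) * (½ * (2ℚ * μ + 1ℚ + e * s)) + 2ℚ * (μ - 1ℚ)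
      ≡ ½ * ½ * (e * e * (s * s) - ((2ℚ * μ - 1ℚ) * (2ℚ * μ - 1ℚ) + (4ℚ + 4ℚ)))
    expand = solve-∀ ring
    collect : ∀ μ s →
      ½ * ½ * (1ℚ * (s * s) - ((2ℚ * μ - 1ℚ) * (2ℚ * μ - 1ℚ) + (4ℚ + 4ℚ)))
      ≡ ½ * ½ * (s * s - ((2ℚ * μ - 1ℚ) * (2ℚ * μ - 1ℚ) + (4ℚ + 4ℚ)))
    collect = solve-∀ ring

  -- The entry at rest vertices of the eigenvector with entries m at the
  -- pendant vertex and m(r - 1) at the hub.
  tail-entry : ℚ → ℚ
  tail-entry r = (μ - 1ℚ) * r + (2ℚ - μ)

  hub-entry : ℚ → ℚ
  hub-entry r = μ * r + (- μ)

  -- At a rational `r` the eigenvalue equation fails by a fixed multiple of `χ r`, which is null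
  -- along the approximants of an eigenvalue. The same holds for `rest-equation`, while the equation
  -- at the pendant vertex holds exactly.
  hub-equation : ∀ r →
    (1ℚ + μ) * hub-entry r + (μ + μ * tail-entry r) - r * hub-entry r ≡ (- μ) * χ r
  hub-equation = solved μ
    where
    solved : ∀ μ r →
      (1ℚ + μ) * (μ * r + (- μ)) + (μ + μ * ((μ - 1ℚ) * r + (2ℚ - μ))) - r * (μ * r + (- μ))
      ≡ (- μ) * (r * r - (2ℚ * μ + 1ℚ) * r + 2ℚ * (μ - 1ℚ))
    solved = solve-∀ ring

  rest-equation : ∀ r →
    μ * tail-entry r + (hub-entry r + (μ * tail-entry r - tail-entry r)) - r * tail-entry r
    ≡ (1ℚ - μ) * χ r
  rest-equation = solved μ
    where
    solved : ∀ μ r → let t = (μ - 1ℚ) * r + (2ℚ - μ) in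
      μ * t + (μ * r + (- μ) + (μ * t - t)) - r * t
      ≡ (1ℚ - μ) * (r * r - (2ℚ * μ + 1ℚ) * r + 2ℚ * (μ - 1ℚ))
    solved = solve-∀ ring

-- Independence of the eigenbasis of `K⁺`.

module CliqueIndependence (l : ℕ) (s : ℕ → ℚ) (1≤s : ∀ n → ℚ.1ℚ ℚ.≤ s n) where
  open Data.Rational.Base using (_+_; _*_; -_; _-_; _≤_; 0ℚ; 1ℚ; ½)
  open RationalSums
  open NullSequences
  open SquareRoot using (null-cancel; null-scale)
  open CliqueRows l

  β : ℚ
  β = 2ℚ * μ + 1ℚ

  r₊ r₋ : ℕ → ℚ
  r₊ n = ½ * (β + 1ℚ * s n)
  r₋ n = ½ * (β + (- 1ℚ) * s n)

  last : Fin (suc l)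
  last = Fin.fromℕ l

  -- a, b and C last are the coefficients of the eigenvectors for r₊, m and
  -- r₋, and the other C i those of the vectors e i - e last.
  module _ (a b : ℕ → ℚ) (C : Fin (suc l) → ℕ → ℚ)
           (pendant : Null (λ n → a n * μ + (b n * 1ℚ + C last n * μ)))
           (hub     : Null (λ n → a n * hub-entry (r₊ n) + (b n * (μ - 1ℚ) + C last n * hub-entry (r₋ n))))
           (others  : ∀ j → Null (λ n → a n * tail-entry (r₊ n) + (b n * (- 1ℚ)
                        + (C last n * tail-entry (r₋ n) + (C j n - δ last j * sum (λ i → C i n)))))) where

    private
      -- Gaussian elimination modulo null sequences; the divisors `μ`, `μ (μ - 1) + 2` and `s` are
      -- all at least `1`. Adding the equations `others` cancels the difference vectors and leaves
      -- `μ X`; combining `hub` with `pendant` eliminates `b` and leaves `μ (R - μ P)`. Together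
      -- these give `P = a + d`, and then `s (a - d)` from `2 (R - μ P) - P`.
      d P R X : ℕ → ℚ
      d n = C last n
      P n = a n + d n
      R n = a n * r₊ n + d n * r₋ n
      X n = a n * tail-entry (r₊ n) + (b n * (- 1ℚ) + d n * tail-entry (r₋ n))

      X-null : Null X
      X-null = null-cancel (λ _ → 1≤μ) (null-cong total (null-sum others))
        where
        open ≡-Reasoning
        total : ∀ n → sum (λ j → a n * tail-entry (r₊ n) + (b n * (- 1ℚ)
                        + (d n * tail-entry (r₋ n) + (C j n - δ last j * sum (λ i → C i n))))) ≡ μ * X n
        total n = begin
          sum (λ j → p + (q + (t + (C j n - δ last j * Z))))
            ≡⟨ sum-cong-≗ (λ j → regroup p q t (C j n) (δ last j) Z) ⟩
          sum (λ j → X n + (C j n + (- Z) * δ last j))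
            ≡⟨ ∑-distrib-+ (λ _ → X n) (λ j → C j n + (- Z) * δ last j) ⟩
          sum {suc l} (λ _ → X n) + sum (λ j → C j n + (- Z) * δ last j)
            ≡⟨ cong₂ _+_ (sum-const (suc l) (X n)) (trans (∑-distrib-+ (λ j → C j n) (λ j → (- Z) * δ last j))
                 (cong (Z +_) (trans (sym (*-distribˡ-sum (- Z) (δ last))) (cong ((- Z) *_) (sum-δ-1 last))))) ⟩
          μ * X n + (Z + (- Z) * 1ℚ)
            ≡⟨ cancel (μ * X n) Z ⟩
          μ * X n ∎
          where
          p = a n * tail-entry (r₊ n)
          q = b n * (- 1ℚ)
          t = d n * tail-entry (r₋ n)
          Z = sum (λ i → C i n)
          regroup : ∀ p q t c e Z → p + (q + (t + (c - e * Z))) ≡ p + (q + t) + (c + (- Z) * e)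
          regroup = solve-∀ ring
          cancel : ∀ p Z → p + (Z + (- Z) * 1ℚ) ≡ p
          cancel = solve-∀ ring

      R-μP-null : Null (λ n → R n - μ * P n)
      R-μP-null = null-cancel (λ _ → 1≤μ) (null-cong
        (λ n → combination μ (a n) (b n) (d n) (r₊ n) (r₋ n))
        (null-+ hub (null-scale (1ℚ - μ) pendant)))
        where
        combination : ∀ μ a b d r₊ r₋ →
          (a * (μ * r₊ + (- μ)) + (b * (μ - 1ℚ) + d * (μ * r₋ + (- μ))))
            + (1ℚ - μ) * (a * μ + (b * 1ℚ + d * μ))
          ≡ μ * (a * r₊ + d * r₋ - μ * (a + d))
        combination = solve-∀ ring

      P-null : Null P
      P-null = null-cancel {c = λ _ → μ * (μ - 1ℚ) + 2ℚ} (λ _ → 1≤coefficient) (null-cong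
        (λ n → combination μ (a n) (b n) (d n) (r₊ n) (r₋ n))
        (null-+ (null-+ X-null pendant) (null-scale (1ℚ - μ) R-μP-null)))
        where
        1≤coefficient : 1ℚ ≤ μ * (μ - 1ℚ) + 2ℚ
        1≤coefficient = ≤-by (μ * (μ - 1ℚ) + 1ℚ)
          (0≤+ (0≤* (0≤ι (suc l)) (0≤-difference 1≤μ)) (ℚ.nonNegative⁻¹ 1ℚ)) (shift μ)
          where
          shift : ∀ μ → 1ℚ + (μ * (μ - 1ℚ) + 1ℚ) ≡ μ * (μ - 1ℚ) + 2ℚ
          shift = solve-∀ ring
        combination : ∀ μ a b d r₊ r₋ →
          (a * ((μ - 1ℚ) * r₊ + (2ℚ - μ)) + (b * (- 1ℚ) + d * ((μ - 1ℚ) * r₋ + (2ℚ - μ))))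
            + (a * μ + (b * 1ℚ + d * μ)) + (1ℚ - μ) * (a * r₊ + d * r₋ - μ * (a + d))
          ≡ (μ * (μ - 1ℚ) + 2ℚ) * (a + d)
        combination = solve-∀ ring

      a-d-null : Null (λ n → a n - d n)
      a-d-null = null-cancel 1≤s (null-cong
        (λ n → combination μ (a n) (d n) (s n))
        (null-+ (null-scale 2ℚ R-μP-null) (null-scale (- 1ℚ) P-null)))
        where
        combination : ∀ μ a d s →
          2ℚ * (a * (½ * (2ℚ * μ + 1ℚ + 1ℚ * s)) + d * (½ * (2ℚ * μ + 1ℚ + (- 1ℚ) * s)) - μ * (a + d))
            + (- 1ℚ) * (a + d)
          ≡ s * (a - d)
        combination = solve-∀ ring

    a-null : Null a
    a-null = null-cong (λ n → halves (a n) (d n)) (null-scale ½ (null-+ P-null a-d-null))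
      where
      halves : ∀ a d → ½ * (a + d + (a - d)) ≡ a
      halves = solve-∀ ring

    last-null : Null (C last)
    last-null = null-cong (λ n → cancel (a n) (d n)) (null-+ P-null (null-scale (- 1ℚ) a-null))
      where
      cancel : ∀ a d → a + d + (- 1ℚ) * a ≡ d
      cancel = solve-∀ ring

    b-null : Null b
    b-null = null-cong (λ n → cancel μ (a n) (b n) (d n)) (null-+ pendant (null-scale (- μ) P-null))
      where
      cancel : ∀ μ a b d → a * μ + (b * 1ℚ + d * μ) + (- μ) * (a + d) ≡ b
      cancel = solve-∀ ring

    C-null : ∀ j → Null (C j)
    C-null j = cases (last ≟ j) refl
      where
      cases : ∀ (dec : Dec (last ≡ j)) → δ last j ≡ (if does dec then 1ℚ else 0ℚ) → Null (C j)
      cases (yes last≡j) _   = subst (λ i → Null (C i)) last≡j last-null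
      cases (no _)      δ≡0 = null-cong
        (λ n → trans
          (cong (λ h → a n * tail-entry (r₊ n) + (b n * (- 1ℚ) + (d n * tail-entry (r₋ n) + (C j n - h * sum (λ i → C i n))))
                       + (- 1ℚ) * X n) δ≡0)
          (cancel (a n * tail-entry (r₊ n)) (b n * (- 1ℚ)) (d n * tail-entry (r₋ n)) (C j n) (sum (λ i → C i n))))
        (null-+ (others j) (null-scale (- 1ℚ) X-null))
        where
        cancel : ∀ p q t c Z → p + (q + (t + (c - 0ℚ * Z))) + (- 1ℚ) * (p + (q + t)) ≡ c
        cancel = solve-∀ ring

-- The spread of `K⁺` as a real, and its margin over the threshold.

module SpreadRoot (m : ℕ) (40≤m : 40 ℕ.≤ m) where
  open Data.Rational.Base using (_+_; _*_; -_; _-_; _≤_; _<_; 0ℚ; 1ℚ)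
  open RationalSums
  open NullSequences
  open SquareRoot
  open PendantCliqueForm using (3ℚ; 8ℚ)
  open Classification using (threshold; 4μr≡1; eightfold-recip)

  μ r ν M : ℚ
  μ = ι m
  r = recip (4 ℕ.* m)
  ν = 2ℚ * μ - 1ℚ
  M = ν * ν + 8ℚ

  40≤μ : ι 40 ≤ μ
  40≤μ = ι-mono 40≤m

  0≤μ-40 : 0ℚ ≤ μ - ι 40
  0≤μ-40 = 0≤-difference 40≤μ

  9≤M : 3ℚ * 3ℚ ≤ M
  9≤M = ≤-by _ (0≤* (ℚ.nonNegative⁻¹ 4ℚ) (0≤* (0≤ι m) 0≤μ-1)) (expand μ)
    where
    0≤μ-1 : 0ℚ ≤ μ - 1ℚ
    0≤μ-1 = 0≤-difference (ℚ.≤-trans (ι-mono {1} {40} (ℕ.s≤s ℕ.z≤n)) 40≤μ)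
    expand : ∀ μ → 3ℚ * 3ℚ + 4ℚ * (μ * (μ - 1ℚ)) ≡ (2ℚ * μ - 1ℚ) * (2ℚ * μ - 1ℚ) + 8ℚ
    expand = solve-∀ ring

  start : Approximation M 9≤M (2ℚ * μ * (2ℚ * μ) - M)
  start = record
    { value = 2ℚ * μ
    ; pos   = 0<* (ℚ.positive⁻¹ 2ℚ) (ℚ.<-≤-trans (0<ι 39) 40≤μ)
    -- The excess of `(2 m)²` over `M` is `4 m - 9 = 4 (m - 40) + 151`.
    ; above = ≤-by _ (0≤+ (0≤* (ℚ.nonNegative⁻¹ 4ℚ) 0≤μ-40) (0≤ι 151)) (expand μ)
    ; near  = ℚ.≤-reflexive (cancel M (2ℚ * μ * (2ℚ * μ)))
    }
    where
    expand : ∀ μ → (2ℚ * μ - 1ℚ) * (2ℚ * μ - 1ℚ) + 8ℚ + (4ℚ * (μ - ι 40) + ι 151) ≡ 2ℚ * μ * (2ℚ * μ)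
    expand = solve-∀ ring
    cancel : ∀ M s → s ≡ M + (s - M)
    cancel = solve-∀ ring

  σ : ℝ
  σ = root M 9≤M start

  3≤σ : ∀ n → 3ℚ ≤ seq σ n
  3≤σ = 3≤root M 9≤M start

  M≤σ² : ∀ n → M ≤ seq σ n * seq σ n
  M≤σ² = root-above M 9≤M start

  σ²→M : Null (λ n → seq σ n * seq σ n - M)
  σ²→M = root²-null M 9≤M start

  0≤σ : ∀ n → 0ℚ ≤ seq σ n
  0≤σ n = ℚ.≤-trans (ℚ.nonNegative⁻¹ 3ℚ) (3≤σ n)

  1≤4m : 1 ℕ.≤ 4 ℕ.* m
  1≤4m = ℕ.≤-trans (ℕ.≤-trans (ℕ.s≤s ℕ.z≤n) 40≤m) (ℕ.m≤n*m m 4)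

  0<r : 0ℚ < r
  0<r = 0<recip 1≤4m

  -- (2m - 1 + 7r)² = (2m - 1)² + 7 - 14r + 49r² for r = 1/(4m).
  threshold+r≤σ : ∀ n → threshold m + r ≤ seq σ n
  threshold+r≤σ n = square-cancel-≤ (0≤σ n) (ℚ.≤-trans
    (≤-by _ (0≤+ (0≤* (0≤-difference 7r≤1) (0≤+ (ℚ.nonNegative⁻¹ 1ℚ) (0≤* (0≤ι 7) (0≤recip (4 ℕ.* m)))))
                 (0≤* (0≤ι 14) (0≤recip (4 ℕ.* m))))
      (trans (expand μ r) (trans (cong (λ h → ν * ν + ι 7 * h + 1ℚ) (4μr≡1 m 40≤m)) (collect (ν * ν)))))
    (M≤σ² n))
    where
    7r≤1 : ι 7 * r ≤ 1ℚ
    7r≤1 = ℚ.≤-trans (*-monoʳ (0≤recip (4 ℕ.* m)) (ι-mono (ℕ.n≤1+n 7)))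
      (eightfold-recip (4 ℕ.* m) (ℕ.≤-trans (ℕ.≤-trans (ℕ.m≤n+m 8 32) 40≤m) (ℕ.m≤n*m m 4)))
    expand : ∀ μ r →
      (2ℚ * μ - 1ℚ + (4ℚ + 2ℚ) * r + r) * (2ℚ * μ - 1ℚ + (4ℚ + 2ℚ) * r + r)
        + ((1ℚ - ι 7 * r) * (1ℚ + ι 7 * r) + ι 14 * r)
      ≡ (2ℚ * μ - 1ℚ) * (2ℚ * μ - 1ℚ) + ι 7 * (4ℚ * μ * r) + 1ℚ
    expand = solve-∀ ring
    collect : ∀ s → s + ι 7 * 1ℚ + 1ℚ ≡ s + 8ℚ
    collect = solve-∀ ring

  threshold≤σ : ∀ n → threshold m ≤ seq σ n
  threshold≤σ n = ℚ.≤-trans (≤-by r (0≤recip (4 ℕ.* m)) refl) (threshold+r≤σ n)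

  0<σ-ν : ∀ n → 0ℚ < seq σ n - 2ℚ * μ + 1ℚ
  0<σ-ν n = ℚ.<-≤-trans 0<r (≤-by _
    (0≤+ (0≤-difference (threshold+r≤σ n)) (0≤* (ℚ.nonNegative⁻¹ (4ℚ + 2ℚ)) (0≤recip (4 ℕ.* m))))
    (rearrange μ r (seq σ n)))
    where
    rearrange : ∀ μ r s →
      r + (s - (2ℚ * μ - 1ℚ + (4ℚ + 2ℚ) * r + r) + (4ℚ + 2ℚ) * r) ≡ s - 2ℚ * μ + 1ℚ
    rearrange = solve-∀ ring

  8≤product : ∀ n → 8ℚ ≤ (seq σ n + 2ℚ * μ - 1ℚ) * (seq σ n - 2ℚ * μ + 1ℚ)
  8≤product n = ≤-by _ (0≤-difference (M≤σ² n)) (rearrange μ (seq σ n))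
    where
    rearrange : ∀ μ s → 8ℚ + (s * s - ((2ℚ * μ - 1ℚ) * (2ℚ * μ - 1ℚ) + 8ℚ))
      ≡ (s + 2ℚ * μ - 1ℚ) * (s - 2ℚ * μ + 1ℚ)
    rearrange = solve-∀ ring

open import Defs

-- The Cauchy reals as a commutative ring.

module Reals where
  open NullSequences
  open RationalSums using () renaming (ring to ℚ-ring)

  ≗⇒≈ : ∀ {x y} → (∀ n → seq x n ≡ seq y n) → x ≈ y
  ≗⇒≈ {x} {y} x≗y = mk≈ (null-cong (λ n → trans (sym (ℚ.+-inverseʳ (seq x n))) (cong (λ h → seq x n ℚ.- h) (x≗y n))) null-zero)

  ≈-sym : ∀ {x y} → x ≈ y → y ≈ x
  ≈-sym {x} {y} (mk≈ c) = mk≈ (null-cong (λ n → flip (seq x n) (seq y n)) (null-neg c))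
    where
    flip : ∀ p q → ℚ.- (p ℚ.- q) ≡ q ℚ.- p
    flip = solve-∀ ℚ-ring

  ≈-trans : ∀ {x y z} → x ≈ y → y ≈ z → x ≈ z
  ≈-trans {x} {y} {z} (mk≈ c) (mk≈ d) =
    mk≈ (null-cong (λ n → telescope (seq x n) (seq y n) (seq z n)) (null-+ c d))
    where
    telescope : ∀ p q r → (p ℚ.- q) ℚ.+ (q ℚ.- r) ≡ p ℚ.- r
    telescope = solve-∀ ℚ-ring

  +-cong : ∀ {x y u v} → x ≈ y → u ≈ v → x + u ≈ y + v
  +-cong {x} {y} {u} {v} (mk≈ c) (mk≈ d) =
    mk≈ (null-cong (λ n → rearrange (seq x n) (seq y n) (seq u n) (seq v n)) (null-+ c d))
    where
    rearrange : ∀ p q r s → (p ℚ.- q) ℚ.+ (r ℚ.- s) ≡ (p ℚ.+ r) ℚ.- (q ℚ.+ s)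
    rearrange = solve-∀ ℚ-ring

  *-cong : ∀ {x y u v} → x ≈ y → u ≈ v → x * u ≈ y * v
  *-cong {x} {y} {u} {v} (mk≈ c) (mk≈ d) =
    mk≈ (null-cong (λ n → rearrange (seq x n) (seq y n) (seq u n) (seq v n))
      (null-+ (null-* (cauchy⇒bounded (seq x) (cauchy x)) d) (null-* (cauchy⇒bounded (seq v) (cauchy v)) c)))
    where
    rearrange : ∀ p q r s → p ℚ.* (r ℚ.- s) ℚ.+ s ℚ.* (p ℚ.- q) ≡ p ℚ.* r ℚ.- q ℚ.* s
    rearrange = solve-∀ ℚ-ring

  infix 8 ⁻_

  ⁻_ : ℝ → ℝ
  ⁻ x = 0ℝ - x

  ⁻-cong : ∀ {x y} → x ≈ y → ⁻ x ≈ ⁻ y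
  ⁻-cong {x} {y} (mk≈ c) = mk≈ (null-cong (λ n → rearrange (seq x n) (seq y n)) (null-neg c))
    where
    rearrange : ∀ p q → ℚ.- (p ℚ.- q) ≡ (ℚ.0ℚ ℚ.- p) ℚ.- (ℚ.0ℚ ℚ.- q)
    rearrange = solve-∀ ℚ-ring

  ℝ-commutativeRing : CommutativeRing 0ℓ 0ℓ
  ℝ-commutativeRing = record
    { Carrier = ℝ ; _≈_ = _≈_ ; _+_ = _+_ ; _*_ = _*_ ; -_ = ⁻_ ; 0# = 0ℝ ; 1# = 1ℝ
    ; isCommutativeRing = record
      { isRing = record
        { +-isAbelianGroup = record
          { isGroup = record
            { isMonoid = record
              { isSemigroup = record
                { isMagma = record
                  { isEquivalence = record { refl = ≗⇒≈ (λ _ → refl) ; sym = ≈-sym ; trans = ≈-trans }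
                  ; ∙-cong = +-cong }
                ; assoc = λ x y z → ≗⇒≈ λ n → ℚ.+-assoc (seq x n) (seq y n) (seq z n) }
              ; identity = (λ x → ≗⇒≈ λ n → ℚ.+-identityˡ (seq x n)) , (λ x → ≗⇒≈ λ n → ℚ.+-identityʳ (seq x n)) }
            ; inverse = (λ x → ≗⇒≈ λ n → ⁻-inverseˡ (seq x n)) , (λ x → ≗⇒≈ λ n → ⁻-inverseʳ (seq x n))
            ; ⁻¹-cong = ⁻-cong }
          ; comm = λ x y → ≗⇒≈ λ n → ℚ.+-comm (seq x n) (seq y n) }
        ; *-cong = *-cong
        ; *-assoc = λ x y z → ≗⇒≈ λ n → ℚ.*-assoc (seq x n) (seq y n) (seq z n)
        ; *-identity = (λ x → ≗⇒≈ λ n → ℚ.*-identityˡ (seq x n)) , (λ x → ≗⇒≈ λ n → ℚ.*-identityʳ (seq x n))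
        ; distrib = (λ x y z → ≗⇒≈ λ n → ℚ.*-distribˡ-+ (seq x n) (seq y n) (seq z n))
                  , (λ x y z → ≗⇒≈ λ n → ℚ.*-distribʳ-+ (seq x n) (seq y n) (seq z n)) }
      ; *-comm = λ x y → ≗⇒≈ λ n → ℚ.*-comm (seq x n) (seq y n) } }
    where
    ⁻-inverseˡ : ∀ p → (ℚ.0ℚ ℚ.- p) ℚ.+ p ≡ ℚ.0ℚ
    ⁻-inverseˡ = solve-∀ ℚ-ring
    ⁻-inverseʳ : ∀ p → p ℚ.+ (ℚ.0ℚ ℚ.- p) ≡ ℚ.0ℚ
    ⁻-inverseʳ = solve-∀ ℚ-ring

  1≉0 : ¬ 1ℝ ≈ 0ℝ
  1≉0 (mk≈ c) with c ℚ.½ (ℚ.positive⁻¹ ℚ.½)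
  ... | N , h with h N ℕ.≤-refl
  ...   | ℚ.*≤* (ℤ.+≤+ (ℕ.s≤s ()))

  -- Supplies the nonzero eigenvectors for the Rayleigh quotient argument. With the indicator of `i`
  -- as coefficients, a vanishing `v i` would force `1ℝ ≈ 0ℝ`.
  independent⇒nonzero : ∀ {k n} (v : Fin k → Vector ℝ n) → LinearlyIndependent v →
    ∀ i → ¬ (∀ j → v i j ≈ 0ℝ)
  independent⇒nonzero v independent i v≈0 = 1≉0 (subst (_≈ 0ℝ) cᵢ≡1 (independent c combination i))
    where
    R = CommutativeRing.semiring ℝ-commutativeRing
    c : Vector ℝ _
    c l = if does (i ≟ l) then 1ℝ else 0ℝ
    cᵢ≡1 : c i ≡ 1ℝ
    cᵢ≡1 with i ≟ i
    ... | yes _  = refl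
    ... | no i≢i = contradiction refl i≢i
    combination : ∀ j → ∑ (λ l → c l * v l j) ≈ 0ℝ
    combination j = ≈-trans (sum-select R i 1ℝ (λ l → v l j))
      (≈-trans (Semiring.*-identityˡ R (v i j)) (v≈0 j))

-- From bounds on the form to bounds on eigenvalues.

module EigenvalueBounds where
  open Data.Rational.Base using () renaming (_+_ to _+′_; _*_ to _*′_; _-_ to _-′_; _≤_ to _≤′_; _<_ to _<′_)
  open NullSequences
  open Reals
  open RationalSums
  open Forms
  open Counting using (𝟙; deg)

  seq-∑ : ∀ {k} (v : Vector ℝ k) n → seq (∑ v) n ≡ sum (λ i → seq (v i) n)
  seq-∑ {zero}  v n = refl
  seq-∑ {suc k} v n = cong (seq (v zero) n +′_) (seq-∑ (v ∘ suc) n)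

  seq-if : ∀ b x y n → seq (if b then x else y) n ≡ (if b then seq x n else seq y n)
  seq-if true  x y n = refl
  seq-if false x y n = refl

  seq-D : ∀ {k} (G : Graph k) i j n →
    seq (D G i j) n ≡ (if does (i ≟ j) then ι (deg G i) else ℚ.0ℚ)
  seq-D G i j n = trans (seq-if (does (i ≟ j)) (fromℕ (degree G i)) 0ℝ n)
    (cong (λ d → if does (i ≟ j) then ι d else ℚ.0ℚ) (Counting.degree≡deg G i))

  seq-A : ∀ {k} (G : Graph k) i j n → seq (A G i j) n ≡ weight G i j
  seq-A G i j n = indicator (adj G i j)
    where
    indicator : ∀ b → seq (if b then 1ℝ else 0ℝ) n ≡ ι (𝟙 b)
    indicator true  = refl
    indicator false = refl

  seq-Q : ∀ {k} (G : Graph k) i j n → seq (Q G i j) n ≡ seq (D G i j) n +′ seq (A G i j) n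
  seq-Q G i j n = refl

  seq-* : ∀ x y n → seq (x * y) n ≡ seq x n *′ seq y n
  seq-* x y n = refl

  seq-Q·v : ∀ {k} (G : Graph k) (v : Vector ℝ k) i n →
    seq ((Q G · v) i) n ≡ ι (deg G i) *′ seq (v i) n +′ sum (λ j → weight G i j *′ seq (v j) n)
  seq-Q·v G v i n = begin
    seq ((Q G · v) i) n
      ≡⟨ seq-∑ (λ j → Q G i j * v j) n ⟩
    sum (λ j → seq (Q G i j * v j) n)
      ≡⟨ sum-cong-≗ entry ⟩
    sum (λ j → δ j *′ x j +′ weight G i j *′ x j)
      ≡⟨ ∑-distrib-+ (λ j → δ j *′ x j) (λ j → weight G i j *′ x j) ⟩
    sum (λ j → δ j *′ x j) +′ sum (λ j → weight G i j *′ x j)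
      ≡⟨ cong (_+′ sum (λ j → weight G i j *′ x j))
           (sum-select (CommutativeRing.semiring ℚ.+-*-commutativeRing) i (ι (deg G i)) x) ⟩
    ι (deg G i) *′ x i +′ sum (λ j → weight G i j *′ x j) ∎
    where
    open ≡-Reasoning
    x = λ j → seq (v j) n
    δ = λ j → if does (i ≟ j) then ι (deg G i) else ℚ.0ℚ
    entry : ∀ j → seq (Q G i j * v j) n ≡ δ j *′ x j +′ weight G i j *′ x j
    entry j = trans (seq-* (Q G i j) (v j) n) (trans
      (cong (_*′ x j) (trans (seq-Q G i j n) (cong₂ _+′_ (seq-D G i j n) (seq-A G i j n))))
      (ℚ.*-distribʳ-+ (x j) (δ j) (weight G i j)))

  module _ {k} (G : Graph k) (lam : ℝ) (v : Vector ℝ k)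
           (eigen : ∀ i → (Q G · v) i ≈ lam * v i) where

    private
      x : ℕ → Vector ℚ k
      x n i = seq (v i) n

    -- The Rayleigh quotient identity cleared of its denominator, since an approximant of a nonzero
    -- vector may itself be zero. It is null rather than zero because `x n` only approximates the
    -- eigenvector.
    residual : ℕ → ℚ
    residual n = form G (x n) -′ seq lam n *′ ‖ x n ‖²

    x·Q·x : ∀ i n → x n i *′ seq ((Q G · v) i) n ≡ sum (λ j → weight G i j *′ (x n i *′ x n i +′ x n i *′ x n j))
    x·Q·x i n = begin
      a *′ seq ((Q G · v) i) n
        ≡⟨ cong (a *′_) (trans (seq-Q·v G v i n) (cong (_+′ sum (λ j → weight G i j *′ x n j))
             (trans (cong (_*′ a) (sym (sum-weight G i))) (*-distribʳ-sum a (weight G i))))) ⟩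
      a *′ (sum (λ j → weight G i j *′ a) +′ sum (λ j → weight G i j *′ x n j))
        ≡⟨ cong (a *′_) (∑-distrib-+ (λ j → weight G i j *′ a) (λ j → weight G i j *′ x n j)) ⟨
      a *′ sum (λ j → weight G i j *′ a +′ weight G i j *′ x n j)
        ≡⟨ *-distribˡ-sum a (λ j → weight G i j *′ a +′ weight G i j *′ x n j) ⟩
      sum (λ j → a *′ (weight G i j *′ a +′ weight G i j *′ x n j))
        ≡⟨ sum-cong-≗ (λ j → rearrange a (weight G i j) (x n j)) ⟩
      sum (λ j → weight G i j *′ (a *′ a +′ a *′ x n j)) ∎
      where
      open ≡-Reasoning
      a = x n i
      rearrange : ∀ a w b → a *′ (w *′ a +′ w *′ b) ≡ w *′ (a *′ a +′ a *′ b)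
      rearrange = solve-∀ ring

    -- The residual is the product of `x n` with the defect of the eigenvalue equation: in each
    -- coordinate a bounded sequence times a null one.
    residual-null : Null residual
    residual-null = null-cong identity
      (null-sum λ i → null-* (cauchy⇒bounded (seq (v i)) (cauchy (v i))) (_≈_.close (eigen i)))
      where
      open ≡-Reasoning
      identity : ∀ n → sum (λ i → x n i *′ (seq ((Q G · v) i) n -′ seq lam n *′ x n i)) ≡ residual n
      identity n = begin
        sum (λ i → x n i *′ (seq ((Q G · v) i) n -′ seq lam n *′ x n i))
          ≡⟨ sum-cong-≗ (λ i → trans (expand (x n i) (seq ((Q G · v) i) n) (seq lam n))
               (cong (_+′ (ℚ.- seq lam n) *′ (x n i *′ x n i)) (x·Q·x i n))) ⟩
        sum (λ i → row i +′ (ℚ.- seq lam n) *′ (x n i *′ x n i))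
          ≡⟨ ∑-distrib-+ row (λ i → (ℚ.- seq lam n) *′ (x n i *′ x n i)) ⟩
        form G (x n) +′ sum (λ i → (ℚ.- seq lam n) *′ (x n i *′ x n i))
          ≡⟨ cong (form G (x n) +′_) (trans (sym (*-distribˡ-sum (ℚ.- seq lam n) (λ i → x n i *′ x n i)))
               (sym (ℚ.neg-distribˡ-* (seq lam n) ‖ x n ‖²))) ⟩
        residual n ∎
        where
        row = λ i → sum (λ j → weight G i j *′ (x n i *′ x n i +′ x n i *′ x n j))
        expand : ∀ a q l → a *′ (q -′ l *′ a) ≡ a *′ q +′ (ℚ.- l) *′ (a *′ a)
        expand = solve-∀ ring

    module _ (nonzero : ¬ (∀ j → v j ≈ 0ℝ)) where

      -- If y stayed above some η > 0, then ‖x‖² would tend to 0.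
      residual-bound : ∀ y → (∀ n → seq y n *′ ‖ x n ‖² ≤′ ∣ residual n ∣ℚ) →
        ∀ ε → ℚ.0ℚ <′ ε → ∃[ N ] ∀ n → N ℕ.≤ n → seq y n ≤′ ε
      residual-bound y h ε 0<ε =
        [ id , (λ (η , M , 0<η , η≤y) → contradiction (vanish η M 0<η η≤y) nonzero) ]′
          (sign-split (seq y) (cauchy y) ε 0<ε)
        where
        open ℚ.≤-Reasoning
        vanish : ∀ η M → ℚ.0ℚ <′ η → (∀ n → M ℕ.≤ n → η ≤′ seq y n) → ∀ j → v j ≈ 0ℝ
        vanish η M 0<η η≤y j = mk≈ λ δ 0<δ →
          let N , r = residual-null (η *′ (δ *′ δ)) (0<* 0<η (0<* 0<δ 0<δ)) in
          M ℕ.⊔ N , λ n n≥ → subst (λ p → ∣ p ∣ℚ ≤′ δ) (sym (ℚ.+-identityʳ (x n j)))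
            (square-cancel-≤ (ℚ.<⇒≤ 0<δ) (*-cancelˡ 0<η (begin
              η *′ (∣ x n j ∣ℚ *′ ∣ x n j ∣ℚ) ≡⟨ cong (η *′_) (∣p∣*∣p∣≡p*p (x n j)) ⟩
              η *′ (x n j *′ x n j)   ≤⟨ *-monoˡ (ℚ.<⇒≤ 0<η) (term≤sum (λ i → x n i *′ x n i) (λ i → 0≤square (x n i)) j) ⟩
              η *′ ‖ x n ‖²           ≤⟨ *-monoʳ (0≤‖‖² (x n)) (η≤y n (ℕ.m⊔n≤o⇒m≤o M N n≥)) ⟩
              seq y n *′ ‖ x n ‖²     ≤⟨ h n ⟩
              ∣ residual n ∣ℚ         ≤⟨ r n (ℕ.m⊔n≤o⇒n≤o M N n≥) ⟩
              η *′ (δ *′ δ)           ∎)))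

      eigenvalue-upper : ∀ U → (∀ x → form G x ≤′ U *′ ‖ x ‖²) →
        ∀ ε → ℚ.0ℚ <′ ε → ∃[ N ] ∀ n → N ℕ.≤ n → seq lam n -′ U ≤′ ε
      eigenvalue-upper U upper = residual-bound (lam - fromℚ U) λ n → begin
        (seq lam n -′ U) *′ ‖ x n ‖²                                      ≡⟨ rearrange (seq lam n) U ‖ x n ‖² ⟩
        seq lam n *′ ‖ x n ‖² -′ U *′ ‖ x n ‖²                            ≤⟨ ℚ.+-monoʳ-≤ (seq lam n *′ ‖ x n ‖²) (ℚ.neg-antimono-≤ (upper (x n))) ⟩
        seq lam n *′ ‖ x n ‖² -′ form G (x n)                             ≤⟨ p≤∣p∣ (seq lam n *′ ‖ x n ‖² -′ form G (x n)) ⟩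
        ∣ seq lam n *′ ‖ x n ‖² -′ form G (x n) ∣ℚ                        ≡⟨ ∣p-q∣≡∣q-p∣ (seq lam n *′ ‖ x n ‖²) (form G (x n)) ⟩
        ∣ residual n ∣ℚ                                                   ∎
        where
        open ℚ.≤-Reasoning
        rearrange : ∀ l u X → (l -′ u) *′ X ≡ l *′ X -′ u *′ X
        rearrange = solve-∀ ring

      eigenvalue-lower : ∀ L → (∀ x → L *′ ‖ x ‖² ≤′ form G x) →
        ∀ ε → ℚ.0ℚ <′ ε → ∃[ N ] ∀ n → N ℕ.≤ n → L -′ seq lam n ≤′ ε
      eigenvalue-lower L lower = residual-bound (fromℚ L - lam) λ n → begin
        (L -′ seq lam n) *′ ‖ x n ‖²                                      ≡⟨ rearrange L (seq lam n) ‖ x n ‖² ⟩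
        L *′ ‖ x n ‖² -′ seq lam n *′ ‖ x n ‖²                            ≤⟨ ℚ.+-monoˡ-≤ (ℚ.- (seq lam n *′ ‖ x n ‖²)) (lower (x n)) ⟩
        residual n                                                        ≤⟨ p≤∣p∣ (residual n) ⟩
        ∣ residual n ∣ℚ                                                   ∎
        where
        open ℚ.≤-Reasoning
        rearrange : ∀ l u X → (l -′ u) *′ X ≡ l *′ X -′ u *′ X
        rearrange = solve-∀ ring

  spread-bound : ∀ {k} (G : Graph (suc k)) s → QSpread G s → ∀ U L →
    (∀ x → form G x ≤′ U *′ ‖ x ‖²) → (∀ x → L *′ ‖ x ‖² ≤′ form G x) → s ≤ fromℚ (U -′ L)
  spread-bound {k} G s (q , E , s≈) U L upper lower = mk≤ below
    where
    open ℚ.≤-Reasoning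
    open Eigenvalues E
    open Data.Rational.Base using (½)
    last = Fin.fromℕ k
    combine : ∀ s a b U L → s -′ (a -′ b) +′ ((a -′ U) +′ (L -′ b)) +′ (U -′ L) ≡ s
    combine = solve-∀ ring
    collect : ∀ ε p → ½ *′ ε +′ (½ *′ (½ *′ ε) +′ ½ *′ (½ *′ ε)) +′ p ≡ p +′ ε
    collect = solve-∀ ring
    nonzero : ∀ i → ¬ (∀ j → vectors i j ≈ 0ℝ)
    nonzero = independent⇒nonzero vectors independent
    below : ∀ ε → ℚ.0ℚ <′ ε → ∃[ N ] ∀ n → N ℕ.≤ n → seq s n ≤′ (U -′ L) +′ ε
    below ε 0<ε =
      let N₁ , h₁ = _≈_.close s≈ (½ *′ ε) (0<½* 0<ε)
          N₂ , h₂ = eigenvalue-upper G (q zero) (vectors zero) (eigen zero) (nonzero zero)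
                      U upper (½ *′ (½ *′ ε)) (0<½* (0<½* 0<ε))
          N₃ , h₃ = eigenvalue-lower G (q last) (vectors last) (eigen last) (nonzero last)
                      L lower (½ *′ (½ *′ ε)) (0<½* (0<½* 0<ε))
      in N₁ ℕ.⊔ (N₂ ℕ.⊔ N₃) , λ n n≥ →
      let n≥₂₃ = ℕ.m⊔n≤o⇒n≤o N₁ (N₂ ℕ.⊔ N₃) n≥
          a = seq (q zero) n
          b = seq (q last) n
      in begin
      seq s n
        ≡⟨ combine (seq s n) a b U L ⟨
      seq s n -′ (a -′ b) +′ ((a -′ U) +′ (L -′ b)) +′ (U -′ L)
        ≤⟨ ℚ.+-monoˡ-≤ (U -′ L) (ℚ.+-mono-≤
             (ℚ.≤-trans (p≤∣p∣ (seq s n -′ (a -′ b))) (h₁ n (ℕ.m⊔n≤o⇒m≤o N₁ (N₂ ℕ.⊔ N₃) n≥)))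
             (ℚ.+-mono-≤ (h₂ n (ℕ.m⊔n≤o⇒m≤o N₂ N₃ n≥₂₃)) (h₃ n (ℕ.m⊔n≤o⇒n≤o N₂ N₃ n≥₂₃)))) ⟩
      ½ *′ ε +′ (½ *′ (½ *′ ε) +′ ½ *′ (½ *′ ε)) +′ (U -′ L)
        ≡⟨ collect ε (U -′ L) ⟩
      (U -′ L) +′ ε ∎

-- The spectrum of `K⁺`.

module CliqueSpectrum (l : ℕ) (σ : ℝ) (3≤σ : ∀ n → PendantCliqueForm.3ℚ ℚ.≤ seq σ n)
  (σ² : NullSequences.Null (λ n → seq σ n ℚ.* seq σ n ℚ.-
          ((RationalSums.2ℚ ℚ.* RationalSums.ι (suc l) ℚ.- ℚ.1ℚ) ℚ.* (RationalSums.2ℚ ℚ.* RationalSums.ι (suc l) ℚ.- ℚ.1ℚ) ℚ.+ PendantCliqueForm.8ℚ))) where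
  open Data.Rational.Base using (0ℚ; 1ℚ; ½)
    renaming (_+_ to _+′_; _*_ to _*′_; _-_ to _-′_; -_ to ⊖_; _≤_ to _≤′_; _<_ to _<′_)
  open RationalSums
  open NullSequences
  open SquareRoot using (null-scale)
  open Forms using (weight)
  open Counting using (deg)
  open Reals
  open EigenvalueBounds using (seq-∑; seq-*; seq-Q·v)
  open CliqueRows l

  K : Graph (3 ℕ.+ l)
  K = K⁺ (suc l)

  1≤σ : ∀ n → 1ℚ ≤′ seq σ n
  1≤σ n = ℚ.≤-trans (ℚ.≤ᵇ⇒≤ _) (3≤σ n)

  open CliqueIndependence l (seq σ) 1≤σ

  -- Used at `e = 1` and `e = - 1`, the two signs of the square root, so that one computation of `χ`
  -- covers both roots.
  eigenvalue : ℚ → ℝ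
  eigenvalue e = fromℚ ½ * (fromℚ β + fromℚ e * σ)

  χ-null : ∀ e → e *′ e ≡ 1ℚ → Null (λ n → χ (seq (eigenvalue e) n))
  χ-null e e²≡1 = null-cong (λ n → sym (χ-root e (seq σ n) e²≡1)) (null-scale (½ *′ ½) σ²)

  vec : ∀ {n} → ℝ → ℝ → Vector ℝ n → Vector ℝ (2 ℕ.+ n)
  vec x y v zero          = x
  vec x y v (suc zero)    = y
  vec x y v (suc (suc i)) = v i

  IsEigenvector : ℝ → Vector ℝ (3 ℕ.+ l) → Set
  IsEigenvector r v = ∀ k → (Q K · v) k ≈ r * v k

  is-eigenvector : ∀ r x y v →
    Null (λ n → 1ℚ *′ seq x n +′ seq y n -′ seq r n *′ seq x n) →
    Null (λ n → (1ℚ +′ μ) *′ seq y n +′ (seq x n +′ sum (λ i → seq (v i) n)) -′ seq r n *′ seq y n) →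
    (∀ i → Null (λ n → μ *′ seq (v i) n +′ (seq y n +′ (sum (λ j → seq (v j) n) -′ seq (v i) n)) -′ seq r n *′ seq (v i) n)) →
    IsEigenvector r (vec x y v)
  is-eigenvector r x y v pendant hub others k = mk≈ (null-cong
    (λ n → cong (_-′ seq r n *′ seq (vec x y v k) n) (sym (seq-Q·v K (vec x y v) k n))) (row k))
    where
    w : ℕ → Vector ℚ (3 ℕ.+ l)
    w n j = seq (vec x y v j) n
    row : ∀ k → Null (λ n → ι (deg K k) *′ w n k +′ sum (λ j → weight K k j *′ w n j) -′ seq r n *′ w n k)
    row zero = null-cong (λ n → cong₂ (λ p q → p *′ seq x n +′ q -′ seq r n *′ seq x n)
      (sym deg-pendant) (sym (row-pendant (w n)))) pendant
    row (suc zero) = null-cong (λ n → cong₂ (λ p q → p *′ seq y n +′ q -′ seq r n *′ seq y n)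
      (sym deg-hub) (sym (row-hub (w n)))) hub
    row (suc (suc i)) = null-cong (λ n → cong₂ (λ p q → p *′ seq (v i) n +′ q -′ seq r n *′ seq (v i) n)
      (sym (deg-rest i)) (sym (row-rest i (w n)))) (others i)

  null-zeros : ∀ {f} → (∀ n → f n ≡ 0ℚ) → Null f
  null-zeros f≗0 = null-cong (λ n → sym (f≗0 n)) null-zero

  vec-root : ℝ → Vector ℝ (3 ℕ.+ l)
  vec-root r = vec (fromℚ μ) (fromℚ μ * r + fromℚ (⊖ μ)) (λ _ → fromℚ (μ -′ 1ℚ) * r + fromℚ (2ℚ -′ μ))

  vec-root-eigen : ∀ r → Null (λ n → χ (seq r n)) → IsEigenvector r (vec-root r)
  vec-root-eigen r χ→0 = is-eigenvector r (fromℚ μ) (fromℚ μ * r + fromℚ (⊖ μ))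
    (λ _ → fromℚ (μ -′ 1ℚ) * r + fromℚ (2ℚ -′ μ))
    (null-zeros λ n → exact μ (seq r n))
    (null-cong (λ n → sym (trans
      (cong (λ h → (1ℚ +′ μ) *′ hub-entry (seq r n) +′ (μ +′ h) -′ seq r n *′ hub-entry (seq r n))
        (sum-const (suc l) (tail-entry (seq r n))))
      (hub-equation (seq r n)))) (null-scale (⊖ μ) χ→0))
    (λ _ → null-cong (λ n → sym (trans
      (cong (λ h → μ *′ tail-entry (seq r n) +′ (hub-entry (seq r n) +′ (h -′ tail-entry (seq r n))) -′ seq r n *′ tail-entry (seq r n))
        (sum-const (suc l) (tail-entry (seq r n))))
      (rest-equation (seq r n)))) (null-scale (1ℚ -′ μ) χ→0))
    where
    exact : ∀ μ r → 1ℚ *′ μ +′ (μ *′ r +′ (⊖ μ)) -′ r *′ μ ≡ 0ℚ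
    exact = solve-∀ ring

  vec-middle : Vector ℝ (3 ℕ.+ l)
  vec-middle = vec 1ℝ (fromℚ (μ -′ 1ℚ)) (λ _ → fromℚ (⊖ 1ℚ))

  vec-middle-eigen : IsEigenvector (fromℚ μ) vec-middle
  vec-middle-eigen = is-eigenvector (fromℚ μ) 1ℝ (fromℚ (μ -′ 1ℚ)) (λ _ → fromℚ (⊖ 1ℚ))
    (null-zeros λ _ → pendant μ)
    (null-zeros λ _ → trans
      (cong (λ h → (1ℚ +′ μ) *′ (μ -′ 1ℚ) +′ (1ℚ +′ h) -′ μ *′ (μ -′ 1ℚ)) (sum-const (suc l) (⊖ 1ℚ)))
      (hub μ))
    (λ _ → null-zeros λ _ → trans
      (cong (λ h → μ *′ (⊖ 1ℚ) +′ (μ -′ 1ℚ +′ (h -′ (⊖ 1ℚ))) -′ μ *′ (⊖ 1ℚ)) (sum-const (suc l) (⊖ 1ℚ)))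
      (others μ))
    where
    pendant : ∀ μ → 1ℚ *′ 1ℚ +′ (μ -′ 1ℚ) -′ μ *′ 1ℚ ≡ 0ℚ
    pendant = solve-∀ ring
    hub : ∀ μ → (1ℚ +′ μ) *′ (μ -′ 1ℚ) +′ (1ℚ +′ μ *′ (⊖ 1ℚ)) -′ μ *′ (μ -′ 1ℚ) ≡ 0ℚ
    hub = solve-∀ ring
    others : ∀ μ → μ *′ (⊖ 1ℚ) +′ (μ -′ 1ℚ +′ (μ *′ (⊖ 1ℚ) -′ (⊖ 1ℚ))) -′ μ *′ (⊖ 1ℚ) ≡ 0ℚ
    others = solve-∀ ring

  vec-difference : Fin (suc l) → Vector ℝ (3 ℕ.+ l)
  vec-difference i = vec 0ℝ 0ℝ (λ j → fromℚ (δ i j -′ δ last j))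

  sum-difference : ∀ i → sum (λ j → δ i j -′ δ last j) ≡ 0ℚ
  sum-difference i = trans (sum-cong-≗ λ j → negate (δ i j) (δ last j))
    (trans (∑-distrib-+ (δ i) (λ j → (⊖ 1ℚ) *′ δ last j))
      (cong₂ _+′_ (sum-δ-1 i) (trans (sym (*-distribˡ-sum (⊖ 1ℚ) (δ last))) (cong ((⊖ 1ℚ) *′_) (sum-δ-1 last)))))
    where
    negate : ∀ p q → p -′ q ≡ p +′ (⊖ 1ℚ) *′ q
    negate = solve-∀ ring

  vec-difference-eigen : ∀ i → IsEigenvector (fromℚ (μ -′ 1ℚ)) (vec-difference i)
  vec-difference-eigen i = is-eigenvector (fromℚ (μ -′ 1ℚ)) 0ℝ 0ℝ (λ j → fromℚ (δ i j -′ δ last j))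
    (null-zeros λ _ → pendant μ)
    (null-zeros λ _ → trans
      (cong (λ h → (1ℚ +′ μ) *′ 0ℚ +′ (0ℚ +′ h) -′ (μ -′ 1ℚ) *′ 0ℚ) (sum-difference i)) (hub μ))
    (λ j → null-zeros λ _ → trans
      (cong (λ h → μ *′ (δ i j -′ δ last j) +′ (0ℚ +′ (h -′ (δ i j -′ δ last j))) -′ (μ -′ 1ℚ) *′ (δ i j -′ δ last j))
        (sum-difference i))
      (others μ (δ i j -′ δ last j)))
    where
    pendant : ∀ μ → 1ℚ *′ 0ℚ +′ 0ℚ -′ (μ -′ 1ℚ) *′ 0ℚ ≡ 0ℚ
    pendant = solve-∀ ring
    hub : ∀ μ → (1ℚ +′ μ) *′ 0ℚ +′ (0ℚ +′ 0ℚ) -′ (μ -′ 1ℚ) *′ 0ℚ ≡ 0ℚ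
    hub = solve-∀ ring
    others : ∀ μ p → μ *′ p +′ (0ℚ +′ (0ℚ -′ p)) -′ (μ -′ 1ℚ) *′ p ≡ 0ℚ
    others = solve-∀ ring

  -- The small root must stand at the greatest index. It takes the place of the difference vector of
  -- `last` with itself, which would be zero; the other `l` such slots carry the eigenvalue `m - 1`.
  values : Vector ℝ (3 ℕ.+ l)
  values = vec (eigenvalue 1ℚ) (fromℚ μ)
    (λ i → if does (last ≟ i) then eigenvalue (⊖ 1ℚ) else fromℚ (μ -′ 1ℚ))

  vecs : Fin (3 ℕ.+ l) → Vector ℝ (3 ℕ.+ l)
  vecs zero          = vec-root (eigenvalue 1ℚ)
  vecs (suc zero)    = vec-middle
  vecs (suc (suc i)) = if does (last ≟ i) then vec-root (eigenvalue (⊖ 1ℚ)) else vec-difference i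

  vecs-eigen : ∀ i → IsEigenvector (values i) (vecs i)
  vecs-eigen zero          = vec-root-eigen (eigenvalue 1ℚ) (χ-null 1ℚ refl)
  vecs-eigen (suc zero)    = vec-middle-eigen
  vecs-eigen (suc (suc i)) = cases (does (last ≟ i))
    where
    cases : ∀ b → IsEigenvector (if b then eigenvalue (⊖ 1ℚ) else fromℚ (μ -′ 1ℚ))
                                (if b then vec-root (eigenvalue (⊖ 1ℚ)) else vec-difference i)
    cases true  = vec-root-eigen (eigenvalue (⊖ 1ℚ)) (χ-null (⊖ 1ℚ) refl)
    cases false = vec-difference-eigen i

  ≤-pointwise : ∀ {x y} → (∀ n → seq x n ≤′ seq y n) → x ≤ y
  ≤-pointwise {x} {y} h = mk≤ λ ε 0<ε → 0 , λ n _ → ℚ.≤-trans (h n) (≤-by ε (ℚ.<⇒≤ 0<ε) refl)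

  values-nonincreasing : ∀ {i j} → i Fin.≤ j → values j ≤ values i
  values-nonincreasing {i} {j} = order i j
    where
    -- For `r₋ = (2m + 1 - s)/2` this is equivalent to `3 ≤ s`.
    r₋≤ : ∀ n → seq (eigenvalue (⊖ 1ℚ)) n ≤′ μ -′ 1ℚ
    r₋≤ n = ≤-by _ (0≤* 0≤½ (0≤-difference (3≤σ n))) (gap μ (seq σ n))
      where
      gap : ∀ μ s → ½ *′ (2ℚ *′ μ +′ 1ℚ +′ (⊖ 1ℚ) *′ s) +′ ½ *′ (s -′ (2ℚ +′ 1ℚ)) ≡ μ -′ 1ℚ
      gap = solve-∀ ring
    μ-1≤μ : μ -′ 1ℚ ≤′ μ
    μ-1≤μ = ≤-by 1ℚ (ℚ.nonNegative⁻¹ 1ℚ) (gap μ)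
      where
      gap : ∀ μ → μ -′ 1ℚ +′ 1ℚ ≡ μ
      gap = solve-∀ ring
    μ≤r₊ : ∀ n → μ ≤′ seq (eigenvalue 1ℚ) n
    μ≤r₊ n = ≤-by _ (0≤* 0≤½ (0≤+ (ℚ.nonNegative⁻¹ 1ℚ) (ℚ.≤-trans (ℚ.nonNegative⁻¹ 1ℚ) (1≤σ n)))) (gap μ (seq σ n))
      where
      gap : ∀ μ s → μ +′ ½ *′ (1ℚ +′ s) ≡ ½ *′ (2ℚ *′ μ +′ 1ℚ +′ 1ℚ *′ s)
      gap = solve-∀ ring
    ≤-top : ∀ b n → seq (if b then eigenvalue (⊖ 1ℚ) else fromℚ (μ -′ 1ℚ)) n ≤′ μ -′ 1ℚ
    ≤-top true  n = r₋≤ n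
    ≤-top false n = ℚ.≤-refl
    among : ∀ {i j} (di : Dec (last ≡ i)) (dj : Dec (last ≡ j)) → i Fin.≤ j →
      (if does dj then eigenvalue (⊖ 1ℚ) else fromℚ (μ -′ 1ℚ))
        ≤ (if does di then eigenvalue (⊖ 1ℚ) else fromℚ (μ -′ 1ℚ))
    among (yes _)    (yes _)    _   = ≤-pointwise λ _ → ℚ.≤-refl
    among (yes refl) (no last≢) i≤j = contradiction (≤-antisym i≤j (≤fromℕ _)) last≢
    among (no _)     (yes _)    _   = ≤-pointwise r₋≤
    among (no _)     (no _)     _   = ≤-pointwise λ _ → ℚ.≤-refl
    order : ∀ i j → i Fin.≤ j → values j ≤ values i
    order zero          zero          _ = ≤-pointwise λ _ → ℚ.≤-refl
    order zero          (suc zero)    _ = ≤-pointwise μ≤r₊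
    order zero          (suc (suc j)) _ = ≤-pointwise λ n →
      ℚ.≤-trans (≤-top (does (last ≟ j)) n) (ℚ.≤-trans μ-1≤μ (μ≤r₊ n))
    order (suc zero)    (suc zero)    _ = ≤-pointwise λ _ → ℚ.≤-refl
    order (suc zero)    (suc (suc j)) _ = ≤-pointwise λ n → ℚ.≤-trans (≤-top (does (last ≟ j)) n) μ-1≤μ
    order (suc (suc i)) (suc (suc j)) (ℕ.s≤s (ℕ.s≤s i≤j)) = among (last ≟ i) (last ≟ j) i≤j
    order (suc zero)    zero          ()
    order (suc (suc i)) zero          ()
    order (suc (suc i)) (suc zero)    (ℕ.s≤s ())

  -- vec-difference last = 0, so both branches of vecs fit one formula.
  seq-vecs : ∀ i k n → seq (vecs (suc (suc i)) k) n
    ≡ δ last i *′ seq (vec-root (eigenvalue (⊖ 1ℚ)) k) n +′ seq (vec-difference i k) n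
  seq-vecs i k n = cases (last ≟ i)
    where
    y = seq (vec-root (eigenvalue (⊖ 1ℚ)) k) n
    vanish : ∀ k → seq (vec-difference last k) n ≡ 0ℚ
    vanish zero          = refl
    vanish (suc zero)    = refl
    vanish (suc (suc j)) = ℚ.+-inverseʳ (δ last j)
    cases : (dec : Dec (last ≡ i)) →
      seq ((if does dec then vec-root (eigenvalue (⊖ 1ℚ)) else vec-difference i) k) n
      ≡ (if does dec then 1ℚ else 0ℚ) *′ y +′ seq (vec-difference i k) n
    cases (yes refl) = sym (trans (cong (1ℚ *′ y +′_) (vanish k)) (trans (ℚ.+-identityʳ (1ℚ *′ y)) (ℚ.*-identityˡ y)))
    cases (no _)     = sym (trans (cong (_+′ seq (vec-difference i k) n) (ℚ.*-zeroˡ y)) (ℚ.+-identityˡ _))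

  vecs-independent : LinearlyIndependent vecs
  vecs-independent c combination = null-coefficients
    where
    a b : ℕ → ℚ
    a = seq (c zero)
    b = seq (c (suc zero))
    C : Fin (suc l) → ℕ → ℚ
    C i = seq (c (suc (suc i)))

    -- Coordinate `k` of the vanishing combination, in the shape that `CliqueIndependence` expects.
    -- `D` collects the difference vectors; it is `0` at the pendant vertex and at the hub.
    coordinate : ∀ k (D : ℕ → ℚ) →
      (∀ n → sum (λ i → C i n *′ seq (vec-difference i k) n) ≡ D n) →
      Null (λ n → a n *′ seq (vec-root (eigenvalue 1ℚ) k) n +′ (b n *′ seq (vec-middle k) n
        +′ (C last n *′ seq (vec-root (eigenvalue (⊖ 1ℚ)) k) n +′ D n)))
    coordinate k D hD = null-cong (λ n → trans (ℚ.+-identityʳ (seq (∑ (λ i → c i * vecs i k)) n)) (trans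
      (seq-∑ (λ i → c i * vecs i k) n)
      (cong (λ h → a n *′ seq (vec-root (eigenvalue 1ℚ) k) n +′ (b n *′ seq (vec-middle k) n +′ h)) (tail n))))
      (_≈_.close (combination k))
      where
      open ≡-Reasoning
      y : ℕ → ℚ
      y n = seq (vec-root (eigenvalue (⊖ 1ℚ)) k) n
      tail : ∀ n → sum (λ i → seq (c (suc (suc i)) * vecs (suc (suc i)) k) n) ≡ C last n *′ y n +′ D n
      tail n = begin
        sum (λ i → seq (c (suc (suc i)) * vecs (suc (suc i)) k) n)
          ≡⟨ sum-cong-≗ (λ i → trans (seq-* (c (suc (suc i))) (vecs (suc (suc i)) k) n)
               (trans (cong (C i n *′_) (seq-vecs i k n)) (expand (C i n) (δ last i) (y n) (seq (vec-difference i k) n)))) ⟩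
        sum (λ i → δ last i *′ (C i n *′ y n) +′ C i n *′ seq (vec-difference i k) n)
          ≡⟨ ∑-distrib-+ (λ i → δ last i *′ (C i n *′ y n)) (λ i → C i n *′ seq (vec-difference i k) n) ⟩
        sum (λ i → δ last i *′ (C i n *′ y n)) +′ sum (λ i → C i n *′ seq (vec-difference i k) n)
          ≡⟨ cong₂ _+′_ (sum-δ last (λ i → C i n *′ y n)) (hD n) ⟩
        C last n *′ y n +′ D n ∎
        where
        expand : ∀ c e y u → c *′ (e *′ y +′ u) ≡ e *′ (c *′ y) +′ c *′ u
        expand = solve-∀ ring

    zero-sum : ∀ n → sum (λ i → C i n *′ 0ℚ) ≡ 0ℚ
    zero-sum n = sum-zero λ i → ℚ.*-zeroʳ (C i n)

    difference-sum : ∀ j n → sum (λ i → C i n *′ (δ i j -′ δ last j)) ≡ C j n -′ δ last j *′ sum (λ i → C i n)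
    difference-sum j n = trans
      (sum-cong-≗ λ i → trans (cong (λ h → C i n *′ (h -′ δ last j)) (cong (if_then 1ℚ else 0ℚ) (does-≟-sym i j)))
        (expand (C i n) (δ j i) (δ last j)))
      (trans (∑-distrib-+ (λ i → δ j i *′ C i n) (λ i → (⊖ δ last j) *′ C i n))
        (trans (cong₂ _+′_ (sum-δ j (λ i → C i n)) (sym (*-distribˡ-sum (⊖ δ last j) (λ i → C i n))))
          (cong (C j n +′_) (sym (ℚ.neg-distribˡ-* (δ last j) (sum (λ i → C i n)))))))
      where
      expand : ∀ c p q → c *′ (p -′ q) ≡ p *′ c +′ (⊖ q) *′ c
      expand = solve-∀ ring

    drop-zero : ∀ (p q r : ℕ → ℚ) → Null (λ n → p n +′ (q n +′ (r n +′ 0ℚ))) → Null (λ n → p n +′ (q n +′ r n))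
    drop-zero p q r = null-cong λ n → cong (λ h → p n +′ (q n +′ h)) (ℚ.+-identityʳ (r n))

    pendant : Null (λ n → a n *′ μ +′ (b n *′ 1ℚ +′ C last n *′ μ))
    pendant = drop-zero (λ n → a n *′ μ) (λ n → b n *′ 1ℚ) (λ n → C last n *′ μ)
      (coordinate zero (λ _ → 0ℚ) zero-sum)
    hub : Null (λ n → a n *′ hub-entry (r₊ n) +′ (b n *′ (μ -′ 1ℚ) +′ C last n *′ hub-entry (r₋ n)))
    hub = drop-zero (λ n → a n *′ hub-entry (r₊ n)) (λ n → b n *′ (μ -′ 1ℚ)) (λ n → C last n *′ hub-entry (r₋ n))
      (coordinate (suc zero) (λ _ → 0ℚ) zero-sum)
    others : ∀ j → Null (λ n → a n *′ tail-entry (r₊ n) +′ (b n *′ (⊖ 1ℚ)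
      +′ (C last n *′ tail-entry (r₋ n) +′ (C j n -′ δ last j *′ sum (λ i → C i n)))))
    others j = coordinate (suc (suc j)) (λ n → C j n -′ δ last j *′ sum (λ i → C i n)) (difference-sum j)

    to-zero : ∀ x → Null (seq x) → x ≈ 0ℝ
    to-zero x nx = mk≈ (null-cong (λ n → sym (ℚ.+-identityʳ (seq x n))) nx)

    null-coefficients : ∀ i → c i ≈ 0ℝ
    null-coefficients zero          = to-zero (c zero) (a-null a b C pendant hub others)
    null-coefficients (suc zero)    = to-zero (c (suc zero)) (b-null a b C pendant hub others)
    null-coefficients (suc (suc j)) = to-zero (c (suc (suc j))) (C-null a b C pendant hub others j)

  spectrum : Eigenvalues (Q K) values
  spectrum = record
    { nonincreasing = values-nonincreasing
    ; vectors       = vecs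
    ; independent   = vecs-independent
    ; eigen         = vecs-eigen
    }

  spread : QSpread K σ
  spread = values , spectrum , ≗⇒≈ (λ n → trans (difference β (seq σ n)) (cong (seq (eigenvalue 1ℚ) n -′_) (sym (last-value n))))
    where
    difference : ∀ β s → s ≡ ½ *′ (β +′ 1ℚ *′ s) -′ ½ *′ (β +′ (⊖ 1ℚ) *′ s)
    difference = solve-∀ ring
    last-value : ∀ n → seq (values (Fin.fromℕ (2 ℕ.+ l))) n ≡ seq (eigenvalue (⊖ 1ℚ)) n
    last-value n = cases (last ≟ last)
      where
      cases : (dec : Dec (last ≡ last)) →
        seq (if does dec then eigenvalue (⊖ 1ℚ) else fromℚ (μ -′ 1ℚ)) n ≡ seq (eigenvalue (⊖ 1ℚ)) n
      cases (yes _)       = refl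
      cases (no last≢last) = contradiction refl last≢last

-- Pendant cliques are isomorphic to `K⁺`.

module Isomorphism where
  vertex-cases : ∀ {n} (P : Fin (suc n) → Set) z → P z → (∀ i → P (punchIn z i)) → ∀ i → P i
  vertex-cases P z pz pi i with z ≟ i
  ... | yes refl = pz
  ... | no z≢i   = subst P (punchIn-punchOut z≢i) (pi (punchOut z≢i))

  insert-self : ∀ {n} i j (π : Permutation′ n) → insert i j π ⟨$⟩ʳ i ≡ j
  insert-self i j π with i ≟ i
  ... | yes _  = refl
  ... | no i≢i = contradiction refl i≢i

  does-permute : ∀ {n} (π : Permutation′ n) i j → does (i ≟ j) ≡ does ((π ⟨$⟩ʳ i) ≟ (π ⟨$⟩ʳ j))
  does-permute π i j with i ≟ j | (π ⟨$⟩ʳ i) ≟ (π ⟨$⟩ʳ j)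
  ... | yes _    | yes _   = refl
  ... | no _     | no _    = refl
  ... | yes refl | no πi≢  = contradiction refl πi≢
  ... | no i≢j   | yes πi≡ = contradiction
    (trans (sym (inverseˡ π)) (trans (cong (Perm._⟨$⟩ˡ_ π) πi≡) (inverseˡ π))) i≢j

  pendantClique⇒≅K⁺ : ∀ {m} (G : Graph (2 ℕ.+ m)) {z w} → PendantClique G z w → G ≅ K⁺ m
  pendantClique⇒≅K⁺ {m} G {z} {w} pc = π ,
    vertex-cases (λ i → ∀ j → adj G i j ≡ adj (K⁺ m) (π ⟨$⟩ʳ i) (π ⟨$⟩ʳ j)) z
      (vertex-cases (λ j → adj G z j ≡ adj (K⁺ m) (π ⟨$⟩ʳ z) (π ⟨$⟩ʳ j)) z loop z-row)
      (λ i → vertex-cases (λ j → adj G (punchIn z i) j ≡ adj (K⁺ m) (π ⟨$⟩ʳ punchIn z i) (π ⟨$⟩ʳ j)) z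
        (trans (Graph.symm G (punchIn z i) z)
          (trans (z-row i) (Graph.symm (K⁺ m) (π ⟨$⟩ʳ z) (π ⟨$⟩ʳ punchIn z i))))
        (block i))
    where
    open PendantClique pc
    -- On the clique, `w` is sent to the vertex `zero` that carries the pendant edge of `K⁺`; `π`
    -- then extends this by sending `z` to the pendant vertex.
    ρ : Permutation′ (suc m)
    ρ = insert w zero Perm.id
    π : Permutation′ (2 ℕ.+ m)
    π = insert z zero ρ
    πz : π ⟨$⟩ʳ z ≡ zero
    πz = insert-self z zero ρ
    πp : ∀ i → π ⟨$⟩ʳ punchIn z i ≡ suc (ρ ⟨$⟩ʳ i)
    πp = insert-punchIn z zero ρ
    loop : adj G z z ≡ adj (K⁺ m) (π ⟨$⟩ʳ z) (π ⟨$⟩ʳ z)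
    loop = trans (Graph.irrefl G z) (sym (Graph.irrefl (K⁺ m) (π ⟨$⟩ʳ z)))
    z-row : ∀ j → adj G z (punchIn z j) ≡ adj (K⁺ m) (π ⟨$⟩ʳ z) (π ⟨$⟩ʳ punchIn z j)
    z-row j = begin
      adj G z (punchIn z j)                                ≡⟨ pendant j ⟩
      does (j ≟ w)                                         ≡⟨ does-permute ρ j w ⟩
      does ((ρ ⟨$⟩ʳ j) ≟ (ρ ⟨$⟩ʳ w))                       ≡⟨ cong (λ v → does ((ρ ⟨$⟩ʳ j) ≟ v)) (insert-self w zero Perm.id) ⟩
      does ((ρ ⟨$⟩ʳ j) ≟ zero)                             ≡⟨ cong₂ (adj (K⁺ m)) πz (πp j) ⟨
      adj (K⁺ m) (π ⟨$⟩ʳ z) (π ⟨$⟩ʳ punchIn z j)           ∎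
      where open ≡-Reasoning
    block : ∀ i j → adj G (punchIn z i) (punchIn z j) ≡ adj (K⁺ m) (π ⟨$⟩ʳ punchIn z i) (π ⟨$⟩ʳ punchIn z j)
    block i j = begin
      adj G (punchIn z i) (punchIn z j)                              ≡⟨ clique i j ⟩
      not (does (i ≟ j))                                             ≡⟨ cong not (does-permute ρ i j) ⟩
      not (does ((ρ ⟨$⟩ʳ i) ≟ (ρ ⟨$⟩ʳ j)))                           ≡⟨ cong₂ (adj (K⁺ m)) (πp i) (πp j) ⟨
      adj (K⁺ m) (π ⟨$⟩ʳ punchIn z i) (π ⟨$⟩ʳ punchIn z j)           ∎
      where open ≡-Reasoning

-- Maximality of `K⁺` and uniqueness.

K⁺-connected : ∀ m → Connected (K⁺ m)
K⁺-connected m i j = to-hub i ◅◅ from-hub j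
  where
  to-hub : ∀ i → Star (λ u v → adj (K⁺ m) u v ≡ true) i (suc zero)
  to-hub zero          = refl ◅ done
  to-hub (suc zero)    = done
  to-hub (suc (suc i)) = refl ◅ done
  from-hub : ∀ i → Star (λ u v → adj (K⁺ m) u v ≡ true) (suc zero) i
  from-hub zero          = refl ◅ done
  from-hub (suc zero)    = done
  from-hub (suc (suc i)) = refl ◅ done

module MaximumSpread (l : ℕ) (40≤m : 40 ℕ.≤ suc l) where
  open SpreadRoot (suc l) 40≤m
  open Data.Rational.Base using (0ℚ; 1ℚ; ½)
    renaming (_+_ to _+′_; _*_ to _*′_; _-_ to _-′_; -_ to ⊖_; _≤_ to _≤′_; _<_ to _<′_)
  open RationalSums
  open NullSequences using (0<½*; ∣p-q∣≤ε⇒p≤q+ε)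
  open Forms using (form)
  open EigenvalueBounds using (spread-bound)
  open Classification using (Bounds; classify; threshold)
  open PendantCliqueForm using (pendantClique-bounds)
  open CliqueSpectrum l σ 3≤σ σ²→M using (spread)

  K : Graph (3 ℕ.+ l)
  K = K⁺ (suc l)

  -- Form bounds have rational coefficients, so they compare `t` with one approximant at a time; the
  -- slack in the order lets the comparison pass to the limit.
  ≤-by-approximants : ∀ t → (∀ k → t ≤ fromℚ (seq σ k)) → t ≤ σ
  ≤-by-approximants t t≤ = mk≤ λ ε 0<ε →
    let N , close = cauchy σ (½ *′ ε) (0<½* 0<ε)
        N′ , below = _≤_.below (t≤ N) (½ *′ ε) (0<½* 0<ε)
    in N ℕ.⊔ N′ , λ n n≥ → begin
      seq t n                                   ≤⟨ below n (ℕ.m⊔n≤o⇒n≤o N N′ n≥) ⟩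
      seq σ N +′ ½ *′ ε                         ≤⟨ ℚ.+-monoˡ-≤ (½ *′ ε) (∣p-q∣≤ε⇒p≤q+ε (seq σ N) (seq σ n)
                                                     (close N n ℕ.≤-refl (ℕ.m⊔n≤o⇒m≤o N N′ n≥))) ⟩
      seq σ n +′ ½ *′ ε +′ ½ *′ ε               ≡⟨ halves (seq σ n) ε ⟩
      seq σ n +′ ε                              ∎
    where
    open ℚ.≤-Reasoning
    halves : ∀ s ε → s +′ ½ *′ ε +′ ½ *′ ε ≡ s +′ ε
    halves = solve-∀ ring

  -- Each approximant `s` of `σ` confines the spectrum to the interval around `(2m + 1)/2` of width
  -- `s`. Since `QSpread` is a relation, this is needed for `K⁺` itself as well as for its other
  -- copies.
  pendantClique-spread : ∀ (G : Graph (3 ℕ.+ l)) {z w} → PendantClique G z w → ∀ t → QSpread G t → t ≤ σ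
  pendantClique-spread G pc t spr = ≤-by-approximants t λ k →
    subst (λ u → t ≤ fromℚ u) (width μ (seq σ k))
      (spread-bound G t spr (½ *′ (2ℚ *′ μ +′ 1ℚ +′ seq σ k)) (½ *′ (2ℚ *′ μ +′ 1ℚ -′ seq σ k))
        (λ x → half-≤ (form G x) (2ℚ *′ μ +′ 1ℚ +′ seq σ k) ‖ x ‖² (proj₁ (bounds k x)))
        (λ x → half-≥ (form G x) (2ℚ *′ μ +′ 1ℚ -′ seq σ k) ‖ x ‖² (proj₂ (bounds k x))))
    where
    bounds : ∀ k x → _
    bounds k = pendantClique-bounds G pc (seq σ k) (3≤σ k) (0<σ-ν k) (8≤product k)
    width : ∀ μ s → ½ *′ (2ℚ *′ μ +′ 1ℚ +′ s) -′ ½ *′ (2ℚ *′ μ +′ 1ℚ -′ s) ≡ s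
    width = solve-∀ ring
    half : ∀ p → ½ *′ (2ℚ *′ p) ≡ p
    half = solve-∀ ring
    half-≤ : ∀ f U X → 2ℚ *′ f ≤′ U *′ X → f ≤′ ½ *′ U *′ X
    half-≤ f U X h = subst₂ _≤′_ (half f) (sym (ℚ.*-assoc ½ U X)) (*-monoˡ 0≤½ h)
    half-≥ : ∀ f L X → L *′ X ≤′ 2ℚ *′ f → ½ *′ L *′ X ≤′ f
    half-≥ f L X h = subst₂ _≤′_ (sym (ℚ.*-assoc ½ L X)) (half f) (*-monoˡ 0≤½ h)

  bounded-spread : ∀ (G : Graph (3 ℕ.+ l)) → Bounds G (threshold (suc l)) → ∀ t → QSpread G t →
    ∀ ε → 0ℚ <′ ε → ∃[ N ] ∀ n → N ℕ.≤ n → seq t n ≤′ threshold (suc l) +′ ε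
  bounded-spread G b t spr ε 0<ε =
    let open Bounds b
        N , below = _≤_.below (spread-bound G t spr U L upper lower) ε 0<ε
    in N , λ n n≥ → ℚ.≤-trans (below n n≥) (ℚ.+-monoˡ-≤ ε gap)

  maximum : ∀ G → Connected G → ∀ t → QSpread G t → t ≤ σ
  maximum G conn t spr =
    [ (λ (z , w , pc) → pendantClique-spread G pc t spr)
    , (λ b → mk≤ λ ε 0<ε →
        let N , below = bounded-spread G b t spr ε 0<ε
        in N , λ n n≥ → ℚ.≤-trans (below n n≥) (ℚ.+-monoˡ-≤ ε (threshold≤σ n)))
    ]′ (classify 40≤m G (Counting.deg-positive G conn))

  attained : AttainsMaximum K σ
  attained = K⁺-connected (suc l) , spread , maximum

  -- A graph with bounded gap has `s` at most the threshold, while maximality against `K` puts `σ`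
  -- at most `s`; the margin `r` between threshold and `σ` excludes both.
  unique : ∀ G s → AttainsMaximum G s → G ≅ K
  unique G s (conn , spr , max) =
    [ (λ (z , w , pc) → Isomorphism.pendantClique⇒≅K⁺ G pc)
    , (λ b → contradiction (too-small b) (ℚ.<-irrefl refl))
    ]′ (classify 40≤m G (Counting.deg-positive G conn))
    where
    open ℚ.≤-Reasoning
    τ = threshold (suc l)
    -- Two slacks are spent, one for each comparison; at `r/4` each they use up only half of the
    -- margin `r`, which keeps the final inequality strict.
    η = ½ *′ (½ *′ r)
    0<η : 0ℚ <′ η
    0<η = 0<½* (0<½* 0<r)
    collect : ∀ τ r → τ +′ ½ *′ (½ *′ r) +′ ½ *′ (½ *′ r) +′ ½ *′ r ≡ τ +′ r
    collect = solve-∀ ring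
    too-small : Bounds G τ → τ +′ r <′ τ +′ r
    too-small b =
      let N₁ , σ≤s = _≤_.below (max K (K⁺-connected (suc l)) σ spread) η 0<η
          N₂ , s≤τ = bounded-spread G b s spr η 0<η
          n = N₁ ℕ.⊔ N₂
      in begin-strict
      τ +′ r                        ≤⟨ threshold+r≤σ n ⟩
      seq σ n                       ≤⟨ σ≤s n (ℕ.m≤m⊔n N₁ N₂) ⟩
      seq s n +′ η                  ≤⟨ ℚ.+-monoˡ-≤ η (s≤τ n (ℕ.m≤n⊔m N₁ N₂)) ⟩
      τ +′ η +′ η                   ≡⟨ ℚ.+-identityʳ (τ +′ η +′ η) ⟨
      τ +′ η +′ η +′ 0ℚ             <⟨ ℚ.+-monoʳ-< (τ +′ η +′ η) (0<½* 0<r) ⟩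
      τ +′ η +′ η +′ ½ *′ r         ≡⟨ collect τ r ⟩
      τ +′ r                        ∎

mainTheorem2 : ∃[ n₀ ] ∀ (m : ℕ) → n₀ ℕ.≤ 2 ℕ.+ m →
    (∃[ s ] AttainsMaximum (K⁺ m) s) ×
    (∀ (G : Graph (2 ℕ.+ m)) (s : ℝ) → AttainsMaximum G s → G ≅ K⁺ m)
-- The graph has `m + 2` vertices, so `40 ≤ m` becomes `42 ≤ n`.
mainTheorem2 = 42 , λ m 42≤2+m → large m (ℕ.+-cancelˡ-≤ 2 40 m 42≤2+m)
  where
  large : ∀ m → 40 ℕ.≤ m →
    (∃[ s ] AttainsMaximum (K⁺ m) s) ×
    (∀ (G : Graph (2 ℕ.+ m)) (s : ℝ) → AttainsMaximum G s → G ≅ K⁺ m)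
  large (suc l) 40≤m = (SpreadRoot.σ (suc l) 40≤m , MaximumSpread.attained l 40≤m) , MaximumSpread.unique l 40≤m
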